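{- For any positive integers $\alpha,m,n,r$, the expression $$\sum_{k=0}^{n-1}(-1)^{k}\,[k(k+1)]^r_{q^2}\,[2k+1]\,q^{(n-1-k)(2\alpha m+1)}\,w_k^{(\alpha)}(x;q^2)^m$$ is divisible, in the ring $\mathbb{Z}[q,q^{ -1}][x]$, by $$\prod_{\substack{d\mid n \\ d>1\text{ odd}}}\Phi_d(q)\cdot\prod_{\substack{d\mid n \\ d>1\text{ even}}}\Phi_d(q^2).$$
   Context: Here $q$ and $x$ are indeterminates. For an integer $N$, $[N]=[N]_q=\frac{1-q^N}{1-q}$ is the $q$-integer, and $[N]_{q^2}=\frac{1-q^{2N}}{1-q^2}$ is the same expression with $q$ replaced by $q^2$; $[k(k+1)]^r_{q^2}$ is the $r$-th power of $[k(k+1)]_{q^2}$. $\Phi_d(q)=\prod_{1\le k\le d,\ \gcd(k,d)=1}(q-e^{2\pi i k/d})\in\mathbb{Z}[q]$ is the $d$-th cyclotomic polynomial. For nonnegative integers $N$ and integers $k$, $\left[\begin{matrix} N \\ k \end{matrix}\right]=\frac{\prod_{1\le j\le k}[N-j+1]}{\prod_{1\le j\le k}[j]}$ is the $q$-binomial coefficient, equal to $1$ if $k=0$ and to $0$ if $k<0$ or $k>N$. For a nonnegative integer $k$ and a positive integer $\alpha$, $$w_k^{(\alpha)}(x;q)=\sum_{j=1}^{k}q^{\alpha\left(\binom{j+1}{2}-(k+1)(j-1)\right)}\left(\left[\begin{matrix} k-1 \\ j-1 \end{matrix}\right]\left[\begin{matrix} k+j \\ j \end{matrix}\right]-\left[\begin{matrix}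 k \\ j \end{matrix}\right]\left[\begin{matrix} k+j \\ j-1 \end{matrix}\right]\right)^{\alpha}x^{j-1}\in\mathbb{Z}[q,q^{ -1}][x],$$ with $w_0^{(\alpha)}(x;q)=0$ (empty sum); $w_k^{(\alpha)}(x;q^2)$ is obtained from it by replacing $q$ by $q^2$ throughout. -}

module Defs where

open import Algebra.Bundles using (CommutativeRing)
open import Algebra.Morphism.Structures using (IsRingHomomorphism)
import Algebra.Morphism.Construct.Identity as Identity
import Algebra.Properties.CommutativeMonoid.Sum as Sum
import Algebra.Properties.CommutativeSemiring.Exp as Exp
import Algebra.Properties.Ring as RingProperties
import Algebra.Properties.Semiring.Divisibility as Divisibility
import Algebra.Solver.Ring.NaturalCoefficients.Default as NatSolver
open import Data.Bool.Base using (if_then_else_)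
open import Data.Fin.Base using (Fin; toℕ)
import Data.Fin.Properties as Fin
open import Data.Integer.Base as ℤ using (ℤ; +_; -[1+_])
import Data.Integer.Properties as ℤ
open import Data.List.Base as List using (List; []; _∷_; length; replicate)
import Data.List.Properties as List
open import Data.Nat.Base as ℕ using (ℕ; zero; suc; z≤n; s≤s; NonZero; z<s; s<s)
import Data.Nat.Combinatorics as ℕ
open import Data.Nat.Divisibility as ℕ using (_∣?_; divides)
import Data.Nat.GCD as ℕ
open import Data.Nat.Induction using (<-rec; <-wellFounded)
import Data.Nat.Properties as ℕ
open import Data.Product.Base using (_,_)
open import Data.Sum.Base using (inj₁; inj₂)
open import Function.Base using (_∘_)
import Induction.WellFounded as WellFounded
open import Level using (Level; 0ℓ; _⊔_)
open import Relation.Binary.PropositionalEquality.Core as ≡ using (_≡_)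
import Relation.Binary.Reasoning.Setoid as SetoidReasoning
open import Relation.Nullary using (Dec; does; yes; no; ¬_; contradiction)

-- R[X]: a polynomial is the list of its coefficients, constant term first; equality compares
-- coefficients, so trailing zeros do not matter.
module Polynomial {c ℓ : Level} (R : CommutativeRing c ℓ) where

  private
    open module R = CommutativeRing R
      using (Carrier; _≈_; 0#; 1#)
      renaming (_+_ to _+ᴿ_; _*_ to _*ᴿ_; -_ to -ᴿ_)
    open RingProperties R.ring using (-0#≈0#; -‿+-comm)
    open SetoidReasoning R.setoid

  Poly : Set c
  Poly = List Carrier

  coeff : Poly → ℕ → Carrier
  coeff []      _       = 0#
  coeff (a ∷ _) zero    = a
  coeff (_ ∷ p) (suc i) = coeff p i

  infix 4 _≋_

  record _≋_ (p q : Poly) : Set ℓ where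
    constructor mk≋
    field at : ∀ i → coeff p i ≈ coeff q i
  open _≋_ public

  infixl 6 _+_
  infixl 7 _*_ _·_
  infix  8 -_

  _+_ : Poly → Poly → Poly
  []      + q       = q
  (a ∷ p) + []      = a ∷ p
  (a ∷ p) + (b ∷ q) = (a +ᴿ b) ∷ (p + q)

  _·_ : Carrier → Poly → Poly
  a · []      = []
  a · (b ∷ q) = (a *ᴿ b) ∷ (a · q)

  -_ : Poly → Poly
  - []      = []
  - (a ∷ p) = (-ᴿ a) ∷ (- p)

  _*_ : Poly → Poly → Poly
  []      * q = []
  (a ∷ p) * q = a · q + (0# ∷ p * q)

  C : Carrier → Poly
  C a = a ∷ []

  X : Poly
  X = 0# ∷ 1# ∷ []

  tail : Poly → Poly
  tail []      = []
  tail (_ ∷ p) = p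

  ≋-refl : ∀ {p} → p ≋ p
  ≋-refl .at i = R.refl

  ≋-sym : ∀ {p q} → p ≋ q → q ≋ p
  ≋-sym e .at i = R.sym (e .at i)

  ≋-trans : ∀ {p q r} → p ≋ q → q ≋ r → p ≋ r
  ≋-trans e f .at i = R.trans (e .at i) (f .at i)

  ∷-cong : ∀ {a b p q} → a ≈ b → p ≋ q → a ∷ p ≋ b ∷ q
  ∷-cong a≈b e .at zero    = a≈b
  ∷-cong a≈b e .at (suc i) = e .at i

  tail-cong : ∀ {p q} → p ≋ q → tail p ≋ tail q
  tail-cong {p} {q} e .at i = R.trans (lem p i) (R.trans (e .at (suc i)) (R.sym (lem q i)))
    where
    lem : ∀ p i → coeff (tail p) i ≈ coeff p (suc i)
    lem []      i = R.refl
    lem (_ ∷ p) i = R.refl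

  ∷-tail : ∀ {a p q} → a ≈ coeff q 0 → p ≋ tail q → a ∷ p ≋ q
  ∷-tail {q = []}    a≈ e .at zero    = a≈
  ∷-tail {q = []}    a≈ e .at (suc i) = e .at i
  ∷-tail {q = _ ∷ _} a≈ e = ∷-cong a≈ e

  coeff-+ : ∀ p q i → coeff (p + q) i ≈ coeff p i +ᴿ coeff q i
  coeff-+ []      q       i       = R.sym (R.+-identityˡ _)
  coeff-+ (a ∷ p) []      i       = R.sym (R.+-identityʳ _)
  coeff-+ (a ∷ p) (b ∷ q) zero    = R.refl
  coeff-+ (a ∷ p) (b ∷ q) (suc i) = coeff-+ p q i

  coeff-· : ∀ a p i → coeff (a · p) i ≈ a *ᴿ coeff p i
  coeff-· a []      i       = R.sym (R.zeroʳ a)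
  coeff-· a (b ∷ p) zero    = R.refl
  coeff-· a (b ∷ p) (suc i) = coeff-· a p i

  coeff-neg : ∀ p i → coeff (- p) i ≈ -ᴿ coeff p i
  coeff-neg []      i       = R.sym -0#≈0#
  coeff-neg (a ∷ p) zero    = R.refl
  coeff-neg (a ∷ p) (suc i) = coeff-neg p i

  +-cong : ∀ {p p′ q q′} → p ≋ p′ → q ≋ q′ → p + q ≋ p′ + q′
  +-cong {p} {p′} {q} {q′} e f .at i = begin
    coeff (p + q) i           ≈⟨ coeff-+ p q i ⟩
    coeff p i +ᴿ coeff q i    ≈⟨ R.+-cong (e .at i) (f .at i) ⟩
    coeff p′ i +ᴿ coeff q′ i  ≈⟨ coeff-+ p′ q′ i ⟨
    coeff (p′ + q′) i         ∎

  +-assoc : ∀ p q r → (p + q) + r ≋ p + (q + r)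
  +-assoc p q r .at i = begin
    coeff ((p + q) + r) i                     ≈⟨ coeff-+ (p + q) r i ⟩
    coeff (p + q) i +ᴿ coeff r i              ≈⟨ R.+-congʳ (coeff-+ p q i) ⟩
    (coeff p i +ᴿ coeff q i) +ᴿ coeff r i     ≈⟨ R.+-assoc _ _ _ ⟩
    coeff p i +ᴿ (coeff q i +ᴿ coeff r i)     ≈⟨ R.+-congˡ (coeff-+ q r i) ⟨
    coeff p i +ᴿ coeff (q + r) i              ≈⟨ coeff-+ p (q + r) i ⟨
    coeff (p + (q + r)) i                     ∎

  +-comm : ∀ p q → p + q ≋ q + p
  +-comm p q .at i = begin
    coeff (p + q) i         ≈⟨ coeff-+ p q i ⟩
    coeff p i +ᴿ coeff q i  ≈⟨ R.+-comm _ _ ⟩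
    coeff q i +ᴿ coeff p i  ≈⟨ coeff-+ q p i ⟨
    coeff (q + p) i         ∎

  +-identityʳ : ∀ p → p + [] ≋ p
  +-identityʳ []      = ≋-refl
  +-identityʳ (_ ∷ _) = ≋-refl

  -‿cong : ∀ {p q} → p ≋ q → - p ≋ - q
  -‿cong {p} {q} e .at i =
    R.trans (coeff-neg p i) (R.trans (R.-‿cong (e .at i)) (R.sym (coeff-neg q i)))

  -‿inverseˡ : ∀ p → - p + p ≋ []
  -‿inverseˡ p .at i = begin
    coeff (- p + p) i           ≈⟨ coeff-+ (- p) p i ⟩
    coeff (- p) i +ᴿ coeff p i  ≈⟨ R.+-congʳ (coeff-neg p i) ⟩
    -ᴿ coeff p i +ᴿ coeff p i   ≈⟨ R.-‿inverseˡ _ ⟩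
    0#                          ∎

  ·-cong : ∀ {a b p q} → a ≈ b → p ≋ q → a · p ≋ b · q
  ·-cong {a} {b} {p} {q} a≈b e .at i = begin
    coeff (a · p) i   ≈⟨ coeff-· a p i ⟩
    a *ᴿ coeff p i    ≈⟨ R.*-cong a≈b (e .at i) ⟩
    b *ᴿ coeff q i    ≈⟨ coeff-· b q i ⟨
    coeff (b · q) i   ∎

  ·-distribˡ : ∀ a p q → a · (p + q) ≋ a · p + a · q
  ·-distribˡ a p q .at i = begin
    coeff (a · (p + q)) i                 ≈⟨ coeff-· a (p + q) i ⟩
    a *ᴿ coeff (p + q) i                  ≈⟨ R.*-congˡ (coeff-+ p q i) ⟩
    a *ᴿ (coeff p i +ᴿ coeff q i)         ≈⟨ R.distribˡ _ _ _ ⟩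
    a *ᴿ coeff p i +ᴿ a *ᴿ coeff q i      ≈⟨ R.+-cong (coeff-· a p i) (coeff-· a q i) ⟨
    coeff (a · p) i +ᴿ coeff (a · q) i    ≈⟨ coeff-+ (a · p) (a · q) i ⟨
    coeff (a · p + a · q) i               ∎

  ·-distribʳ : ∀ a b p → (a +ᴿ b) · p ≋ a · p + b · p
  ·-distribʳ a b p .at i = begin
    coeff ((a +ᴿ b) · p) i                ≈⟨ coeff-· _ p i ⟩
    (a +ᴿ b) *ᴿ coeff p i                 ≈⟨ R.distribʳ _ _ _ ⟩
    a *ᴿ coeff p i +ᴿ b *ᴿ coeff p i      ≈⟨ R.+-cong (coeff-· a p i) (coeff-· b p i) ⟨
    coeff (a · p) i +ᴿ coeff (b · p) i    ≈⟨ coeff-+ (a · p) (b · p) i ⟨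
    coeff (a · p + b · p) i               ∎

  ·-assoc : ∀ a b p → (a *ᴿ b) · p ≋ a · (b · p)
  ·-assoc a b p .at i = begin
    coeff ((a *ᴿ b) · p) i   ≈⟨ coeff-· _ p i ⟩
    (a *ᴿ b) *ᴿ coeff p i    ≈⟨ R.*-assoc _ _ _ ⟩
    a *ᴿ (b *ᴿ coeff p i)    ≈⟨ R.*-congˡ (coeff-· b p i) ⟨
    a *ᴿ coeff (b · p) i     ≈⟨ coeff-· a (b · p) i ⟨
    coeff (a · (b · p)) i    ∎

  ·-zero : ∀ {a} p → a ≈ 0# → a · p ≋ []
  ·-zero p a≈0 .at i =
    R.trans (coeff-· _ p i) (R.trans (R.*-congʳ a≈0) (R.zeroˡ _))

  ·-identity : ∀ p → 1# · p ≋ p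
  ·-identity p .at i = R.trans (coeff-· 1# p i) (R.*-identityˡ _)

  0∷[]≋[] : ∀ {a} → a ≈ 0# → a ∷ [] ≋ []
  0∷[]≋[] a≈0 = ∷-tail a≈0 ≋-refl

  ∷-+ : ∀ p q → 0# ∷ (p + q) ≋ (0# ∷ p) + (0# ∷ q)
  ∷-+ p q = ∷-cong (R.sym (R.+-identityˡ 0#)) ≋-refl

  private
    +-swap : ∀ p q r → p + (q + r) ≋ q + (p + r)
    +-swap p q r =
      ≋-trans (≋-sym (+-assoc p q r)) (≋-trans (+-cong (+-comm p q) ≋-refl) (+-assoc q p r))

    +-inter : ∀ p q r s → (p + q) + (r + s) ≋ (p + r) + (q + s)
    +-inter p q r s =
      ≋-trans (+-assoc p q (r + s))
      (≋-trans (+-cong (≋-refl {p}) (+-swap q r s)) (≋-sym (+-assoc p r (q + s))))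

  *-congʳ : ∀ p {q r} → q ≋ r → p * q ≋ p * r
  *-congʳ []      e = ≋-refl
  *-congʳ (a ∷ p) e = +-cong (·-cong R.refl e) (∷-cong R.refl (*-congʳ p e))

  *-zeroʳ : ∀ p → p * [] ≋ []
  *-zeroʳ []      = ≋-refl
  *-zeroʳ (a ∷ p) = ≋-trans (∷-cong R.refl (*-zeroʳ p)) (0∷[]≋[] R.refl)

  *-∷ʳ : ∀ p b q → p * (b ∷ q) ≋ b · p + (0# ∷ p * q)
  *-∷ʳ []      b q = ≋-sym (0∷[]≋[] R.refl)
  *-∷ʳ (a ∷ p) b q = ∷-cong (R.+-congʳ (R.*-comm a b))
    (≋-trans (+-cong (≋-refl {a · q}) (*-∷ʳ p b q)) (+-swap (a · q) (b · p) (0# ∷ p * q)))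

  *-comm : ∀ p q → p * q ≋ q * p
  *-comm []      q = ≋-sym (*-zeroʳ q)
  *-comm (a ∷ p) q =
    ≋-trans (+-cong ≋-refl (∷-cong R.refl (*-comm p q))) (≋-sym (*-∷ʳ q a p))

  *-cong : ∀ {p p′ q q′} → p ≋ p′ → q ≋ q′ → p * q ≋ p′ * q′
  *-cong {p} {p′} {q} {q′} e f =
    ≋-trans (*-congʳ p f) (≋-trans (*-comm p q′) (≋-trans (*-congʳ q′ e) (*-comm q′ p′)))

  distribʳ : ∀ r p q → (p + q) * r ≋ p * r + q * r
  distribʳ r []      q       = ≋-refl
  distribʳ r (a ∷ p) []      = ≋-sym (+-identityʳ _)
  distribʳ r (a ∷ p) (b ∷ q) =
    ≋-trans (+-cong (·-distribʳ a b r)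
      (≋-trans (∷-cong R.refl (distribʳ r p q)) (∷-+ (p * r) (q * r))))
    (+-inter (a · r) (b · r) (0# ∷ p * r) (0# ∷ q * r))

  distribˡ : ∀ p q r → p * (q + r) ≋ p * q + p * r
  distribˡ p q r =
    ≋-trans (*-comm p (q + r)) (≋-trans (distribʳ p q r) (+-cong (*-comm q p) (*-comm r p)))

  ·-*-assoc : ∀ a p q → (a · p) * q ≋ a · (p * q)
  ·-*-assoc a []      q = ≋-refl
  ·-*-assoc a (b ∷ p) q =
    ≋-trans (+-cong (·-assoc a b q)
      (∷-cong (R.sym (R.zeroʳ a)) (·-*-assoc a p q)))
    (≋-sym (·-distribˡ a (b · q) (0# ∷ p * q)))

  0∷-* : ∀ p q → (0# ∷ p) * q ≋ 0# ∷ (p * q)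
  0∷-* p q = +-cong (·-zero q R.refl) ≋-refl

  *-assoc : ∀ p q r → (p * q) * r ≋ p * (q * r)
  *-assoc []      q r = ≋-refl
  *-assoc (a ∷ p) q r =
    ≋-trans (distribʳ r (a · q) (0# ∷ p * q))
    (+-cong (·-*-assoc a q r)
      (≋-trans (0∷-* (p * q) r) (∷-cong R.refl (*-assoc p q r))))

  C-* : ∀ a p → C a * p ≋ a · p
  C-* a p = ≋-trans (+-cong (≋-refl {a · p}) (0∷[]≋[] R.refl)) (+-identityʳ _)

  X-* : ∀ p → X * p ≋ 0# ∷ p
  X-* p = ≋-trans (0∷-* (1# ∷ []) p) (∷-cong R.refl (≋-trans (C-* 1# p) (·-identity p)))

  *-identityˡ : ∀ p → C 1# * p ≋ p
  *-identityˡ p = ≋-trans (C-* 1# p) (·-identity p)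

  commutativeRing : CommutativeRing c ℓ
  commutativeRing = record
    { Carrier = Poly ; _≈_ = _≋_ ; _+_ = _+_ ; _*_ = _*_ ; -_ = -_ ; 0# = [] ; 1# = C 1#
    ; isCommutativeRing = record
      { isRing = record
        { +-isAbelianGroup = record
          { isGroup = record
            { isMonoid = record
              { isSemigroup = record
                { isMagma = record
                  { isEquivalence = record { refl = ≋-refl ; sym = ≋-sym ; trans = ≋-trans }
                  ; ∙-cong = +-cong }
                ; assoc = +-assoc }
              ; identity = (λ _ → ≋-refl) , +-identityʳ }
            ; inverse = -‿inverseˡ
                      , λ p → ≋-trans (+-comm p (- p)) (-‿inverseˡ p)
            ; ⁻¹-cong = -‿cong }
          ; comm = +-comm }
        ; *-cong = *-cong
        ; *-assoc = *-assoc
        ; *-identity = *-identityˡ , λ p → ≋-trans (*-comm p (C 1#)) (*-identityˡ p)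
        ; distrib = distribˡ , distribʳ }
      ; *-comm = *-comm } }

  *-split : ∀ p q → p * q ≋ coeff p 0 · q + (0# ∷ tail p * q)
  *-split []      q = ≋-sym (≋-trans (+-cong (·-zero q R.refl) (0∷[]≋[] R.refl)) ≋-refl)
  *-split (a ∷ p) q = ≋-refl

  coeff-*-0 : ∀ p q → coeff (p * q) 0 ≈ coeff p 0 *ᴿ coeff q 0
  coeff-*-0 []      q = R.sym (R.zeroˡ _)
  coeff-*-0 (a ∷ p) q =
    R.trans (coeff-+ (a · q) (0# ∷ p * q) 0) (R.trans (R.+-identityʳ _) (coeff-· a q 0))

  length-· : ∀ a p → length (a · p) ≡ length p
  length-· a []      = ≡.refl
  length-· a (b ∷ p) = ≡.cong suc (length-· a p)

  length-+-≤ : ∀ {n} p q → length p ℕ.≤ n → length q ℕ.≤ n → length (p + q) ℕ.≤ n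
  length-+-≤ []      q       p≤n       q≤n       = q≤n
  length-+-≤ (a ∷ p) []      p≤n       q≤n       = p≤n
  length-+-≤ (a ∷ p) (b ∷ q) (s≤s p≤n) (s≤s q≤n) = s≤s (length-+-≤ p q p≤n q≤n)

  length-+-≥ˡ : ∀ p q → length p ℕ.≤ length (p + q)
  length-+-≥ˡ []      q       = z≤n
  length-+-≥ˡ (a ∷ p) []      = ℕ.≤-refl
  length-+-≥ˡ (a ∷ p) (b ∷ q) = s≤s (length-+-≥ˡ p q)

  length-+-≥ʳ : ∀ p q → length q ℕ.≤ length (p + q)
  length-+-≥ʳ []      q       = ℕ.≤-refl
  length-+-≥ʳ (a ∷ p) []      = z≤n
  length-+-≥ʳ (a ∷ p) (b ∷ q) = s≤s (length-+-≥ʳ p q)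

  length-*-≤ : ∀ m n p q → length p ℕ.≤ suc m → length q ℕ.≤ suc n → length (p * q) ℕ.≤ suc (m ℕ.+ n)
  length-*-≤ m n []      q p≤1+m q≤1+n = z≤n
  length-*-≤ m n (a ∷ p) q (s≤s p≤m) q≤1+n = length-+-≤ (a · q) (0# ∷ p * q)
    (≡.subst (ℕ._≤ suc (m ℕ.+ n)) (≡.sym (length-· a q)) (ℕ.≤-trans q≤1+n (s≤s (ℕ.m≤n+m n m))))
    (s≤s (tail-bound m p p≤m))
    where
    tail-bound : ∀ m p → length p ℕ.≤ m → length (p * q) ℕ.≤ m ℕ.+ n
    tail-bound m       []      p≤m = z≤n
    tail-bound (suc m) (b ∷ p) p≤m = length-*-≤ m n (b ∷ p) q p≤m q≤1+n

  length-X*-≥ : ∀ p → suc (length p) ℕ.≤ length (X * p)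
  length-X*-≥ p = ℕ.≤-trans (s≤s 1·p) (length-+-≥ʳ (0# · p) (0# ∷ C 1# * p))
    where
    1·p : length p ℕ.≤ length (C 1# * p)
    1·p = ≡.subst (ℕ._≤ length (C 1# * p)) (length-· 1# p) (length-+-≥ˡ (1# · p) (0# ∷ []))

  -- The quotient of a by a divisor b whose constant coefficient b₀ satisfies b₀² = 1, found one
  -- coefficient at a time from the constant one upwards; n bounds the number of coefficients.
  quotient : ℕ → Poly → Poly → Poly
  quotient zero    a b = []
  quotient (suc n) a b = c₀ ∷ quotient n (tail (a + - (c₀ · b))) b
    where c₀ = coeff b 0 *ᴿ coeff a 0

  infixl 7 _÷_

  _÷_ : Poly → Poly → Poly
  a ÷ b = quotient (length a) a b

module PolynomialMap {c₁ ℓ₁ c₂ ℓ₂ : Level} (R : CommutativeRing c₁ ℓ₁) (S : CommutativeRing c₂ ℓ₂)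
  (f : CommutativeRing.Carrier R → CommutativeRing.Carrier S)
  (f-hom : IsRingHomomorphism (CommutativeRing.rawRing R) (CommutativeRing.rawRing S) f) where

  private
    module R = CommutativeRing R
    module S = CommutativeRing S
    module R[X] = Polynomial R
    open Polynomial S
    module f = IsRingHomomorphism f-hom
    open SetoidReasoning S.setoid

  map : R[X].Poly → Poly
  map = List.map f

  coeff-map : ∀ p i → coeff (map p) i S.≈ f (R[X].coeff p i)
  coeff-map []      i       = S.sym f.0#-homo
  coeff-map (a ∷ p) zero    = S.refl
  coeff-map (a ∷ p) (suc i) = coeff-map p i

  map-tail : ∀ p → map (R[X].tail p) ≋ tail (map p)
  map-tail []      = ≋-refl
  map-tail (_ ∷ p) = ≋-refl

  map-+ : ∀ p q → map (p R[X].+ q) ≋ map p + map q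
  map-+ p q .at i = begin
    coeff (map (p R[X].+ q)) i                  ≈⟨ coeff-map (p R[X].+ q) i ⟩
    f (R[X].coeff (p R[X].+ q) i)               ≈⟨ f.⟦⟧-cong (R[X].coeff-+ p q i) ⟩
    f (R[X].coeff p i R.+ R[X].coeff q i)       ≈⟨ f.+-homo _ _ ⟩
    f (R[X].coeff p i) S.+ f (R[X].coeff q i)   ≈⟨ S.+-cong (coeff-map p i) (coeff-map q i) ⟨
    coeff (map p) i S.+ coeff (map q) i         ≈⟨ coeff-+ (map p) (map q) i ⟨
    coeff (map p + map q) i                     ∎

  map-neg : ∀ p → map (R[X].- p) ≋ - map p
  map-neg []      = ≋-refl
  map-neg (a ∷ p) = ∷-cong (f.-‿homo a) (map-neg p)

  map-· : ∀ a p → map (a R[X].· p) ≋ f a · map p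
  map-· a []      = ≋-refl
  map-· a (b ∷ p) = ∷-cong (f.*-homo a b) (map-· a p)

  map-* : ∀ p q → map (p R[X].* q) ≋ map p * map q
  map-* []      q = ≋-refl
  map-* (a ∷ p) q = ≋-trans (map-+ (a R[X].· q) (R.0# ∷ p R[X].* q))
    (+-cong (map-· a q) (∷-cong f.0#-homo (map-* p q)))

  map-1# : map (R[X].C R.1#) ≋ C S.1#
  map-1# = ∷-cong f.1#-homo ≋-refl

  map-X : map R[X].X ≋ X
  map-X = ∷-cong f.0#-homo (∷-cong f.1#-homo ≋-refl)

  map-quotient : ∀ n a b c → R[X].coeff b 0 R.* R[X].coeff b 0 R.≈ R.1# →
                 c * map b ≋ map a → length c ℕ.≤ n → map (R[X].quotient n a b) ≋ c
  map-quotient zero    a b [] b₀²≈1 e c≤n = ≋-refl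
  map-quotient (suc n) a b c  b₀²≈1 e c≤n =
    ∷-tail head≈ (map-quotient n (R[X].tail r) b (tail c) b₀²≈1 e′ (tail-≤ c c≤n))
    where
    b₀ = R[X].coeff b 0
    a₀ = R[X].coeff a 0
    c₀ = coeff c 0
    r  = a R[X].+ R[X].- ((b₀ R.* a₀) R[X].· b)

    tail-≤ : ∀ c → length c ℕ.≤ suc n → length (tail c) ℕ.≤ n
    tail-≤ []      _         = z≤n
    tail-≤ (_ ∷ c) (s≤s c≤n) = c≤n

    fa₀≈ : f a₀ S.≈ c₀ S.* f b₀
    fa₀≈ = begin
      f a₀                      ≈⟨ coeff-map a 0 ⟨
      coeff (map a) 0           ≈⟨ e .at 0 ⟨
      coeff (c * map b) 0       ≈⟨ coeff-*-0 c (map b) ⟩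
      c₀ S.* coeff (map b) 0    ≈⟨ S.*-congˡ (coeff-map b 0) ⟩
      c₀ S.* f b₀               ∎

    head≈ : f (b₀ R.* a₀) S.≈ c₀
    head≈ = begin
      f (b₀ R.* a₀)             ≈⟨ f.*-homo b₀ a₀ ⟩
      f b₀ S.* f a₀             ≈⟨ S.*-comm _ _ ⟩
      f a₀ S.* f b₀             ≈⟨ S.*-congʳ fa₀≈ ⟩
      c₀ S.* f b₀ S.* f b₀      ≈⟨ S.*-assoc _ _ _ ⟩
      c₀ S.* (f b₀ S.* f b₀)    ≈⟨ S.*-congˡ (f.*-homo b₀ b₀) ⟨
      c₀ S.* f (b₀ R.* b₀)      ≈⟨ S.*-congˡ (S.trans (f.⟦⟧-cong b₀²≈1) f.1#-homo) ⟩
      c₀ S.* S.1#               ≈⟨ S.*-identityʳ c₀ ⟩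
      c₀                        ∎

    c₀b : Poly
    c₀b = c₀ · map b

    map-r : map r ≋ S.0# ∷ tail c * map b
    map-r =
      ≋-trans (map-+ a (R[X].- ((b₀ R.* a₀) R[X].· b)))
      (≋-trans (+-cong (≋-trans (≋-sym e) (*-split c (map b)))
        (≋-trans (map-neg ((b₀ R.* a₀) R[X].· b))
          (-‿cong (≋-trans (map-· (b₀ R.* a₀) b) (·-cong head≈ ≋-refl)))))
      (≋-trans (+-comm (c₀b + (S.0# ∷ tail c * map b)) (- c₀b))
      (≋-trans (≋-sym (+-assoc (- c₀b) c₀b (S.0# ∷ tail c * map b)))
      (+-cong (-‿inverseˡ c₀b) ≋-refl))))

    e′ : tail c * map b ≋ map (R[X].tail r)
    e′ = ≋-sym (≋-trans (map-tail r) (tail-cong map-r))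

-- If a = c · b then a ÷ b = c, provided the list c is no longer than the list a.
÷-exact : ∀ {c ℓ : Level} (R : CommutativeRing c ℓ) →
  let open CommutativeRing R using (_≈_; 1#) renaming (_*_ to _*ᴿ_)
      open Polynomial R
  in ∀ a b c → coeff b 0 *ᴿ coeff b 0 ≈ 1# → length c ℕ.≤ length a → c * b ≋ a → a ÷ b ≋ c
÷-exact R a b c b₀²≈1 c≤a e =
  ≡.subst (_≋ c) (List.map-id (a ÷ b))
    (map-quotient (length a) a b c b₀²≈1
      (≡.subst₂ (λ a b → c * b ≋ a) (≡.sym (List.map-id a)) (≡.sym (List.map-id b)) e) c≤a)
  where
  open CommutativeRing R using (rawRing; refl)
  open Polynomial R
  open PolynomialMap R R (λ x → x) (Identity.isRingHomomorphism rawRing refl)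

-- R[1/t] for a regular element t; a /t^ n stands for a · t⁻ⁿ.
module Localisation {c ℓ : Level} (R : CommutativeRing c ℓ) (t : CommutativeRing.Carrier R)
  (t-cancel : ∀ {a b} → CommutativeRing._≈_ R (CommutativeRing._*_ R t a) (CommutativeRing._*_ R t b)
                      → CommutativeRing._≈_ R a b) where

  private
    module R = CommutativeRing R
    open R using (Carrier; _≈_) renaming (_+_ to _+ᴿ_; _*_ to _*ᴿ_; -_ to -ᴿ_)
    open Exp R.commutativeSemiring using (_^_; ^-homo-*)
    open NatSolver R.commutativeSemiring
    open SetoidReasoning R.setoid

    T : ℕ → Carrier
    T n = t ^ n

    T-cancel : ∀ n {a b} → T n *ᴿ a ≈ T n *ᴿ b → a ≈ b
    T-cancel zero    e = R.trans (R.sym (R.*-identityˡ _)) (R.trans e (R.*-identityˡ _))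
    T-cancel (suc n) e = T-cancel n (t-cancel
      (R.trans (R.sym (R.*-assoc _ _ _)) (R.trans e (R.*-assoc _ _ _))))

  infix 5 _/t^_

  record Fraction : Set c where
    constructor _/t^_
    field
      num : Carrier
      den : ℕ
  open Fraction public

  infix 4 _≃_

  record _≃_ (x y : Fraction) : Set ℓ where
    constructor mk≃
    field cross : T (den y) *ᴿ num x ≈ T (den x) *ᴿ num y
  open _≃_ public

  infixl 6 _+_
  infixl 7 _*_
  infix  8 -_

  _+_ : Fraction → Fraction → Fraction
  (a /t^ m) + (b /t^ n) = (T n *ᴿ a +ᴿ T m *ᴿ b) /t^ (m ℕ.+ n)

  _*_ : Fraction → Fraction → Fraction
  (a /t^ m) * (b /t^ n) = (a *ᴿ b) /t^ (m ℕ.+ n)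

  -_ : Fraction → Fraction
  - (a /t^ m) = (-ᴿ a) /t^ m

  fromBase : Carrier → Fraction
  fromBase a = a /t^ 0

  0# 1# : Fraction
  0# = fromBase R.0#
  1# = fromBase R.1#

  ≃-refl : ∀ {x} → x ≃ x
  ≃-refl .cross = R.refl

  ≃-sym : ∀ {x y} → x ≃ y → y ≃ x
  ≃-sym e .cross = R.sym (e .cross)

  ≃-trans : ∀ {x y z} → x ≃ y → y ≃ z → x ≃ z
  ≃-trans {a /t^ m} {b /t^ n} {c /t^ k} (mk≃ e) (mk≃ f) .cross = T-cancel n (begin
    T n *ᴿ (T k *ᴿ a)  ≈⟨ swap (T n) (T k) a ⟩
    T k *ᴿ (T n *ᴿ a)  ≈⟨ R.*-congˡ e ⟩
    T k *ᴿ (T m *ᴿ b)  ≈⟨ swap (T k) (T m) b ⟩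
    T m *ᴿ (T k *ᴿ b)  ≈⟨ R.*-congˡ f ⟩
    T m *ᴿ (T n *ᴿ c)  ≈⟨ swap (T m) (T n) c ⟩
    T n *ᴿ (T m *ᴿ c)  ∎)
    where
    swap : ∀ x y z → x *ᴿ (y *ᴿ z) ≈ y *ᴿ (x *ᴿ z)
    swap = solve 3 (λ x y z → x :* (y :* z) := y :* (x :* z)) R.refl

  +-comm : ∀ x y → x + y ≃ y + x
  +-comm (a /t^ m) (b /t^ n) .cross =
    R.*-cong (R.reflexive (≡.cong T (ℕ.+-comm n m))) (R.+-comm _ _)

  *-comm : ∀ x y → x * y ≃ y * x
  *-comm (a /t^ m) (b /t^ n) .cross =
    R.*-cong (R.reflexive (≡.cong T (ℕ.+-comm n m))) (R.*-comm _ _)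

  +-congˡ : ∀ {x y z} → y ≃ z → x + y ≃ x + z
  +-congˡ {a /t^ m} {b /t^ n} {c /t^ k} (mk≃ e) .cross = begin
    T (m ℕ.+ k) *ᴿ (T n *ᴿ a +ᴿ T m *ᴿ b)
      ≈⟨ R.*-congʳ (^-homo-* t m k) ⟩
    T m *ᴿ T k *ᴿ (T n *ᴿ a +ᴿ T m *ᴿ b)
      ≈⟨ solve 5 (λ M N K a b → M :* K :* (N :* a :+ M :* b) :=
                   M :* N :* (K :* a) :+ M :* M :* (K :* b)) R.refl (T m) (T n) (T k) a b ⟩
    T m *ᴿ T n *ᴿ (T k *ᴿ a) +ᴿ T m *ᴿ T m *ᴿ (T k *ᴿ b)
      ≈⟨ R.+-congˡ (R.*-congˡ e) ⟩
    T m *ᴿ T n *ᴿ (T k *ᴿ a) +ᴿ T m *ᴿ T m *ᴿ (T n *ᴿ c)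
      ≈⟨ solve 5 (λ M N K a c → M :* N :* (K :* a) :+ M :* M :* (N :* c) :=
                   M :* N :* (K :* a :+ M :* c)) R.refl (T m) (T n) (T k) a c ⟩
    T m *ᴿ T n *ᴿ (T k *ᴿ a +ᴿ T m *ᴿ c)
      ≈⟨ R.*-congʳ (^-homo-* t m n) ⟨
    T (m ℕ.+ n) *ᴿ (T k *ᴿ a +ᴿ T m *ᴿ c) ∎

  +-cong : ∀ {x x′ y y′} → x ≃ x′ → y ≃ y′ → x + y ≃ x′ + y′
  +-cong {x} {x′} {y} {y′} e f =
    ≃-trans (+-congˡ f) (≃-trans (+-comm x y′) (≃-trans (+-congˡ e) (+-comm y′ x′)))

  *-congˡ : ∀ {x y z} → y ≃ z → x * y ≃ x * z
  *-congˡ {a /t^ m} {b /t^ n} {c /t^ k} (mk≃ e) .cross = begin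
    T (m ℕ.+ k) *ᴿ (a *ᴿ b)      ≈⟨ R.*-congʳ (^-homo-* t m k) ⟩
    T m *ᴿ T k *ᴿ (a *ᴿ b)       ≈⟨ regroup (T m) (T k) a b ⟩
    T m *ᴿ a *ᴿ (T k *ᴿ b)       ≈⟨ R.*-congˡ e ⟩
    T m *ᴿ a *ᴿ (T n *ᴿ c)       ≈⟨ regroup (T m) (T n) a c ⟨
    T m *ᴿ T n *ᴿ (a *ᴿ c)       ≈⟨ R.*-congʳ (^-homo-* t m n) ⟨
    T (m ℕ.+ n) *ᴿ (a *ᴿ c)      ∎
    where
    regroup : ∀ M K a b → M *ᴿ K *ᴿ (a *ᴿ b) ≈ M *ᴿ a *ᴿ (K *ᴿ b)
    regroup = solve 4 (λ M K a b → M :* K :* (a :* b) := M :* a :* (K :* b)) R.refl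

  *-cong : ∀ {x x′ y y′} → x ≃ x′ → y ≃ y′ → x * y ≃ x′ * y′
  *-cong {x} {x′} {y} {y′} e f =
    ≃-trans (*-congˡ f) (≃-trans (*-comm x y′) (≃-trans (*-congˡ e) (*-comm y′ x′)))

  private
    same-den : ∀ {a b m n} → m ≡ n → a ≈ b → a /t^ m ≃ b /t^ n
    same-den ≡.refl a≈b .cross = R.*-congˡ a≈b

  +-assoc : ∀ x y z → (x + y) + z ≃ x + (y + z)
  +-assoc (a /t^ m) (b /t^ n) (c /t^ k) = same-den (ℕ.+-assoc m n k) (begin
    T k *ᴿ (T n *ᴿ a +ᴿ T m *ᴿ b) +ᴿ T (m ℕ.+ n) *ᴿ c
      ≈⟨ R.+-congˡ (R.*-congʳ (^-homo-* t m n)) ⟩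
    T k *ᴿ (T n *ᴿ a +ᴿ T m *ᴿ b) +ᴿ T m *ᴿ T n *ᴿ c
      ≈⟨ solve 6 (λ M N K a b c → K :* (N :* a :+ M :* b) :+ M :* N :* c :=
                   N :* K :* a :+ M :* (K :* b :+ N :* c)) R.refl (T m) (T n) (T k) a b c ⟩
    T n *ᴿ T k *ᴿ a +ᴿ T m *ᴿ (T k *ᴿ b +ᴿ T n *ᴿ c)
      ≈⟨ R.+-congʳ (R.*-congʳ (^-homo-* t n k)) ⟨
    T (n ℕ.+ k) *ᴿ a +ᴿ T m *ᴿ (T k *ᴿ b +ᴿ T n *ᴿ c) ∎)

  *-assoc : ∀ x y z → (x * y) * z ≃ x * (y * z)
  *-assoc (a /t^ m) (b /t^ n) (c /t^ k) = same-den (ℕ.+-assoc m n k) (R.*-assoc a b c)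

  +-identityˡ : ∀ x → 0# + x ≃ x
  +-identityˡ (a /t^ m) = same-den ≡.refl
    (solve 2 (λ M a → M :* con 0 :+ con 1 :* a := a) R.refl (T m) a)

  *-identityˡ : ∀ x → 1# * x ≃ x
  *-identityˡ (a /t^ m) = same-den ≡.refl (R.*-identityˡ a)

  distribˡ : ∀ x y z → x * (y + z) ≃ x * y + x * z
  distribˡ (a /t^ m) (b /t^ n) (c /t^ k) .cross = begin
    T ((m ℕ.+ n) ℕ.+ (m ℕ.+ k)) *ᴿ (a *ᴿ (T k *ᴿ b +ᴿ T n *ᴿ c))
      ≈⟨ R.*-congʳ (R.trans (^-homo-* t (m ℕ.+ n) (m ℕ.+ k))
           (R.*-cong (^-homo-* t m n) (^-homo-* t m k))) ⟩
    (T m *ᴿ T n) *ᴿ (T m *ᴿ T k) *ᴿ (a *ᴿ (T k *ᴿ b +ᴿ T n *ᴿ c))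
      ≈⟨ solve 6 (λ M N K a b c →
           (M :* N) :* (M :* K) :* (a :* (K :* b :+ N :* c)) :=
           M :* (N :* K) :* ((M :* K) :* (a :* b) :+ (M :* N) :* (a :* c)))
           R.refl (T m) (T n) (T k) a b c ⟩
    T m *ᴿ (T n *ᴿ T k) *ᴿ ((T m *ᴿ T k) *ᴿ (a *ᴿ b) +ᴿ (T m *ᴿ T n) *ᴿ (a *ᴿ c))
      ≈⟨ R.*-cong
           (R.trans (^-homo-* t m (n ℕ.+ k)) (R.*-congˡ (^-homo-* t n k)))
           (R.+-cong (R.*-congʳ (^-homo-* t m k)) (R.*-congʳ (^-homo-* t m n))) ⟨
    T (m ℕ.+ (n ℕ.+ k)) *ᴿ (T (m ℕ.+ k) *ᴿ (a *ᴿ b) +ᴿ T (m ℕ.+ n) *ᴿ (a *ᴿ c)) ∎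

  distribʳ : ∀ x y z → (y + z) * x ≃ y * x + z * x
  distribʳ x y z = ≃-trans (*-comm (y + z) x)
    (≃-trans (distribˡ x y z) (+-cong (*-comm x y) (*-comm x z)))

  -‿inverseˡ : ∀ x → - x + x ≃ 0#
  -‿inverseˡ (a /t^ m) .cross = begin
    R.1# *ᴿ (T m *ᴿ (-ᴿ a) +ᴿ T m *ᴿ a)  ≈⟨ R.*-identityˡ _ ⟩
    T m *ᴿ (-ᴿ a) +ᴿ T m *ᴿ a            ≈⟨ R.distribˡ (T m) (-ᴿ a) a ⟨
    T m *ᴿ (-ᴿ a +ᴿ a)                   ≈⟨ R.*-congˡ (R.-‿inverseˡ a) ⟩
    T m *ᴿ R.0#                          ≈⟨ R.zeroʳ (T m) ⟩
    R.0#                                 ≈⟨ R.zeroʳ _ ⟨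
    T (m ℕ.+ m) *ᴿ R.0#                  ∎

  -‿cong : ∀ {x y} → x ≃ y → - x ≃ - y
  -‿cong {a /t^ m} {b /t^ n} (mk≃ e) .cross =
    R.trans (R.sym (-‿distribʳ-* (T n) a)) (R.trans (R.-‿cong e) (-‿distribʳ-* (T m) b))
    where open RingProperties R.ring using (-‿distribʳ-*)

  commutativeRing : CommutativeRing c ℓ
  commutativeRing = record
    { Carrier = Fraction ; _≈_ = _≃_ ; _+_ = _+_ ; _*_ = _*_ ; -_ = -_ ; 0# = 0# ; 1# = 1#
    ; isCommutativeRing = record
      { isRing = record
        { +-isAbelianGroup = record
          { isGroup = record
            { isMonoid = record
              { isSemigroup = record
                { isMagma = record
                  { isEquivalence = record { refl = ≃-refl ; sym = ≃-sym ; trans = ≃-trans }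
                  ; ∙-cong = +-cong }
                ; assoc = +-assoc }
              ; identity = +-identityˡ
                         , λ x → ≃-trans (+-comm x 0#) (+-identityˡ x) }
            ; inverse = -‿inverseˡ
                      , λ x → ≃-trans (+-comm x (- x)) (-‿inverseˡ x)
            ; ⁻¹-cong = -‿cong }
          ; comm = +-comm }
        ; *-cong = *-cong
        ; *-assoc = *-assoc
        ; *-identity = *-identityˡ , λ x → ≃-trans (*-comm x 1#) (*-identityˡ x)
        ; distrib = distribˡ , distribʳ }
      ; *-comm = *-comm } }

module RingNotation {c ℓ : Level} (R : CommutativeRing c ℓ) where

  open CommutativeRing R public
  open Exp commutativeSemiring public using (_^_; ^-homo-*; ^-congˡ; ^-assocʳ)
  open Divisibility semiring public using (_∣_)
  open Sum +-commutativeMonoid public using (sum-syntax; sum⁺-syntax)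
  module Product = Sum *-commutativeMonoid

  infixl 10 ∏-syntax ∏⁺-syntax

  ∏-syntax : ∀ n → (Fin n → Carrier) → Carrier
  ∏-syntax _ = Product.sum

  syntax ∏-syntax n (λ i → x) = ∏[ i < n ] x

  ∏⁺-syntax : ∀ n → (Fin (suc n) → Carrier) → Carrier
  ∏⁺-syntax n = ∏-syntax (suc n)

  syntax ∏⁺-syntax n (λ i → x) = ∏[ i ≤ n ] x

  infix 9 _when_

  -- The factor a of a product restricted to the indices satisfying P.
  _when_ : ∀ {p} {P : Set p} → Carrier → Dec P → Carrier
  a when P? = if does P? then a else 1#

ℤ[q]-ring : CommutativeRing 0ℓ 0ℓ
ℤ[q]-ring = Polynomial.commutativeRing ℤ.+-*-commutativeRing

ℤ[q] : Set
ℤ[q] = CommutativeRing.Carrier ℤ[q]-ring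

module QPolynomials where

  open RingNotation ℤ[q]-ring
  open Polynomial ℤ.+-*-commutativeRing using (_÷_)

  q : ℤ[q]
  q = Polynomial.X ℤ.+-*-commutativeRing

  [_] : ℕ → ℤ[q]
  [ N ] = (1# - q ^ N) ÷ (1# - q)

  -- The factor for 1 ≤ j ≤ k sits at index j - 1. For k > N one numerator factor is [ 0 ].
  qbinomial : ℕ → ℕ → ℤ[q]
  qbinomial N k = (∏[ j < k ] [ N ℕ.∸ toℕ j ]) ÷ (∏[ j < k ] [ suc (toℕ j) ])

  -- Without ℂ at hand, Φ is computed from ∏_{e ∣ d} Φ e = q ^ d - 1. That it has the primitive
  -- d-th roots of unity as its roots, each once, is Φ-roots below.
  Φ-step : ∀ d → (∀ {e} → e ℕ.< d → ℤ[q]) → ℤ[q]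
  Φ-step d Φ< = (q ^ d - 1#) ÷ (∏[ e < d ] (Φ< (Fin.toℕ<n e) when (toℕ e ∣? d)))

  Φ : ℕ → ℤ[q]
  Φ = <-rec (λ _ → ℤ[q]) Φ-step

  Φ-unfold : ∀ d → Φ d ≡ (q ^ d - 1#) ÷ (∏[ e < d ] (Φ (toℕ e) when (toℕ e ∣? d)))
  Φ-unfold d = unfold-wfRec {d}
    where
    open WellFounded.FixPoint <-wellFounded (λ _ → ℤ[q]) Φ-step
      (λ d eq → ≡.cong ((q ^ d - 1#) ÷_)
        (Product.sum-cong-≗ (λ e → ≡.cong (_when (toℕ e ∣? d)) (eq (Fin.toℕ<n e)))))

  -- P(q) ↦ P(q²)
  infix 9 _⟨q²⟩

  _⟨q²⟩ : ℤ[q] → ℤ[q]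
  []      ⟨q²⟩ = []
  (a ∷ p) ⟨q²⟩ = a ∷ + 0 ∷ (p ⟨q²⟩)

private
  q-cancel : ∀ {a b} → let open RingNotation ℤ[q]-ring in
             QPolynomials.q * a ≈ QPolynomials.q * b → a ≈ b
  q-cancel {a} {b} e = Polynomial.mk≋ λ i → ≋-trans (≋-sym (X-* a)) (≋-trans e (X-* b)) .at (suc i)
    where open Polynomial ℤ.+-*-commutativeRing

module Laurent = Localisation ℤ[q]-ring QPolynomials.q q-cancel

ℤ[q,q⁻¹] : Set
ℤ[q,q⁻¹] = Laurent.Fraction

ℤ[q,q⁻¹]-ring : CommutativeRing 0ℓ 0ℓ
ℤ[q,q⁻¹]-ring = Laurent.commutativeRing

ℤ[q,q⁻¹][x]-ring : CommutativeRing 0ℓ 0ℓ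
ℤ[q,q⁻¹][x]-ring = Polynomial.commutativeRing ℤ[q,q⁻¹]-ring

ℤ[q,q⁻¹][x] : Set
ℤ[q,q⁻¹][x] = CommutativeRing.Carrier ℤ[q,q⁻¹][x]-ring

module WPolynomials where

  open QPolynomials using (qbinomial; _⟨q²⟩)
  private
    module L = RingNotation ℤ[q,q⁻¹]-ring
    module P = RingNotation ℤ[q]-ring
  open RingNotation ℤ[q,q⁻¹][x]-ring
  open Laurent using (_/t^_; fromBase)

  infix 9 q^_

  q^_ : ℤ → ℤ[q,q⁻¹]
  q^ (+ n)    = fromBase (QPolynomials.q P.^ n)
  q^ -[1+ n ] = P.1# /t^ suc n

  x : ℤ[q,q⁻¹][x]
  x = Polynomial.X ℤ[q,q⁻¹]-ring

  const : ℤ[q,q⁻¹] → ℤ[q,q⁻¹][x]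
  const = Polynomial.C ℤ[q,q⁻¹]-ring

  ι : ℤ[q] → ℤ[q,q⁻¹][x]
  ι a = const (fromBase a)

  -- w_k^(α)(x;q), with i standing for j - 1.
  w : ℕ → ℕ → ℤ[q,q⁻¹][x]
  w α k = ∑[ i < k ] term (toℕ i)
    where
    term : ℕ → ℤ[q,q⁻¹][x]
    term i = const (q^ exponent L.* fromBase (difference P.^ α)) * x ^ i
      where
      j = suc i
      exponent : ℤ
      exponent = + α ℤ.* (+ (suc j ℕ.C 2) ℤ.- + (suc k ℕ.* i))
      difference : ℤ[q]
      difference = qbinomial (k ℕ.∸ 1) i P.* qbinomial (k ℕ.+ j) j
             P.- qbinomial k j P.* qbinomial (k ℕ.+ j) i

  -- F(x;q) ↦ F(x;q²)
  infix 9 _⟨q²⟩ₓ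

  _⟨q²⟩ₓ : ℤ[q,q⁻¹][x] → ℤ[q,q⁻¹][x]
  _⟨q²⟩ₓ = List.map λ (a /t^ n) → (a ⟨q²⟩) /t^ (2 ℕ.* n)


module FiniteProducts {c ℓ : Level} (R : CommutativeRing c ℓ) where

  open RingNotation R
  open SetoidReasoning setoid

  prod : ℕ → (ℕ → Carrier) → Carrier
  prod n f = ∏[ i < n ] f (toℕ i)

  prod-cong : ∀ n {f g : ℕ → Carrier} → (∀ i → i ℕ.< n → f i ≈ g i) → prod n f ≈ prod n g
  prod-cong zero    e = refl
  prod-cong (suc n) e = *-cong (e 0 z<s) (prod-cong n (λ i i<n → e (suc i) (s<s i<n)))

  prod-1 : ∀ n {f : ℕ → Carrier} → (∀ i → i ℕ.< n → f i ≈ 1#) → prod n f ≈ 1#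
  prod-1 zero    e = refl
  prod-1 (suc n) e = trans (*-cong (e 0 z<s) (prod-1 n (λ i i<n → e (suc i) (s<s i<n))))
                           (*-identityˡ 1#)

  prod-suc : ∀ n f → prod (suc n) f ≈ prod n f * f n
  prod-suc zero    f = *-comm (f 0) 1#
  prod-suc (suc n) f = trans (*-congˡ (prod-suc n (f ∘ suc))) (sym (*-assoc _ _ _))

  prod-+ : ∀ m n f → prod (m ℕ.+ n) f ≈ prod m f * prod n (λ i → f (m ℕ.+ i))
  prod-+ zero    n f = sym (*-identityˡ _)
  prod-+ (suc m) n f = trans (*-congˡ (prod-+ m n (f ∘ suc))) (sym (*-assoc _ _ _))

  prod-swap : ∀ m n (f : ℕ → ℕ → Carrier) →
              prod m (λ i → prod n (λ j → f i j)) ≈ prod n (λ j → prod m (λ i → f i j))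
  prod-swap m n f = Product.∑-comm {m} {n} (λ i j → f (toℕ i) (toℕ j))

  when-yes : ∀ {p} {P : Set p} {a} (P? : Dec P) → P → a when P? ≈ a
  when-yes (yes _) p = refl
  when-yes (no ¬p) p = contradiction p ¬p

  when-no : ∀ {p} {P : Set p} {a} (P? : Dec P) → ¬ P → a when P? ≈ 1#
  when-no (yes p) ¬p = contradiction p ¬p
  when-no (no _)  ¬p = refl

  when-cong : ∀ {p p′} {P : Set p} {P′ : Set p′} {a b} (P? : Dec P) (P′? : Dec P′) →
              (P → P′) → (P′ → P) → (P → a ≈ b) → a when P? ≈ b when P′?
  when-cong (yes p) P′? to from a≈b = trans (a≈b p) (sym (when-yes P′? (to p)))
  when-cong (no ¬p) P′? to from a≈b = sym (when-no P′? (¬p ∘ from))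

  prod-single : ∀ {p} {P : ℕ → Set p} (P? : ∀ i → Dec (P i)) n a i₀ → i₀ ℕ.< n → P i₀ →
                (∀ i → P i → i ≡ i₀) → prod n (λ i → a when P? i) ≈ a
  prod-single P? (suc n) a zero    i₀<n p uniq = trans
    (*-cong (when-yes (P? 0) p)
      (prod-1 n λ i _ → when-no (P? (suc i)) λ pᵢ → contradiction (uniq (suc i) pᵢ) λ ()))
    (*-identityʳ a)
  prod-single P? (suc n) a (suc i₀) (s<s i₀<n) p uniq = trans
    (*-cong (when-no (P? 0) λ p₀ → contradiction (uniq 0 p₀) λ ())
      (prod-single (P? ∘ suc) n a i₀ i₀<n p λ i pᵢ → ℕ.suc-injective (uniq (suc i) pᵢ)))
    (*-identityˡ a)

  prod-multiples : ∀ c e (f : ℕ → Carrier) → .{{NonZero c}} → (∀ k → ¬ (c ℕ.∣ k) → f k ≈ 1#) →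
                   prod (c ℕ.* e) (f ∘ suc) ≈ prod e (λ j → f (c ℕ.* suc j))
  prod-multiples c@(suc c-1) zero f f≈1 =
    reflexive (≡.cong (λ n → prod n (f ∘ suc)) (ℕ.*-zeroʳ c))
  prod-multiples c@(suc c-1) (suc e) f f≈1 = begin
    prod (c ℕ.* suc e) (f ∘ suc)
      ≡⟨ ≡.cong (λ n → prod n (f ∘ suc)) (ℕ.*-suc c e) ⟩
    prod (c ℕ.+ c ℕ.* e) (f ∘ suc)
      ≈⟨ prod-+ c (c ℕ.* e) (f ∘ suc) ⟩
    prod c (f ∘ suc) * prod (c ℕ.* e) (λ i → f (suc (c ℕ.+ i)))
      ≈⟨ *-cong first rest ⟩
    f (c ℕ.* 1) * prod e (λ j → f (c ℕ.* suc (suc j))) ∎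
    where
    first : prod c (f ∘ suc) ≈ f (c ℕ.* 1)
    first = begin
      prod c (f ∘ suc)          ≈⟨ prod-suc c-1 (f ∘ suc) ⟩
      prod c-1 (f ∘ suc) * f c  ≈⟨ *-congʳ (prod-1 c-1 λ i i<c-1 → f≈1 (suc i)
                                     λ c∣1+i → ℕ.<⇒≱ (s<s i<c-1) (ℕ.∣⇒≤ c∣1+i)) ⟩
      1# * f c                  ≈⟨ *-identityˡ (f c) ⟩
      f c                       ≡⟨ ≡.cong f (ℕ.*-identityʳ c) ⟨
      f (c ℕ.* 1)               ∎

    rest : prod (c ℕ.* e) (λ i → f (suc (c ℕ.+ i))) ≈ prod e (λ j → f (c ℕ.* suc (suc j)))
    rest = begin
      prod (c ℕ.* e) (λ i → f (suc (c ℕ.+ i)))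
        ≈⟨ prod-cong (c ℕ.* e) (λ i _ → reflexive (≡.cong f (≡.sym (ℕ.+-suc c i)))) ⟩
      prod (c ℕ.* e) (λ i → f (c ℕ.+ suc i))
        ≈⟨ prod-multiples c e (λ k → f (c ℕ.+ k))
             (λ k c∤k → f≈1 (c ℕ.+ k) (c∤k ∘ λ c∣ → ℕ.∣m+n∣m⇒∣n c∣ ℕ.∣-refl)) ⟩
      prod e (λ j → f (c ℕ.+ c ℕ.* suc j))
        ≈⟨ prod-cong e (λ j _ → reflexive (≡.cong f (≡.sym (ℕ.*-suc c (suc j))))) ⟩
      prod e (λ j → f (c ℕ.* suc (suc j))) ∎

  -- The indices 1, …, d are sorted by their gcd with d.
  prod-by-gcd : ∀ d → .{{NonZero d}} → (f h : ℕ → Carrier) →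
    (∀ c e → d ≡ c ℕ.* e → h e ≈ prod e (λ j → f (c ℕ.* suc j) when (ℕ.gcd (suc j) e ℕ.≟ 1))) →
    prod d (f ∘ suc) ≈ prod (suc d) (λ e → h e when (e ∣? d))
  prod-by-gcd d f h h≈ = begin
    prod d (f ∘ suc)
      ≈⟨ prod-cong d (λ i _ → sym (fibre (suc i))) ⟩
    prod d (λ i → prod (suc d) (λ e → f (suc i) when (e ℕ.* ℕ.gcd (suc i) d ℕ.≟ d)))
      ≈⟨ prod-swap d (suc d) (λ i e → f (suc i) when (e ℕ.* ℕ.gcd (suc i) d ℕ.≟ d)) ⟩
    prod (suc d) (λ e → prod d (λ i → f (suc i) when (e ℕ.* ℕ.gcd (suc i) d ℕ.≟ d)))
      ≈⟨ prod-cong (suc d) (λ e _ → slice e) ⟩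
    prod (suc d) (λ e → h e when (e ∣? d)) ∎
    where
    fibre : ∀ k → prod (suc d) (λ e → f k when (e ℕ.* ℕ.gcd k d ℕ.≟ d)) ≈ f k
    fibre k with ℕ.gcd[m,n]∣n k d
    ... | divides e₀ d≡e₀g = prod-single (λ e → e ℕ.* ℕ.gcd k d ℕ.≟ d) (suc d) (f k) e₀
      (s≤s (ℕ.∣⇒≤ (divides (ℕ.gcd k d) (≡.trans d≡e₀g (ℕ.*-comm e₀ _)))))
      (≡.sym d≡e₀g)
      (λ e eg≡d → ℕ.*-cancelʳ-≡ e e₀ (ℕ.gcd k d)
        {{ℕ.≢-nonZero (ℕ.gcd[m,n]≢0 k d (inj₂ (ℕ.≢-nonZero⁻¹ d)))}} (≡.trans eg≡d d≡e₀g))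

    slice : ∀ e → prod d (λ i → f (suc i) when (e ℕ.* ℕ.gcd (suc i) d ℕ.≟ d)) ≈ h e when (e ∣? d)
    slice e with e ∣? d
    ... | no e∤d = prod-1 d λ i _ → when-no {a = f (suc i)} (e ℕ.* ℕ.gcd (suc i) d ℕ.≟ d)
      λ eg≡d → e∤d (divides (ℕ.gcd (suc i) d) (≡.trans (≡.sym eg≡d) (ℕ.*-comm e _)))
    ... | yes (divides c d≡ce) = begin
      prod d (F ∘ suc)
        ≡⟨ ≡.cong (λ n → prod n (F ∘ suc)) d≡ce ⟩
      prod (c ℕ.* e) (F ∘ suc)
        ≈⟨ prod-multiples c e F (λ k c∤k → when-no (e ℕ.* ℕ.gcd k d ℕ.≟ d)
             λ eg≡d → c∤k (≡.subst (ℕ._∣ k) (gcd≡c k eg≡d) (ℕ.gcd[m,n]∣m k d))) ⟩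
      prod e (λ j → F (c ℕ.* suc j))
        ≈⟨ prod-cong e (λ j _ → when-cong {a = f (c ℕ.* suc j)}
             (e ℕ.* ℕ.gcd (c ℕ.* suc j) d ℕ.≟ d) (ℕ.gcd (suc j) e ℕ.≟ 1) (to j) (from j) (λ _ → refl)) ⟩
      prod e (λ j → f (c ℕ.* suc j) when (ℕ.gcd (suc j) e ℕ.≟ 1))
        ≈⟨ h≈ c e d≡ce ⟨
      h e ∎
      where
      F : ℕ → Carrier
      F k = f k when (e ℕ.* ℕ.gcd k d ℕ.≟ d)

      instance
        ce≢0 : NonZero (c ℕ.* e)
        ce≢0 = ≡.subst NonZero d≡ce (ℕ.≢-nonZero (ℕ.≢-nonZero⁻¹ d))
        c≢0 : NonZero c
        c≢0 = ℕ.m*n≢0⇒m≢0 c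
        e≢0 : NonZero e
        e≢0 = ℕ.m*n≢0⇒n≢0 c

      gcd≡c : ∀ k → e ℕ.* ℕ.gcd k d ≡ d → ℕ.gcd k d ≡ c
      gcd≡c k eg≡d = ℕ.*-cancelˡ-≡ _ c e (≡.trans eg≡d (≡.trans d≡ce (ℕ.*-comm c e)))

      gcd-scaled : ∀ j → ℕ.gcd (c ℕ.* suc j) d ≡ c ℕ.* ℕ.gcd (suc j) e
      gcd-scaled j = ≡.trans (≡.cong (ℕ.gcd (c ℕ.* suc j)) d≡ce)
                             (≡.sym (ℕ.c*gcd[m,n]≡gcd[cm,cn] c (suc j) e))

      to : ∀ j → e ℕ.* ℕ.gcd (c ℕ.* suc j) d ≡ d → ℕ.gcd (suc j) e ≡ 1
      to j eg≡d = ℕ.*-cancelˡ-≡ _ 1 c (≡.trans (≡.sym (gcd-scaled j))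
        (≡.trans (gcd≡c (c ℕ.* suc j) eg≡d) (≡.sym (ℕ.*-identityʳ c))))

      from : ∀ j → ℕ.gcd (suc j) e ≡ 1 → e ℕ.* ℕ.gcd (c ℕ.* suc j) d ≡ d
      from j g≡1 = ≡.trans (≡.cong (e ℕ.*_) (≡.trans (gcd-scaled j)
        (≡.trans (≡.cong (c ℕ.*_) g≡1) (ℕ.*-identityʳ c)))) (≡.trans (ℕ.*-comm e c) (≡.sym d≡ce))

module MonicRoots {c ℓ : Level} (K : CommutativeRing c ℓ) where

  private
    module K = CommutativeRing K
    open Polynomial K
    module KX = FiniteProducts commutativeRing
    open RingProperties K.ring using (-‿distribˡ-*; -0#≈0#)

  -- The monic polynomial whose lower coefficients are p.
  monic : Poly → Poly
  monic []      = C K.1#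
  monic (a ∷ p) = a ∷ monic p

  -- Its value at t.
  eval : Poly → K.Carrier → K.Carrier
  eval []      t = K.1#
  eval (a ∷ p) t = a K.+ t K.* eval p t

  -- The lower coefficients of its quotient by X - t.
  divide : K.Carrier → Poly → Poly
  divide t []          = []
  divide t (_ ∷ [])    = []
  divide t (_ ∷ b ∷ p) = eval (b ∷ p) t ∷ divide t (b ∷ p)

  linear : K.Carrier → Poly
  linear t = X + - C t

  private
    module _ where
      open SetoidReasoning K.setoid
      open NatSolver K.commutativeSemiring

      cancel-neg : ∀ t E p → (p K.+ t K.* E) K.+ ((K.- t) K.* E) K.≈ p
      cancel-neg t E p = begin
        (p K.+ t K.* E) K.+ ((K.- t) K.* E)    ≈⟨ K.+-assoc _ _ _ ⟩
        p K.+ (t K.* E K.+ (K.- t) K.* E)      ≈⟨ K.+-congˡ (K.distribʳ E t (K.- t)) ⟨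
        p K.+ ((t K.+ K.- t) K.* E)            ≈⟨ K.+-congˡ (K.*-congʳ (K.-‿inverseʳ t)) ⟩
        p K.+ (K.0# K.* E)                     ≈⟨ K.+-congˡ (K.zeroˡ E) ⟩
        p K.+ K.0#                             ≈⟨ K.+-identityʳ p ⟩
        p                                      ∎

      eval-divide-step : ∀ p s t δ E D → t K.+ δ K.≈ s →
        p K.+ s K.* (E K.+ δ K.* D) K.≈ (p K.+ t K.* E) K.+ δ K.* (E K.+ s K.* D)
      eval-divide-step p s t δ E D t+δ≈s = begin
        p K.+ s K.* (E K.+ δ K.* D)
          ≈⟨ solve 5 (λ p s δ E D → p :+ s :* (E :+ δ :* D) := p :+ s :* E :+ s :* (δ :* D))
               K.refl p s δ E D ⟩
        p K.+ s K.* E K.+ s K.* (δ K.* D)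
          ≈⟨ K.+-congʳ (K.+-congˡ (K.*-congʳ t+δ≈s)) ⟨
        p K.+ (t K.+ δ) K.* E K.+ s K.* (δ K.* D)
          ≈⟨ solve 6 (λ p s t δ E D → p :+ (t :+ δ) :* E :+ s :* (δ :* D) :=
               (p :+ t :* E) :+ δ :* (E :+ s :* D)) K.refl p s t δ E D ⟩
        (p K.+ t K.* E) K.+ δ K.* (E K.+ s K.* D) ∎

      t+[s-t]≈s : ∀ s t → t K.+ (s K.- t) K.≈ s
      t+[s-t]≈s s t = begin
        t K.+ (s K.+ K.- t)    ≈⟨ K.+-congˡ (K.+-comm s (K.- t)) ⟩
        t K.+ (K.- t K.+ s)    ≈⟨ K.+-assoc t (K.- t) s ⟨
        (t K.+ K.- t) K.+ s    ≈⟨ K.+-congʳ (K.-‿inverseʳ t) ⟩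
        K.0# K.+ s             ≈⟨ K.+-identityˡ s ⟩
        s                      ∎

  linear-* : ∀ t p → linear t * p ≋ (K.- t) · p + (K.0# ∷ p)
  linear-* t p = +-cong (·-cong (K.+-identityˡ _) ≋-refl)
    (∷-cong K.refl (≋-trans (C-* K.1# p) (·-identity p)))

  monic-divide : ∀ t a p →
    monic (a ∷ p) ≋ C (eval (a ∷ p) t) + linear t * monic (divide t (a ∷ p))
  monic-divide t a [] = ≋-sym (≋-trans
    (+-cong (≋-refl {C (eval (a ∷ []) t)}) (linear-* t (C K.1#)))
    (∷-cong (K.trans (K.+-congˡ (K.+-identityʳ _)) (cancel-neg t K.1# a)) ≋-refl))
  monic-divide t a (b ∷ p) = ≋-sym (≋-trans
    (+-cong (≋-refl {C (a K.+ t K.* E)}) (linear-* t (E ∷ D)))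
    (∷-cong (K.trans (K.+-congˡ (K.+-identityʳ _)) (cancel-neg t E a))
      (≋-trans (≋-trans shuffle (+-cong (≋-refl {C E}) (≋-sym (linear-* t D))))
        (≋-sym (monic-divide t b p)))))
    where
    E = eval (b ∷ p) t
    D = monic (divide t (b ∷ p))
    t̄D = (K.- t) · D

    shuffle : t̄D + (E ∷ D) ≋ C E + (t̄D + (K.0# ∷ D))
    shuffle =
      ≋-trans (+-cong (≋-refl {t̄D}) (∷-cong {p = D} (K.sym (K.+-identityʳ E)) ≋-refl))
      (≋-trans (≋-sym (+-assoc t̄D (C E) (K.0# ∷ D)))
      (≋-trans (+-cong (+-comm t̄D (C E)) ≋-refl) (+-assoc (C E) t̄D (K.0# ∷ D))))

  eval-divide : ∀ s t a p → eval (a ∷ p) s K.≈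
    eval (a ∷ p) t K.+ (s K.- t) K.* eval (divide t (a ∷ p)) s
  eval-divide s t a [] = K.trans (K.+-congˡ (K.*-congʳ (K.sym (t+[s-t]≈s s t))))
    (K.trans (K.+-congˡ (K.distribʳ K.1# t (s K.- t))) (K.sym (K.+-assoc _ _ _)))
  eval-divide s t a (b ∷ p) = K.trans
    (K.+-congˡ (K.*-congˡ (eval-divide s t b p)))
    (eval-divide-step a s t (s K.- t) _ _ (t+[s-t]≈s s t))

  length-divide : ∀ t a p → length (divide t (a ∷ p)) ≡ length p
  length-divide t a []      = ≡.refl
  length-divide t a (b ∷ p) = ≡.cong suc (length-divide t b p)

  Regular : K.Carrier → Set (c ⊔ ℓ)
  Regular a = ∀ b → a K.* b K.≈ K.0# → b K.≈ K.0#

  monic-factors : ∀ p (root : ℕ → K.Carrier) →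
    (∀ i → i ℕ.< length p → eval p (root i) K.≈ K.0#) →
    (∀ i j → i ℕ.< j → j ℕ.< length p → Regular (root j K.- root i)) →
    monic p ≋ KX.prod (length p) (linear ∘ root)
  monic-factors p root = go (length p) p ≡.refl root
    where
    go : ∀ n p → length p ≡ n → (root : ℕ → K.Carrier) →
      (∀ i → i ℕ.< n → eval p (root i) K.≈ K.0#) →
      (∀ i j → i ℕ.< j → j ℕ.< n → Regular (root j K.- root i)) →
      monic p ≋ KX.prod n (linear ∘ root)
    go zero    []      _   root vanish reg = ≋-refl
    go (suc n) (a ∷ p) eq  root vanish reg =
      ≋-trans (monic-divide t a p)
      (≋-trans (+-cong (0∷[]≋[] (vanish 0 z<s)) ≋-refl)
      (*-congʳ (linear t) (go n (divide t (a ∷ p))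
        (≡.trans (length-divide t a p) (ℕ.suc-injective eq)) (root ∘ suc)
        (λ i i<n → reg 0 (suc i) z<s (s<s i<n) _ (quotient-vanishes i i<n))
        (λ i j i<j j<n → reg (suc i) (suc j) (s<s i<j) (s<s j<n)))))
      where
      t = root 0
      open SetoidReasoning K.setoid

      quotient-vanishes : ∀ i → i ℕ.< n →
        (root (suc i) K.- t) K.* eval (divide t (a ∷ p)) (root (suc i)) K.≈ K.0#
      quotient-vanishes i i<n = begin
        δD                        ≈⟨ K.+-identityˡ δD ⟨
        K.0# K.+ δD               ≈⟨ K.+-congʳ (vanish 0 z<s) ⟨
        eval (a ∷ p) t K.+ δD     ≈⟨ eval-divide (root (suc i)) t a p ⟨
        eval (a ∷ p) (root (suc i)) ≈⟨ vanish (suc i) (s<s i<n) ⟩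
        K.0#                      ∎
        where δD = (root (suc i) K.- t) K.* eval (divide t (a ∷ p)) (root (suc i))

module ΦRoots {c ℓ : Level} (K : CommutativeRing c ℓ) (f : ℤ → CommutativeRing.Carrier K)
  (f-hom : IsRingHomomorphism (CommutativeRing.rawRing ℤ.+-*-commutativeRing) (CommutativeRing.rawRing K) f)
  where

  private
    module K = RingNotation K
    module ℤq = Polynomial ℤ.+-*-commutativeRing
    module Q = RingNotation ℤ[q]-ring
    module QP = FiniteProducts ℤ[q]-ring
  open QPolynomials
  open Polynomial K using (C; X; ≋-refl; ≋-trans; ≋-sym; ∷-cong; length-*-≤; 0∷[]≋[]; X-*; mk≋; at)
  open RingNotation (Polynomial.commutativeRing K)
  open PolynomialMap ℤ.+-*-commutativeRing K f f-hom
  open MonicRoots K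
  open FiniteProducts (Polynomial.commutativeRing K)

  -- In an integral domain, the second field says that ζ ^ k ≉ 1 for 0 < k < d.
  record IsPrimitiveRoot (d : ℕ) (ζ : K.Carrier) : Set (c ⊔ ℓ) where
    field
      power-d   : ζ K.^ d K.≈ K.1#
      powers-<d : ∀ k → 0 ℕ.< k → k ℕ.< d → Regular (ζ K.^ k K.- K.1#)
  open IsPrimitiveRoot

  private
    primitive-factors : K.Carrier → ℕ → Carrier
    primitive-factors ζ d = ∏[ j < d ] ((X - C (ζ K.^ suc (toℕ j))) when (ℕ.gcd (suc (toℕ j)) d ℕ.≟ 1))

    linear-cong : ∀ {s t} → s K.≈ t → linear s ≈ linear t
    linear-cong s≈t = +-congˡ {X} (-‿cong (∷-cong {p = []} s≈t ≋-refl))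

    primitive-power : ∀ d c e ζ → .{{NonZero c}} → d ≡ c ℕ.* e →
                      IsPrimitiveRoot d ζ → IsPrimitiveRoot e (ζ K.^ c)
    primitive-power d c e ζ d≡ce prim .power-d = K.trans (K.^-assocʳ ζ c e)
      (K.trans (K.reflexive (≡.cong (ζ K.^_) (≡.sym d≡ce))) (prim .power-d))
    primitive-power d c e ζ d≡ce prim .powers-<d k 0<k k<e b e₀ = prim .powers-<d (c ℕ.* k)
      (ℕ.<-≤-trans 0<k (ℕ.m≤n*m k c))
      (≡.subst (c ℕ.* k ℕ.<_) (≡.sym d≡ce) (ℕ.*-monoʳ-< c k<e)) b
      (K.trans (K.*-congʳ (K.+-congʳ (K.sym (K.^-assocʳ ζ c k)))) e₀)

    module CyclotomicFactorisation (d-1 : ℕ) (ζ : K.Carrier) (prim : IsPrimitiveRoot (suc d-1) ζ) where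

      d = suc d-1
      open SetoidReasoning K.setoid
      open RingProperties K.ring using (x[y-z]≈xy-xz)

      zeros : ℕ → List K.Carrier
      zeros n = replicate n K.0#

      lower : List K.Carrier
      lower = (K.- K.1#) ∷ zeros d-1

      length-lower : length lower ≡ d
      length-lower = ≡.cong suc (List.length-replicate d-1)

      monic-zeros : ∀ n → monic (zeros n) ≈ X ^ n
      monic-zeros zero    = ≋-refl
      monic-zeros (suc n) = ≋-trans (∷-cong K.refl (monic-zeros n)) (≋-sym (X-* (X ^ n)))

      monic-lower : monic lower ≈ X ^ d - 1#
      monic-lower = ≋-sym (≋-trans
        (+-congʳ {Polynomial.-_ K 1#} (≋-trans (X-* (X ^ d-1)) (∷-cong K.refl (≋-sym (monic-zeros d-1)))))
        (∷-cong (K.+-identityˡ _) (+-identityʳ (monic (zeros d-1)))))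

      eval-zeros : ∀ n t → eval (zeros n) t K.≈ t K.^ n
      eval-zeros zero    t = K.refl
      eval-zeros (suc n) t = K.trans (K.+-identityˡ _) (K.*-congˡ (eval-zeros n t))

      eval-lower : ∀ t → t K.^ d K.≈ K.1# → eval lower t K.≈ K.0#
      eval-lower t t^d≈1 = K.trans (K.+-congˡ (K.trans (K.*-congˡ (eval-zeros d-1 t)) t^d≈1))
                                   (K.-‿inverseˡ K.1#)

      1^n : ∀ n → K.1# K.^ n K.≈ K.1#
      1^n zero    = K.refl
      1^n (suc n) = K.trans (K.*-identityˡ _) (1^n n)

      root-power : ∀ i → (ζ K.^ i) K.^ d K.≈ K.1#
      root-power i = begin
        (ζ K.^ i) K.^ d       ≈⟨ K.^-assocʳ ζ i d ⟩
        ζ K.^ (i ℕ.* d)       ≡⟨ ≡.cong (ζ K.^_) (ℕ.*-comm i d) ⟩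
        ζ K.^ (d ℕ.* i)       ≈⟨ K.^-assocʳ ζ d i ⟨
        (ζ K.^ d) K.^ i       ≈⟨ K.^-congˡ i (prim .power-d) ⟩
        K.1# K.^ i            ≈⟨ 1^n i ⟩
        K.1#                  ∎

      regular-difference : ∀ i k m → d ≡ suc i ℕ.+ m → suc k ℕ.< d →
        Regular (ζ K.^ (suc i ℕ.+ suc k) K.- ζ K.^ suc i)
      regular-difference i k m d≡ k<d b e = prim .powers-<d (suc k) z<s k<d b (begin
        w K.* b                 ≈⟨ K.*-identityˡ _ ⟨
        K.1# K.* (w K.* b)      ≈⟨ K.*-congʳ vu≈1 ⟨
        v K.* u K.* (w K.* b)   ≈⟨ K.*-assoc v u _ ⟩
        v K.* (u K.* (w K.* b)) ≈⟨ K.*-congˡ (K.*-assoc u w b) ⟨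
        v K.* (u K.* w K.* b)   ≈⟨ K.*-congˡ (K.*-congʳ uw≈) ⟩
        v K.* ((ζ K.^ (suc i ℕ.+ suc k) K.- u) K.* b) ≈⟨ K.*-congˡ e ⟩
        v K.* K.0#              ≈⟨ K.zeroʳ v ⟩
        K.0#                    ∎)
        where
        u = ζ K.^ suc i
        v = ζ K.^ m
        w = ζ K.^ suc k K.- K.1#

        vu≈1 : v K.* u K.≈ K.1#
        vu≈1 = begin
          v K.* u                ≈⟨ K.*-comm v u ⟩
          u K.* v                ≈⟨ K.^-homo-* ζ (suc i) m ⟨
          ζ K.^ (suc i ℕ.+ m)    ≡⟨ ≡.cong (ζ K.^_) d≡ ⟨
          ζ K.^ d                ≈⟨ prim .power-d ⟩
          K.1#                   ∎

        uw≈ : u K.* w K.≈ ζ K.^ (suc i ℕ.+ suc k) K.- u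
        uw≈ = begin
          u K.* w                             ≈⟨ x[y-z]≈xy-xz u (ζ K.^ suc k) K.1# ⟩
          u K.* ζ K.^ suc k K.- u K.* K.1#    ≈⟨ K.+-cong (K.sym (K.^-homo-* ζ (suc i) (suc k)))
                                                   (K.-‿cong (K.*-identityʳ u)) ⟩
          ζ K.^ (suc i ℕ.+ suc k) K.- u       ∎

      regular-roots : ∀ i j → i ℕ.< j → j ℕ.< d → Regular (ζ K.^ suc j K.- ζ K.^ suc i)
      regular-roots i j i<j j<d with ℕ.m≤n⇒∃[o]m+o≡n i<j | ℕ.m≤n⇒∃[o]m+o≡n (ℕ.<-trans i<j j<d)
      ... | k , ≡.refl | m , eq = ≡.subst (λ n → Regular (ζ K.^ n K.- ζ K.^ suc i))
        (ℕ.+-suc (suc i) k)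
        (regular-difference i k m (≡.sym eq)
          (ℕ.≤-<-trans (s≤s (ℕ.m≤n+m k i)) j<d))

      factorisation : X ^ d - 1# ≈ prod d (λ i → X - C (ζ K.^ suc i))
      factorisation = ≋-trans (≋-sym monic-lower)
        (≡.subst (λ n → monic lower ≈ prod n (λ i → X - C (ζ K.^ suc i))) length-lower
          (monic-factors lower (λ i → ζ K.^ suc i)
            (λ i _ → eval-lower (ζ K.^ suc i) (root-power (suc i)))
            (λ i j i<j j<n → regular-roots i j i<j (≡.subst (j ℕ.<_) length-lower j<n))))

    ±1 : ℤ[q] → Set
    ±1 p = ℤq.coeff p 0 ℤ.* ℤq.coeff p 0 ≡ + 1

    square-* : ∀ a b → a ℤ.* a ≡ + 1 → b ℤ.* b ≡ + 1 → (a ℤ.* b) ℤ.* (a ℤ.* b) ≡ + 1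
    square-* a b a² b² = ≡.trans
      (NS.solve 2 (λ a b → (a NS.:* b) NS.:* (a NS.:* b) NS.:= (a NS.:* a) NS.:* (b NS.:* b)) ≡.refl a b)
      (≡.cong₂ ℤ._*_ a² b²)
      where module NS = NatSolver ℤ.+-*-commutativeSemiring

    ±1-* : ∀ p q → ±1 p → ±1 q → ±1 (p Q.* q)
    ±1-* p q p² q² = ≡.trans (≡.cong₂ ℤ._*_ (ℤq.coeff-*-0 p q) (ℤq.coeff-*-0 p q))
                             (square-* (ℤq.coeff p 0) (ℤq.coeff q 0) p² q²)

    ±1-prod : ∀ n (g : ℕ → ℤ[q]) → (∀ i → i ℕ.< n → ±1 (g i)) → ±1 (QP.prod n g)
    ±1-prod zero    g g±1 = ≡.refl
    ±1-prod (suc n) g g±1 = ±1-* (g 0) (QP.prod n (g ∘ suc)) (g±1 0 z<s)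
      (±1-prod n (g ∘ suc) (λ i i<n → g±1 (suc i) (s<s i<n)))

    q^d-1 : ℕ → ℤ[q]
    q^d-1 d = q Q.^ d Q.- Q.1#

    divisor : ℕ → ℤ[q]
    divisor d = QP.prod d (λ e → Φ e Q.when (e ∣? d))

    length-q^d-1 : ∀ d → suc d ℕ.≤ length (q^d-1 d)
    length-q^d-1 d = ℕ.≤-trans (length-q^ d) (ℤq.length-+-≥ˡ (q Q.^ d) (Q.- Q.1#))
      where
      length-q^ : ∀ d → suc d ℕ.≤ length (q Q.^ d)
      length-q^ zero    = s≤s z≤n
      length-q^ (suc d) = ℕ.≤-trans (s≤s (length-q^ d)) (ℤq.length-X*-≥ (q Q.^ d))

    coeff-q^d-1 : ∀ d → ℤq.coeff (q^d-1 (suc d)) 0 ≡ -[1+ 0 ]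
    coeff-q^d-1 d = ≡.trans (ℤq.coeff-+ (q Q.^ suc d) (Q.- Q.1#) 0)
      (≡.cong (ℤ._+ -[1+ 0 ]) (ℤq.X-* (q Q.^ d) .ℤq.at 0))

    ±1-quotient : ∀ n a b → ℤq.coeff a 0 ≡ -[1+ 0 ] → ±1 b → ±1 (ℤq.quotient (suc n) a b)
    ±1-quotient n a b a₀ b² = square-* (ℤq.coeff b 0) (ℤq.coeff a 0) b²
      (≡.cong₂ ℤ._*_ a₀ a₀)

    0∤ : ∀ d → .{{NonZero d}} → ¬ (0 ℕ.∣ d)
    0∤ d 0∣d = ℕ.≢-nonZero⁻¹ d (ℕ.0∣⇒≡0 0∣d)

    ±1-divisor : ∀ d → .{{NonZero d}} → (∀ e → e ℕ.< d → NonZero e → ±1 (Φ e)) → ±1 (divisor d)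
    ±1-divisor d IH = ±1-prod d (λ e → Φ e Q.when (e ∣? d)) factor
      where
      factor : ∀ e → e ℕ.< d → ±1 (Φ e Q.when (e ∣? d))
      factor e       e<d with e ∣? d
      factor e       e<d | no _    = ≡.refl
      factor zero    e<d | yes 0∣d = contradiction 0∣d (0∤ d)
      factor (suc e) e<d | yes _   = IH (suc e) e<d _

    ±1-Φ : ∀ d → NonZero d → ±1 (Φ d)
    ±1-Φ = <-rec (λ d → NonZero d → ±1 (Φ d)) step
      where
      step : ∀ d → (∀ {e} → e ℕ.< d → NonZero e → ±1 (Φ e)) → NonZero d → ±1 (Φ d)
      step d@(suc d-1) IH _ = ≡.subst ±1 (≡.sym (Φ-unfold d)) (lemma (length (q^d-1 d)) (length-q^d-1 d))
        where
        lemma : ∀ n → suc d ℕ.≤ n → ±1 (ℤq.quotient n (q^d-1 d) (divisor d))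
        lemma (suc n) _ = ±1-quotient n (q^d-1 d) (divisor d) (coeff-q^d-1 d-1)
                                      (±1-divisor d (λ e e<d e≢0 → IH e<d e≢0))

    map-prod : ∀ n (g : ℕ → ℤ[q]) → map (QP.prod n g) ≈ prod n (map ∘ g)
    map-prod zero    g = map-1#
    map-prod (suc n) g = trans (map-* (g 0) (QP.prod n (g ∘ suc))) (*-congˡ {map (g 0)} (map-prod n (g ∘ suc)))

    map-q^d-1 : ∀ d → map (q^d-1 d) ≈ X ^ d - 1#
    map-q^d-1 d = trans (map-+ (q Q.^ d) (Q.- Q.1#)) (+-cong (map-q^ d) (trans (map-neg Q.1#) (-‿cong map-1#)))
      where
      map-q^ : ∀ d → map (q Q.^ d) ≈ X ^ d
      map-q^ zero    = map-1#
      map-q^ (suc d) = trans (map-* q (q Q.^ d)) (*-cong map-X (map-q^ d))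

    length-primitive-factors : ∀ ζ d → length (primitive-factors ζ d) ℕ.≤ suc d
    length-primitive-factors ζ d = go d (λ j → (X - C (ζ K.^ suc j)) when (ℕ.gcd (suc j) d ℕ.≟ 1)) (λ j → factor-length j (ℕ.gcd (suc j) d ℕ.≟ 1))
      where
      factor-length : ∀ j {P : Set} (P? : Dec P) → length ((X - C (ζ K.^ suc j)) when P?) ℕ.≤ 2
      factor-length j (yes _) = ℕ.≤-refl
      factor-length j (no _)  = s≤s z≤n

      go : ∀ n (g : ℕ → Carrier) → (∀ j → length (g j) ℕ.≤ 2) → length (prod n g) ℕ.≤ suc n
      go zero    g g≤ = ℕ.≤-refl
      go (suc n) g g≤ = length-*-≤ 1 n (g 0) (prod n (g ∘ suc)) (g≤ 0) (go n (g ∘ suc) (g≤ ∘ suc))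

  -- For ℂ and ζ = exp(2πi/d) this reads Φ d = ∏_{1 ≤ k ≤ d, gcd(k,d) = 1} (X - exp(2πik/d)).
  Φ-roots : ∀ d → NonZero d → ∀ ζ → IsPrimitiveRoot d ζ →
    map (Φ d) ≈ ∏[ j < d ] ((X - C (ζ K.^ suc (toℕ j))) when (ℕ.gcd (suc (toℕ j)) d ℕ.≟ 1))
  Φ-roots = <-rec Goal step
    where
    Goal : ℕ → Set (c ⊔ ℓ)
    Goal d = NonZero d → ∀ ζ → IsPrimitiveRoot d ζ → map (Φ d) ≈ primitive-factors ζ d

    step : ∀ d → (∀ {e} → e ℕ.< d → Goal e) → Goal d
    step d@(suc d-1) IH _ ζ prim = ≡.subst (λ p → map p ≈ primitive-factors ζ d) (≡.sym (Φ-unfold d))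
      (map-quotient (length (q^d-1 d)) (q^d-1 d) (divisor d) (primitive-factors ζ d)
        (±1-divisor d (λ e _ → ±1-Φ e))
        product
        (ℕ.≤-trans (length-primitive-factors ζ d) (length-q^d-1 d)))
      where
      factors : ∀ {e} → Dec (e ℕ.∣ d) → Carrier
      factors {e} (yes (divides c _)) = primitive-factors (ζ K.^ c) e
      factors     (no _)              = 1#

      h : ℕ → Carrier
      h e = factors (e ∣? d)

      h≈ : ∀ c e → d ≡ c ℕ.* e → h e ≈
        prod e (λ j → (X - C (ζ K.^ (c ℕ.* suc j))) when (ℕ.gcd (suc j) e ℕ.≟ 1))
      h≈ c e d≡ce with e ∣? d
      ... | no e∤d = contradiction (divides c d≡ce) e∤d
      ... | yes (divides c′ d≡c′e) = prod-cong e λ j _ →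
        when-cong {a = X - C ((ζ K.^ c′) K.^ suc j)} (ℕ.gcd (suc j) e ℕ.≟ 1) (ℕ.gcd (suc j) e ℕ.≟ 1)
          (λ p → p) (λ p → p)
          (λ _ → linear-cong (K.trans (K.^-assocʳ ζ c′ (suc j))
            (K.reflexive (≡.cong (λ c → ζ K.^ (c ℕ.* suc j)) c′≡c))))
        where
        instance
          ce≢0 : NonZero (c ℕ.* e)
          ce≢0 = ≡.subst NonZero d≡ce _
        c′≡c : c′ ≡ c
        c′≡c = ℕ.*-cancelʳ-≡ c′ c e {{ℕ.m*n≢0⇒n≢0 c}} (≡.trans (≡.sym d≡c′e) d≡ce)

      h-d : h d when (d ∣? d) ≈ primitive-factors ζ d
      h-d = trans (when-yes {a = h d} (d ∣? d) ℕ.∣-refl)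
        (trans (h≈ 1 d (≡.sym (ℕ.*-identityˡ d)))
          (prod-cong d (λ j _ → reflexive (≡.cong (λ k → (X - C (ζ K.^ k)) when (ℕ.gcd (suc j) d ℕ.≟ 1))
            (ℕ.*-identityˡ (suc j))))))

      map-divisor : map (divisor d) ≈ prod d (λ e → h e when (e ∣? d))
      map-divisor = trans (map-prod d (λ e → Φ e Q.when (e ∣? d))) (prod-cong d factor)
        where
        factor : ∀ e → e ℕ.< d → map (Φ e Q.when (e ∣? d)) ≈ h e when (e ∣? d)
        factor e       e<d with e ∣? d
        factor e       e<d | no _    = map-1#
        factor zero    e<d | yes 0∣d = contradiction 0∣d (0∤ d)
        factor (suc e) e<d | yes (divides c d≡ce) = IH e<d _ (ζ K.^ c)
          (primitive-power d c (suc e) ζ {{ℕ.m*n≢0⇒m≢0 c {{≡.subst NonZero d≡ce _}}}} d≡ce prim)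

      product : primitive-factors ζ d * map (divisor d) ≈ map (q^d-1 d)
      product = trans (*-comm (primitive-factors ζ d) (map (divisor d)))
        (trans (*-cong map-divisor (sym h-d))
        (trans (sym (prod-suc d (λ e → h e when (e ∣? d))))
        (trans (sym (prod-by-gcd d (λ k → X - C (ζ K.^ k)) h h≈))
        (trans (sym (CyclotomicFactorisation.factorisation d-1 ζ prim))
        (sym (map-q^d-1 d))))))

open QPolynomials public using ([_]; Φ; _⟨q²⟩; q)
open WPolynomials public using (ι; w; _⟨q²⟩ₓ)
open RingNotation ℤ[q,q⁻¹][x]-ring public
  using (_+_; _*_; -_; 1#; _^_; _∣_; _when_; sum-syntax; sum⁺-syntax; ∏-syntax; ∏⁺-syntax)

{-# OPTIONS --safe #-}

-- Modulo Φ_d(q) for odd d, and modulo Φ_d(q²) for even d, the element Q = q² behaves as a primitive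
-- d-th root of unity and (-q)^d = -1. By the q-Lucas theorem the coefficient of x^i in w_k(x;q²) depends,
-- up to ordinary binomial coefficients, only on k and i modulo d; there it is, by
--   [j] ([k-1,j-1][k+j,j] - [k,j][k+j,j-1]) = q^k [k-1,j-1] [k+j,j-1],
-- symmetric under k ↦ -1-k up to a power of Q. Hence in each block of d consecutive k the summands at
-- k = sd + t and k′ = sd + (d-1-t) are opposite, where those with t = 0 or t = d-1 vanish because d
-- divides k(k+1); so twice the sum of a block is zero, and the quotient has no 2-torsion.
--
-- The factors belonging to different d are coprime up to an integer: if c = d/gcd(d,e) > 1, then modulo
-- both of them Q^gcd(d,e) = 1, while the sum of Q^(i gcd(d,e)) over i < c vanishes, so c = 0. Since they
-- have constant coefficient ±1, integers can be cancelled, and the product divides the sum. The same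
-- argument, applied to q, shows that ∏_{e ∣ d, e < d} Φ_e divides q^d - 1, i.e. that the division
-- defining Φ_d is exact.

module Submission where

open import Algebra.Bundles using (CommutativeRing)
open import Algebra.Definitions.RawMagma using (_,_)
import Algebra.Morphism.Construct.Composition as Composition
open import Algebra.Morphism.Structures using (IsRingHomomorphism)
import Algebra.Properties.CommutativeSemiring.Exp as Exp
import Algebra.Properties.Ring as RingProperties
import Algebra.Properties.Semiring.Divisibility as Divisibility
import Algebra.Properties.Semiring.Mult as Mult
import Algebra.Properties.Semiring.Sum as SemiringSum
import Algebra.Solver.Ring.NaturalCoefficients.Default as NatSolver
open import Data.Fin.Base as Fin using (toℕ)
open import Data.Integer.Base as ℤ using (ℤ; +_; -[1+_])
import Data.Integer.Properties as ℤ
open import Data.List.Base using ([]; _∷_; length; take)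
open import Data.Nat.Base as ℕ using (ℕ; zero; suc; NonZero; z≤n; s≤s; z<s; s<s)
import Data.Nat.Combinatorics as ℕ
open import Data.Nat.Divisibility as ℕ using (_∣?_)
import Data.Nat.DivMod as ℕ
import Data.Nat.GCD as ℕ
open import Data.Nat.Induction using (<-rec)
open import Data.Nat.Properties as ℕ using (_<?_)
open import Data.Nat.Solver using (module +-*-Solver)
open import Data.Product.Base as Σ using (_,_; proj₁; proj₂)
open import Data.Sum.Base using (inj₁; inj₂)
open import Function.Base using (_∘_)
open import Level using (Level; _⊔_)
open import Relation.Binary.PropositionalEquality as ≡ using (_≡_; _≢_)
import Relation.Binary.Reasoning.Setoid as SetoidReasoning
open import Relation.Nullary using (Dec; yes; no; ¬_; contradiction)
open import Relation.Nullary.Decidable using (_×-dec_; ¬?)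
open import Defs using (module RingNotation; module FiniteProducts; module Polynomial; module PolynomialMap;
  module Localisation; module Laurent; module QPolynomials; module WPolynomials; ÷-exact;
  ℤ[q]; ℤ[q]-ring; ℤ[q,q⁻¹]-ring; ℤ[q,q⁻¹][x]-ring; q)

-- The rings `R / f` come without a cancellation law, so the notion of primitive root has to supply
-- one. If t^j fixes b and d does not divide j, Bézout makes t^gcd(j,d) fix b; the vanishing
-- geometric sum then acts on b as a positive integer, and absence of integer torsion gives b = 0.
-- This permits division by [j] for 0 < j < d, on which q-Lucas and the reflection rest. The factor
-- q^((n-1-k)(2αm+1)) is dictated by the reflection k ↦ k′. The symmetry of the coefficients gives
-- w_k′ Q^(αk) = w_k Q^(αk′), whose m-th power sets q^(2αmk) against q^(2αmk′); the odd q-integers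
-- satisfy (-1)^k′ [2k′+1] q^k = -(-1)^k [2k+1] q^k′. Together these are q^(k(2αm+1)) and
-- q^(k′(2αm+1)), which the given factor balances. The minus sign arises because k + k′ + 1 is an
-- odd multiple of d, so that (-q)^(k+k′+1) = -1. Negative exponents are avoided: identities are
-- first multiplied by powers of q, which are units modulo each factor, until all exponents are
-- natural numbers.

-- q-integers and Gaussian binomials over an arbitrary commutative ring

module QAnalogues {c ℓ : Level} (R : CommutativeRing c ℓ) where

  open RingNotation R
  open Mult semiring using (_×_)
  open FiniteProducts R using (prod; prod-suc)
  open NatSolver commutativeSemiring using (solve; _:=_; _:+_; _:*_; con)
  open SetoidReasoning setoid

  int : Carrier → ℕ → Carrier
  int q zero    = 0#
  int q (suc n) = 1# + q * int q n

  gauss : Carrier → ℕ → ℕ → Carrier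
  gauss q _       zero    = 1#
  gauss q zero    (suc k) = 0#
  gauss q (suc n) (suc k) = gauss q n k + q ^ suc k * gauss q n (suc k)

  ^-congʳ : ∀ a {m n} → m ≡ n → a ^ m ≈ a ^ n
  ^-congʳ a eq = reflexive (≡.cong (a ^_) eq)

  1^n : ∀ n → 1# ^ n ≈ 1#
  1^n zero    = refl
  1^n (suc n) = trans (*-identityˡ _) (1^n n)

  0^n : ∀ n → .{{NonZero n}} → 0# ^ n ≈ 0#
  0^n (suc n) = zeroˡ _

  -- The form `a * b ≈ b` says that a equals 1 modulo the annihilator of b. Regularity and
  -- coprimality are both proved by computing with such equations.
  ^-fixed : ∀ {a b} → a * b ≈ b → ∀ n → a ^ n * b ≈ b
  ^-fixed         e zero    = *-identityˡ _
  ^-fixed {a} {b} e (suc n) = trans (*-assoc a (a ^ n) b) (trans (*-congˡ (^-fixed e n)) e)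

  ^≈1 : ∀ {a} n → a ^ n ≈ 1# → ∀ m → a ^ (n ℕ.* m) ≈ 1#
  ^≈1 {a} n e m = trans (sym (^-assocʳ a n m)) (trans (^-congˡ m e) (1^n m))

  int-cong : ∀ {q q′} → q ≈ q′ → ∀ n → int q n ≈ int q′ n
  int-cong e zero    = refl
  int-cong e (suc n) = +-congˡ (*-cong e (int-cong e n))

  int-1 : ∀ q → int q 1 ≈ 1#
  int-1 = solve 1 (λ q → con 1 :+ q :* con 0 := con 1) refl

  int-+ : ∀ q m n → int q (m ℕ.+ n) ≈ int q m + q ^ m * int q n
  int-+ q zero    n = solve 1 (λ a → a := con 0 :+ con 1 :* a) refl (int q n)
  int-+ q (suc m) n = begin
    1# + q * int q (m ℕ.+ n)
      ≈⟨ +-congˡ (*-congˡ (int-+ q m n)) ⟩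
    1# + q * (int q m + q ^ m * int q n)
      ≈⟨ solve 4 (λ q a e b → con 1 :+ q :* (a :+ e :* b) := con 1 :+ q :* a :+ q :* e :* b)
           refl q (int q m) (q ^ m) (int q n) ⟩
    1# + q * int q m + q * q ^ m * int q n ∎

  int-suc : ∀ q n → int q n + q ^ n ≈ int q (suc n)
  int-suc q n = begin
    int q n + q ^ n             ≈⟨ +-congˡ (trans (*-congˡ (int-1 q)) (*-identityʳ _)) ⟨
    int q n + q ^ n * int q 1   ≈⟨ int-+ q n 1 ⟨
    int q (n ℕ.+ 1)             ≡⟨ ≡.cong (int q) (ℕ.+-comm n 1) ⟩
    int q (suc n)               ∎

  int-telescope : ∀ q n → (q - 1#) * int q n ≈ q ^ n - 1#
  int-telescope q n = begin
    (q - 1#) * I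
      ≈⟨ [y-z]x≈yx-zx I q 1# ⟩
    q * I - 1# * I
      ≈⟨ +-congˡ (-‿cong (*-identityˡ I)) ⟩
    q * I - I
      ≈⟨ +-identityʳ _ ⟨
    q * I - I + 0#
      ≈⟨ +-congˡ (-‿inverseʳ 1#) ⟨
    q * I - I + (1# - 1#)
      -- The solver knows semiring laws only, so negated terms enter as independent variables.
      ≈⟨ solve 4 (λ qI -I 1′ -1′ → qI :+ -I :+ (1′ :+ -1′) := 1′ :+ qI :+ (-I :+ -1′)) refl (q * I) (- I) 1# (- 1#) ⟩
    1# + q * I + (- I - 1#)
      ≈⟨ +-congʳ (int-suc q n) ⟨
    I + q ^ n + (- I - 1#)
      ≈⟨ solve 4 (λ I qⁿ -I -1′ → I :+ qⁿ :+ (-I :+ -1′) := I :+ -I :+ (qⁿ :+ -1′)) refl I (q ^ n) (- I) (- 1#) ⟩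
    I - I + (q ^ n - 1#)
      ≈⟨ trans (+-congʳ (-‿inverseʳ I)) (+-identityˡ _) ⟩
    q ^ n - 1# ∎
    where
    I = int q n
    open RingProperties ring using ([y-z]x≈yx-zx)

  int-telescope′ : ∀ q n → int q n * (1# - q) ≈ 1# - q ^ n
  int-telescope′ q n = begin
    I * (1# - q)          ≈⟨ x[y-z]≈xy-xz I 1# q ⟩
    I * 1# - I * q        ≈⟨ +-cong (*-identityʳ I) (-‿cong (*-comm I q)) ⟩
    I - q * I             ≈⟨ ⁻¹-anti-homo-// (q * I) I ⟨
    - (q * I - I)         ≈⟨ -‿cong (+-congˡ (-‿cong (*-identityˡ I))) ⟨
    - (q * I - 1# * I)    ≈⟨ -‿cong ([y-z]x≈yx-zx I q 1#) ⟨
    - ((q - 1#) * I)      ≈⟨ -‿cong (int-telescope q n) ⟩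
    - (q ^ n - 1#)        ≈⟨ ⁻¹-anti-homo-// (q ^ n) 1# ⟩
    1# - q ^ n            ∎
    where
    I = int q n
    open RingProperties ring using (x[y-z]≈xy-xz; [y-z]x≈yx-zx; ⁻¹-anti-homo-//)

  -- [n] + q^n = 1 + q [n]; after multiplication by b both terms with [n] vanish.
  int-fixed : ∀ q n {b} → int q n * b ≈ 0# → q ^ n * b ≈ b
  int-fixed q n {b} e = begin
    q ^ n * b                      ≈⟨ +-identityˡ _ ⟨
    0# + q ^ n * b                 ≈⟨ +-congʳ e ⟨
    int q n * b + q ^ n * b        ≈⟨ distribʳ b _ _ ⟨
    (int q n + q ^ n) * b          ≈⟨ *-congʳ (int-suc q n) ⟩
    (1# + q * int q n) * b         ≈⟨ solve 3 (λ q i b → (con 1 :+ q :* i) :* b := b :+ q :* (i :* b)) refl q _ b ⟩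
    b + q * (int q n * b)          ≈⟨ +-congˡ (trans (*-congˡ e) (zeroʳ q)) ⟩
    b + 0#                         ≈⟨ +-identityʳ b ⟩
    b                              ∎

  -- Where a acts as 1, the geometric sum 1 + a + ... + a^(n-1) acts as the integer n. This turns
  -- vanishing geometric sums into integer torsion.
  geometric-fixed : ∀ {a b} → a * b ≈ b → ∀ n → int a n * b ≈ n × b
  geometric-fixed         e zero    = zeroˡ _
  geometric-fixed {a} {b} e (suc n) = begin
    (1# + a * int a n) * b      ≈⟨ solve 3 (λ a i b → (con 1 :+ a :* i) :* b := b :+ i :* (a :* b))
                                     refl a (int a n) b ⟩
    b + int a n * (a * b)       ≈⟨ +-congˡ (*-congˡ e) ⟩
    b + int a n * b             ≈⟨ +-congˡ (geometric-fixed e n) ⟩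
    b + n × b                   ∎

  gauss-> : ∀ q {n k} → n ℕ.< k → gauss q n k ≈ 0#
  gauss-> q {zero}  {suc k} n<k       = refl
  gauss-> q {suc n} {suc k} (s<s n<k) = begin
    gauss q n k + q ^ suc k * gauss q n (suc k)
      ≈⟨ +-cong (gauss-> q n<k) (*-congˡ (gauss-> q (ℕ.m<n⇒m<1+n n<k))) ⟩
    0# + q ^ suc k * 0#   ≈⟨ +-identityˡ _ ⟩
    q ^ suc k * 0#        ≈⟨ zeroʳ _ ⟩
    0#                    ∎

  gauss-diagonal : ∀ q n → gauss q n n ≈ 1#
  gauss-diagonal q zero    = refl
  gauss-diagonal q (suc n) = trans
    (+-cong (gauss-diagonal q n) (trans (*-congˡ (gauss-> q (ℕ.n<1+n n))) (zeroʳ _)))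
    (+-identityʳ 1#)

  private
    -- By Pascal's rule and [k+1] + q^(k+1) [n-k] = [n+1]. The premise is `gauss-absorb` at the same
    -- n; it is an argument so that the recursion of `gauss-absorb` can pass through this step.
    absorb-step : ∀ q n k → int q (suc k) * gauss q n (suc k) ≈ int q (n ℕ.∸ k) * gauss q n k →
      int q (suc k) * gauss q (suc n) (suc k) ≈ int q (suc n) * gauss q n k
    absorb-step q n k IH with k ℕ.≤? n
    ... | no k≰n = trans (trans (*-congˡ (gauss-> q (s<s n<k))) (zeroʳ _))
                         (sym (trans (*-congˡ (gauss-> q n<k)) (zeroʳ _)))
      where n<k = ℕ.≰⇒> k≰n
    ... | yes k≤n = begin
      i * (g + e * g′)
        ≈⟨ solve 4 (λ i g e g′ → i :* (g :+ e :* g′) := i :* g :+ e :* (i :* g′)) refl i g e g′ ⟩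
      i * g + e * (i * g′)
        ≈⟨ +-congˡ (*-congˡ IH) ⟩
      i * g + e * (int q (n ℕ.∸ k) * g)
        ≈⟨ solve 4 (λ i g e j → i :* g :+ e :* (j :* g) := (i :+ e :* j) :* g)
             refl i g e (int q (n ℕ.∸ k)) ⟩
      (i + e * int q (n ℕ.∸ k)) * g
        ≈⟨ *-congʳ (int-+ q (suc k) (n ℕ.∸ k)) ⟨
      int q (suc k ℕ.+ (n ℕ.∸ k)) * g
        ≡⟨ ≡.cong (λ n → int q (suc n) * g) (ℕ.m+[n∸m]≡n k≤n) ⟩
      int q (suc n) * g ∎
      where
      i = int q (suc k)
      g = gauss q n k
      g′ = gauss q n (suc k)
      e = q ^ suc k

  -- The truncation in `n ∸ k` is harmless: for k ≥ n that factor is [0] = 0, and the Gaussian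
  -- binomial on the left vanishes too.
  gauss-absorb : ∀ q n k → int q (suc k) * gauss q n (suc k) ≈ int q (n ℕ.∸ k) * gauss q n k
  gauss-absorb q zero    k       = trans (zeroʳ _)
    (sym (trans (*-congʳ (reflexive (≡.cong (int q) (ℕ.0∸n≡0 k)))) (zeroˡ _)))
  gauss-absorb q (suc n) zero    = absorb-step q n 0 (gauss-absorb q n 0)
  gauss-absorb q (suc n) (suc k) with k ℕ.≤? n
  ... | no k≰n = trans (trans (*-congˡ (gauss-> q (s<s (ℕ.m<n⇒m<1+n n<k)))) (zeroʳ _))
                       (sym (trans (*-congˡ (gauss-> q (s<s n<k))) (zeroʳ _)))
    where n<k = ℕ.≰⇒> k≰n
  ... | yes k≤n = begin
    int q (suc (suc k)) * gauss q (suc n) (suc (suc k))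
      ≈⟨ absorb-step q n (suc k) (gauss-absorb q n (suc k)) ⟩
    int q (suc n) * g′
      ≡⟨ ≡.cong (λ n → int q (suc n) * g′) (ℕ.m+[n∸m]≡n k≤n) ⟨
    int q (suc k ℕ.+ (n ℕ.∸ k)) * g′
      ≈⟨ *-congʳ (int-+ q (suc k) (n ℕ.∸ k)) ⟩
    (i + e * j) * g′
      ≈⟨ solve 4 (λ i e j g′ → (i :+ e :* j) :* g′ := i :* g′ :+ j :* (e :* g′)) refl i e j g′ ⟩
    i * g′ + j * (e * g′)
      ≈⟨ +-congʳ (gauss-absorb q n k) ⟩
    j * gauss q n k + j * (e * g′)
      ≈⟨ distribˡ j (gauss q n k) (e * g′) ⟨
    j * (gauss q n k + e * g′) ∎
    where
    i = int q (suc k)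
    j = int q (n ℕ.∸ k)
    e = q ^ suc k
    g′ = gauss q n (suc k)

  gauss-absorb-suc : ∀ q n k → int q (suc k) * gauss q (suc n) (suc k) ≈ int q (suc n) * gauss q n k
  gauss-absorb-suc q n k = absorb-step q n k (gauss-absorb q n k)

  -- The bracketed difference in the definition of w_k, at j = i + 1.
  narayana : Carrier → ℕ → ℕ → Carrier
  narayana q k i = gauss q (k ℕ.∸ 1) i * gauss q (k ℕ.+ suc i) (suc i)
                 - gauss q k (suc i) * gauss q (k ℕ.+ suc i) i

  -- With j = i + 1 and n = k + 1, absorption gives [j][n+j,j] = [n+1][n+j,j-1] and [j][n,j] =
  -- [n][n-1,j-1]. The difference therefore has the factor [n+1] - [n] = q^n.
  int-*-narayana : ∀ q k i → int q (suc i) * narayana q (suc k) i ≈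
    q ^ suc k * (gauss q k i * gauss q (suc k ℕ.+ suc i) i)
  int-*-narayana q k i = begin
    I * (g * A - B * h)                          ≈⟨ x[y-z]≈xy-xz I (g * A) (B * h) ⟩
    I * (g * A) - I * (B * h)                    ≈⟨ +-cong e₁ (-‿cong e₂) ⟩
    (K * (g * h) + E * (g * h)) - K * (g * h)    ≈⟨ +-congʳ (+-comm (K * (g * h)) (E * (g * h))) ⟩
    (E * (g * h) + K * (g * h)) - K * (g * h)    ≈⟨ +-assoc (E * (g * h)) (K * (g * h)) _ ⟩
    E * (g * h) + (K * (g * h) - K * (g * h))    ≈⟨ +-congˡ (-‿inverseʳ (K * (g * h))) ⟩
    E * (g * h) + 0#                             ≈⟨ +-identityʳ _ ⟩
    E * (g * h)                                  ∎
    where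
    open RingProperties ring using (x[y-z]≈xy-xz)
    I = int q (suc i)
    K = int q (suc k)
    E = q ^ suc k
    g = gauss q k i
    A = gauss q (suc k ℕ.+ suc i) (suc i)
    B = gauss q (suc k) (suc i)
    h = gauss q (suc k ℕ.+ suc i) i

    e₁ : I * (g * A) ≈ K * (g * h) + E * (g * h)
    e₁ = begin
      I * (g * A)         ≈⟨ solve 3 (λ I g A → I :* (g :* A) := g :* (I :* A)) refl I g A ⟩
      g * (I * A)         ≈⟨ *-congˡ (gauss-absorb q (suc k ℕ.+ suc i) i) ⟩
      g * (int q (suc k ℕ.+ suc i ℕ.∸ i) * h)
        ≡⟨ ≡.cong (λ n → g * (int q n * h)) (≡.trans (≡.cong (ℕ._∸ i) (ℕ.+-suc (suc k) i)) (ℕ.m+n∸n≡m (suc (suc k)) i)) ⟩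
      g * (int q (suc (suc k)) * h)  ≈⟨ *-congˡ (*-congʳ (int-suc q (suc k))) ⟨
      g * ((K + E) * h)   ≈⟨ solve 4 (λ K E g h → g :* ((K :+ E) :* h) := K :* (g :* h) :+ E :* (g :* h))
                               refl K E g h ⟩
      K * (g * h) + E * (g * h) ∎

    e₂ : I * (B * h) ≈ K * (g * h)
    e₂ = trans (sym (*-assoc I B h)) (trans (*-congʳ (gauss-absorb-suc q k i)) (*-assoc K g h))

  -- The product formula without division; it identifies the recursive `gauss` with the quotient
  -- that defines `qbinomial`. For k > n both sides are zero, the right one through its factor [0].
  gauss-* : ∀ q n k → gauss q n k * prod k (λ j → int q (suc j)) ≈ prod k (λ j → int q (n ℕ.∸ j))
  gauss-* q n zero    = *-identityˡ 1#
  gauss-* q n (suc k) = begin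
    gauss q n (suc k) * prod (suc k) (λ j → int q (suc j))
      ≈⟨ *-congˡ (prod-suc k (λ j → int q (suc j))) ⟩
    gauss q n (suc k) * (P * int q (suc k))
      ≈⟨ solve 3 (λ g P i → g :* (P :* i) := P :* (i :* g)) refl _ P _ ⟩
    P * (int q (suc k) * gauss q n (suc k))
      ≈⟨ *-congˡ (gauss-absorb q n k) ⟩
    P * (int q (n ℕ.∸ k) * gauss q n k)
      ≈⟨ solve 3 (λ P i g → P :* (i :* g) := g :* P :* i) refl P _ _ ⟩
    gauss q n k * P * int q (n ℕ.∸ k)
      ≈⟨ *-congʳ (gauss-* q n k) ⟩
    prod k (λ j → int q (n ℕ.∸ j)) * int q (n ℕ.∸ k)
      ≈⟨ prod-suc k (λ j → int q (n ℕ.∸ j)) ⟨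
    prod (suc k) (λ j → int q (n ℕ.∸ j)) ∎
    where

    P = prod k (λ j → int q (suc j))

-- Ring homomorphisms and their effect on q-analogues

-- Zero and negatives need no separate check: h 0 + h 0 = h 0 forces h 0 = 0, and additive inverses
-- are unique.
ringHomomorphism : ∀ {a ℓ₁ b ℓ₂} (R : CommutativeRing a ℓ₁) (S : CommutativeRing b ℓ₂)
  (let module R = CommutativeRing R; module S = CommutativeRing S) (h : R.Carrier → S.Carrier) →
  (∀ {x y} → x R.≈ y → h x S.≈ h y) →
  (∀ x y → h (x R.+ y) S.≈ h x S.+ h y) →
  (∀ x y → h (x R.* y) S.≈ h x S.* h y) →
  h R.1# S.≈ S.1# →
  IsRingHomomorphism R.rawRing S.rawRing h
ringHomomorphism R S h h-cong h-+ h-* h-1 = record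
  { isSemiringHomomorphism = record
    { isNearSemiringHomomorphism = record
      { +-isMonoidHomomorphism = record
        { isMagmaHomomorphism = record
          { isRelHomomorphism = record { cong = h-cong }
          ; homo = h-+ }
        ; ε-homo = h-0 }
      ; *-homo = h-* }
    ; 1#-homo = h-1 }
  ; -‿homo = λ x → +-inverseˡ-unique _ _
      (S.trans (S.sym (h-+ _ x)) (S.trans (h-cong (R.-‿inverseˡ x)) h-0)) }
  where
  module R = CommutativeRing R
  module S = CommutativeRing S
  open RingProperties S.ring using (x+x≈x⇒x≈0; +-inverseˡ-unique)
  h-0 : h R.0# S.≈ S.0#
  h-0 = x+x≈x⇒x≈0 _ (S.trans (S.sym (h-+ R.0# R.0#)) (h-cong (R.+-identityˡ R.0#)))

module RingMorphism {a ℓ₁ b ℓ₂ : Level} (R : CommutativeRing a ℓ₁) (S : CommutativeRing b ℓ₂)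
  (h : CommutativeRing.Carrier R → CommutativeRing.Carrier S)
  (h-hom : IsRingHomomorphism (CommutativeRing.rawRing R) (CommutativeRing.rawRing S) h) where

  private
    module R where
      open RingNotation R public
      open QAnalogues R public
      open Mult semiring public using (_×_)
    module S where
      open RingNotation S public
      open QAnalogues S public
      open Mult semiring public using (_×_)
    open IsRingHomomorphism h-hom renaming (⟦⟧-cong to h-cong)

  ^-homo : ∀ {x y} → h x S.≈ y → ∀ n → h (x R.^ n) S.≈ y S.^ n
  ^-homo e zero    = 1#-homo
  ^-homo e (suc n) = S.trans (*-homo _ _) (S.*-cong e (^-homo e n))

  ×-homo : ∀ n x → h (n R.× x) S.≈ n S.× h x
  ×-homo zero    x = 0#-homo
  ×-homo (suc n) x = S.trans (+-homo _ _) (S.+-congˡ (×-homo n x))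

  int-homo : ∀ {q q′} → h q S.≈ q′ → ∀ n → h (R.int q n) S.≈ S.int q′ n
  int-homo e zero    = 0#-homo
  int-homo e (suc n) = S.trans (+-homo _ _)
    (S.+-cong 1#-homo (S.trans (*-homo _ _) (S.*-cong e (int-homo e n))))

  gauss-homo : ∀ {q q′} → h q S.≈ q′ → ∀ n k → h (R.gauss q n k) S.≈ S.gauss q′ n k
  gauss-homo e n       zero    = 1#-homo
  gauss-homo e zero    (suc k) = 0#-homo
  gauss-homo e (suc n) (suc k) = S.trans (+-homo _ _) (S.+-cong (gauss-homo e n k)
    (S.trans (*-homo _ _) (S.*-cong (^-homo e (suc k)) (gauss-homo e n (suc k)))))

  narayana-homo : ∀ {q q′} → h q S.≈ q′ → ∀ k i → h (R.narayana q k i) S.≈ S.narayana q′ k i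
  narayana-homo e k i = S.trans (+-homo _ _) (S.+-cong
    (S.trans (*-homo _ _) (S.*-cong (gauss-homo e (k ℕ.∸ 1) i) (gauss-homo e (k ℕ.+ suc i) (suc i))))
    (S.trans (-‿homo _) (S.-‿cong (S.trans (*-homo _ _) (S.*-cong (gauss-homo e k (suc i)) (gauss-homo e (k ℕ.+ suc i) i))))))

  sum-homo : ∀ n {f g} → (∀ i → h (f i) S.≈ g i) → h (R.sum-syntax n f) S.≈ S.sum-syntax n g
  sum-homo zero    e = 0#-homo
  sum-homo (suc n) e = S.trans (+-homo _ _) (S.+-cong (e Fin.zero) (sum-homo n (e ∘ Fin.suc)))

-- Quotient rings and primitive roots of unity in them

module Quotient {c ℓ : Level} (R : CommutativeRing c ℓ) (f : CommutativeRing.Carrier R) where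

  open RingNotation R hiding (zero)
  open RingProperties ring using (-‿distribˡ-*; -‿+-comm)
  open Mult semiring using (_×_)
  open NatSolver commutativeSemiring using (solve; _:=_; _:+_; _:*_; con)
  open SetoidReasoning setoid

  infix 4 _≈/_

  -- The carrier stays that of R and only equality is weakened, so the projection is the identity
  -- function. Keeping the multiplier as data lets a ring homomorphism carry a congruence over.
  record _≈/_ (a b : Carrier) : Set (c ⊔ ℓ) where
    constructor mk≈/
    field
      multiplier : Carrier
      equation   : a ≈ b + multiplier * f

  ≈⇒≈/ : ∀ {a b} → a ≈ b → a ≈/ b
  ≈⇒≈/ {a} {b} a≈b = mk≈/ 0# (trans a≈b (solve 2 (λ b f → b := b :+ con 0 :* f) refl b f))

  ∣⇒≈/0 : ∀ {a} → f ∣ a → a ≈/ 0#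
  ∣⇒≈/0 (k , kf≈a) = mk≈/ k (trans (sym kf≈a) (sym (+-identityˡ _)))

  ≈/0⇒∣ : ∀ {a} → a ≈/ 0# → f ∣ a
  ≈/0⇒∣ (mk≈/ k a≈) = k , trans (sym (+-identityˡ _)) (sym a≈)

  ≈/-sym : ∀ {a b} → a ≈/ b → b ≈/ a
  ≈/-sym {a} {b} (mk≈/ k a≈) = mk≈/ (- k) (begin
    b                          ≈⟨ +-identityʳ b ⟨
    b + 0#                     ≈⟨ +-congˡ (-‿inverseʳ (k * f)) ⟨
    b + (k * f - k * f)        ≈⟨ +-assoc b _ _ ⟨
    (b + k * f) - k * f        ≈⟨ +-cong a≈ (sym (-‿distribˡ-* k f)) ⟨
    a + (- k) * f              ∎)

  ≈/-trans : ∀ {a b c} → a ≈/ b → b ≈/ c → a ≈/ c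
  ≈/-trans {c = x} (mk≈/ k a≈) (mk≈/ l b≈) = mk≈/ (l + k)
    (trans a≈ (trans (+-congʳ b≈) (solve 4 (λ x k l f → x :+ l :* f :+ k :* f := x :+ (l :+ k) :* f) refl x k l f)))

  +-cong/ : ∀ {a b x y} → a ≈/ b → x ≈/ y → a + x ≈/ b + y
  +-cong/ {b = b} {y = y} (mk≈/ k a≈) (mk≈/ l x≈) = mk≈/ (k + l) (trans (+-cong a≈ x≈)
    (solve 5 (λ b y k l f → b :+ k :* f :+ (y :+ l :* f) := b :+ y :+ (k :+ l) :* f) refl b y k l f))

  *-cong/ : ∀ {a b x y} → a ≈/ b → x ≈/ y → a * x ≈/ b * y
  *-cong/ {b = b} {y = y} (mk≈/ k a≈) (mk≈/ l x≈) = mk≈/ (b * l + k * y + k * l * f) (trans (*-cong a≈ x≈)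
    (solve 5 (λ b y k l f → (b :+ k :* f) :* (y :+ l :* f) :=
                b :* y :+ (b :* l :+ k :* y :+ k :* l :* f) :* f) refl b y k l f))

  -‿cong/ : ∀ {a b} → a ≈/ b → - a ≈/ - b
  -‿cong/ {a} {b} (mk≈/ k a≈) = mk≈/ (- k) (begin
    - a                  ≈⟨ -‿cong a≈ ⟩
    - (b + k * f)        ≈⟨ -‿+-comm b (k * f) ⟨
    - b + - (k * f)      ≈⟨ +-congˡ (-‿distribˡ-* k f) ⟩
    - b + (- k) * f      ∎)

  commutativeRing/ : CommutativeRing c (c ⊔ ℓ)
  commutativeRing/ = record
    { Carrier = Carrier ; _≈_ = _≈/_ ; _+_ = _+_ ; _*_ = _*_ ; -_ = -_ ; 0# = 0# ; 1# = 1#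
    ; isCommutativeRing = record
      { isRing = record
        { +-isAbelianGroup = record
          { isGroup = record
            { isMonoid = record
              { isSemigroup = record
                { isMagma = record
                  { isEquivalence = record { refl = ≈⇒≈/ refl ; sym = ≈/-sym ; trans = ≈/-trans }
                  ; ∙-cong = +-cong/ }
                ; assoc = λ x y z → ≈⇒≈/ (+-assoc x y z) }
              ; identity = (λ x → ≈⇒≈/ (+-identityˡ x)) , (λ x → ≈⇒≈/ (+-identityʳ x)) }
            ; inverse = (λ x → ≈⇒≈/ (-‿inverseˡ x)) , (λ x → ≈⇒≈/ (-‿inverseʳ x))
            ; ⁻¹-cong = -‿cong/ }
          ; comm = λ x y → ≈⇒≈/ (+-comm x y) }
        ; *-cong = *-cong/
        ; *-assoc = λ x y z → ≈⇒≈/ (*-assoc x y z)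
        ; *-identity = (λ x → ≈⇒≈/ (*-identityˡ x)) , (λ x → ≈⇒≈/ (*-identityʳ x))
        ; distrib = (λ x y z → ≈⇒≈/ (distribˡ x y z)) , (λ x y z → ≈⇒≈/ (distribʳ x y z)) }
      ; *-comm = λ x y → ≈⇒≈/ (*-comm x y) } }

  projection : IsRingHomomorphism rawRing (CommutativeRing.rawRing commutativeRing/) (λ a → a)
  projection = ringHomomorphism R commutativeRing/ (λ a → a) ≈⇒≈/
    (λ x y → ≈⇒≈/ refl) (λ x y → ≈⇒≈/ refl) (≈⇒≈/ refl)

  -- The absence of integer torsion in `R / f`, phrased as divisibility in R. It serves to halve the
  -- block sums and to cancel the integer c in the coprimality argument.
  TorsionFree : Set (c ⊔ ℓ)
  TorsionFree = ∀ n {b} → f ∣ suc n × b → f ∣ b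

  module Projection = RingMorphism R commutativeRing/ (λ a → a) projection

infixl 7 _/_

_/_ : ∀ {c ℓ} (R : CommutativeRing c ℓ) → CommutativeRing.Carrier R → CommutativeRing c (c ⊔ ℓ)
_/_ = Quotient.commutativeRing/

-- In a field of characteristic zero, t satisfies these conditions iff it is a primitive d-th root
-- of unity: the sums in geometric are (1 - t ^ d) / (1 - t ^ g).
record IsPrimitiveRoot {c ℓ : Level} (K : CommutativeRing c ℓ) (t : CommutativeRing.Carrier K) (d : ℕ) : Set (c ⊔ ℓ) where
  open RingNotation K hiding (zero)
  open Mult semiring using (_×_)
  open QAnalogues K
  field
    power        : t ^ d ≈ 1#
    geometric    : ∀ c g → 1 ℕ.< c → d ≡ c ℕ.* g → int (t ^ g) c ≈ 0#
    torsion-free : ∀ n {b} → suc n × b ≈ 0# → b ≈ 0#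

module PrimitiveRoot {c ℓ : Level} {K : CommutativeRing c ℓ} {t : CommutativeRing.Carrier K} {d : ℕ}
  (prim : IsPrimitiveRoot K t d) where

  open RingNotation K hiding (zero)
  open QAnalogues K
  open IsPrimitiveRoot prim
  open Mult semiring using (_×_)
  open SetoidReasoning setoid

  fixed-multiple : ∀ x j {b} → t ^ j * b ≈ b → t ^ (x ℕ.* j) * b ≈ b
  fixed-multiple x j e = trans (*-congʳ (trans (^-congʳ t (ℕ.*-comm x j)) (sym (^-assocʳ t j x)))) (^-fixed e x)

  -- Bézout over the natural numbers puts the negative multiple on the other side, as g + y k = x j
  -- or g + x j = y k. Hence no inverse of t is required.
  fixed-gcd : ∀ j k {b} → t ^ j * b ≈ b → t ^ k * b ≈ b → t ^ ℕ.gcd j k * b ≈ b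
  fixed-gcd j k {b} eⱼ eₖ with ℕ.Bézout.identity (ℕ.gcd-GCD j k)
  ... | ℕ.Bézout.+- x y eq = begin
    t ^ g * b                        ≈⟨ *-congˡ (fixed-multiple y k eₖ) ⟨
    t ^ g * (t ^ (y ℕ.* k) * b)      ≈⟨ *-assoc _ _ b ⟨
    t ^ g * t ^ (y ℕ.* k) * b        ≈⟨ *-congʳ (^-homo-* t g (y ℕ.* k)) ⟨
    t ^ (g ℕ.+ y ℕ.* k) * b          ≡⟨ ≡.cong (λ n → t ^ n * b) eq ⟩
    t ^ (x ℕ.* j) * b                ≈⟨ fixed-multiple x j eⱼ ⟩
    b                                ∎
    where
    g = ℕ.gcd j k
  ... | ℕ.Bézout.-+ x y eq = begin
    t ^ g * b                        ≈⟨ *-congˡ (fixed-multiple x j eⱼ) ⟨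
    t ^ g * (t ^ (x ℕ.* j) * b)      ≈⟨ *-assoc _ _ b ⟨
    t ^ g * t ^ (x ℕ.* j) * b        ≈⟨ *-congʳ (^-homo-* t g (x ℕ.* j)) ⟨
    t ^ (g ℕ.+ x ℕ.* j) * b          ≡⟨ ≡.cong (λ n → t ^ n * b) eq ⟩
    t ^ (y ℕ.* k) * b                ≈⟨ fixed-multiple y k eₖ ⟩
    b                                ∎
    where
    g = ℕ.gcd j k

  -- Let g = gcd(j,d) and d = c g. If c = 1, then d divides j. Otherwise t^g fixes b, so the sum of
  -- the t^(ig) over i < c acts on b as c; it is zero by `geometric`, and c is cancelled.
  regular : .{{NonZero d}} → ∀ {j b} → ¬ (d ℕ.∣ j) → t ^ j * b ≈ b → b ≈ 0#
  regular {j} {b} d∤j e with ℕ.gcd[m,n]∣n j d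
  ... | ℕ.divides zero d≡0 = contradiction d≡0 (ℕ.≢-nonZero⁻¹ d)
  ... | ℕ.divides 1 d≡g = contradiction
    (≡.subst (ℕ._∣ j) (≡.sym (≡.trans d≡g (ℕ.*-identityˡ _))) (ℕ.gcd[m,n]∣m j d)) d∤j
  ... | ℕ.divides c@(suc c-1@(suc _)) d≡cg = torsion-free c-1 (begin
    c × b                       ≈⟨ geometric-fixed (fixed-gcd j d e (trans (*-congʳ power) (*-identityˡ b))) c ⟨
    int (t ^ ℕ.gcd j d) c * b    ≈⟨ *-congʳ (geometric c (ℕ.gcd j d) (s<s z<s) d≡cg) ⟩
    0# * b                       ≈⟨ zeroˡ b ⟩
    0#                           ∎)

-- Coprimality of factors and their products

-- Since g b vanishes modulo f, every congruence modulo g may be applied in front of b (`modulo-g`).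
-- If d does not divide e, then t^e fixes b and `regular` applies. If d divides e, the quotient d /
-- gcd(d,e) is 1 and the roles change: with c = e/d > 1, the geometric sum of t^d vanishes modulo g
-- and acts as c modulo f.
coprime : ∀ {c ℓ} {R : CommutativeRing c ℓ} (let open RingNotation R hiding (zero)) {t f g d e} →
  .{{NonZero d}} → .{{NonZero e}} → IsPrimitiveRoot (R / f) t d → IsPrimitiveRoot (R / g) t e →
  d ≢ e → ∀ {b} → f ∣ g * b → f ∣ b
coprime {R = R} {t} {f} {g} {d} {e} f-root g-root d≢e {b} f∣gb = ≈/0⇒∣ b≈0
  where
  open Quotient R f
  open RingNotation (R / f) hiding (zero)
  open QAnalogues (R / f)
  open PrimitiveRoot f-root
  open IsPrimitiveRoot f-root
  module G = IsPrimitiveRoot g-root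
  module R where
    open RingNotation R public
    open QAnalogues R public
  module QG = Quotient R g
  module πᵍ = QG.Projection
  module S = CommutativeRing (R / g)
  open Mult semiring using (_×_)
  open NatSolver commutativeSemiring using (solve; _:=_; _:+_; _:*_)
  open SetoidReasoning setoid

  gb≈0 : g * b ≈ 0#
  gb≈0 = ∣⇒≈/0 f∣gb

  modulo-g : ∀ {x y} → x QG.≈/ y → x * b ≈ y * b
  modulo-g {x} {y} (QG.mk≈/ k x≈) = begin
    x * b                ≈⟨ *-congʳ (≈⇒≈/ x≈) ⟩
    (y + k * g) * b      ≈⟨ solve 4 (λ y k g b → (y :+ k :* g) :* b := y :* b :+ k :* (g :* b)) refl y k g b ⟩
    y * b + k * (g * b)  ≈⟨ +-congˡ (trans (*-congˡ gb≈0) (zeroʳ k)) ⟩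
    y * b + 0#           ≈⟨ +-identityʳ _ ⟩
    y * b                ∎

  power-e : t ^ e * b ≈ b
  power-e = begin
    t ^ e * b        ≈⟨ *-congʳ (Projection.^-homo refl e) ⟨
    (t R.^ e) * b    ≈⟨ modulo-g (S.trans (πᵍ.^-homo S.refl e) G.power) ⟩
    1# * b           ≈⟨ *-identityˡ b ⟩
    b                ∎

  geometric-e : ∀ c → 1 ℕ.< c → e ≡ c ℕ.* d → int (t ^ d) c * b ≈ 0#
  geometric-e c 1<c e≡cd = begin
    int (t ^ d) c * b        ≈⟨ *-congʳ (Projection.int-homo (Projection.^-homo refl d) c) ⟨
    R.int (t R.^ d) c * b    ≈⟨ modulo-g (S.trans (πᵍ.int-homo (πᵍ.^-homo S.refl d) c) (G.geometric c d 1<c e≡cd)) ⟩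
    0# * b                   ≈⟨ zeroˡ b ⟩
    0#                       ∎

  b≈0 : b ≈ 0#
  b≈0 with d ℕ.∣? e
  ... | no d∤e = regular d∤e power-e
  ... | yes (ℕ.divides zero e≡0) = contradiction e≡0 (ℕ.≢-nonZero⁻¹ e)
  ... | yes (ℕ.divides 1 e≡d) = contradiction (≡.sym (≡.trans e≡d (ℕ.*-identityˡ d))) d≢e
  ... | yes (ℕ.divides c@(suc c-1@(suc _)) e≡cd) = torsion-free c-1 (begin
    c × b               ≈⟨ geometric-fixed (trans (*-congʳ power) (*-identityˡ b)) c ⟨
    int (t ^ d) c * b    ≈⟨ geometric-e c (s<s z<s) e≡cd ⟩
    0#                   ∎)

module ModuloFactor {c ℓ : Level} (R : CommutativeRing c ℓ) (t f : CommutativeRing.Carrier R) where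

  open RingNotation R hiding (zero)
  open QAnalogues R using (int)
  open Quotient R f
  private module K = RingNotation (R / f)

  torsion-free/ : TorsionFree → ∀ n {b} → (let open Mult K.semiring using (_×_) in suc n × b ≈/ 0#) → b ≈/ 0#
  torsion-free/ tf n {b} e = ∣⇒≈/0 (tf n (≈/0⇒∣ (K.trans (Projection.×-homo (suc n) b) e)))

  toPrimitiveRoot : ∀ d → f ∣ t ^ d - 1# → (∀ c g → 1 ℕ.< c → d ≡ c ℕ.* g → f ∣ int (t ^ g) c) →
    TorsionFree → IsPrimitiveRoot (R / f) t d
  toPrimitiveRoot d f∣t^d-1 f∣int tf = record
    { power        = K.trans (K.sym (Projection.^-homo K.refl d)) (x∙y⁻¹≈ε⇒x≈y _ _ (∣⇒≈/0 f∣t^d-1))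
    ; geometric    = λ c g 1<c d≡cg → K.trans (K.sym (Projection.int-homo (Projection.^-homo K.refl g) c)) (∣⇒≈/0 (f∣int c g 1<c d≡cg))
    ; torsion-free = torsion-free/ tf }
    where open RingProperties K.ring using (x∙y⁻¹≈ε⇒x≈y)

  root-∣ : ∀ {d e} → IsPrimitiveRoot (R / f) t d → d ℕ.∣ e → f ∣ t ^ e - 1#
  root-∣ {d} {e} prim (ℕ.divides c e≡cd) = ≈/0⇒∣ (K.trans (K.+-congʳ (K.trans (Projection.^-homo K.refl e) t^e≈1))
    (K.-‿inverseʳ 1#))
    where
    open QAnalogues (R / f) using (^-congʳ; ^≈1)
    t^e≈1 : t K.^ e K.≈ K.1#
    t^e≈1 = K.trans (^-congʳ t (≡.trans e≡cd (ℕ.*-comm c d))) (^≈1 d (IsPrimitiveRoot.power prim) c)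

  -- Write D = k (t^g - 1). Then f k (t^g - 1) = t^d - 1 = (t^g - 1) int(t^g, c), and t^g - 1
  -- cancels.
  geometric-∣ : ∀ {d c g D} → f * D ≈ t ^ d - 1# → d ≡ c ℕ.* g → t ^ g - 1# ∣ D →
    (∀ {a b} → a * (t ^ g - 1#) ≈ b * (t ^ g - 1#) → a ≈ b) → f ∣ int (t ^ g) c
  geometric-∣ {d} {c} {g} {D} fD d≡cg (k , eq) cancel = k , cancel (begin
    k * f * (t ^ g - 1#)         ≈⟨ *-congʳ (*-comm k f) ⟩
    f * k * (t ^ g - 1#)         ≈⟨ *-assoc f k _ ⟩
    f * (k * (t ^ g - 1#))       ≈⟨ *-congˡ eq ⟩
    f * D                        ≈⟨ fD ⟩
    t ^ d - 1#                   ≡⟨ ≡.cong (λ n → t ^ n - 1#) (≡.trans d≡cg (ℕ.*-comm c g)) ⟩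
    t ^ (g ℕ.* c) - 1#           ≈⟨ +-congʳ (^-assocʳ t g c) ⟨
    (t ^ g) ^ c - 1#             ≈⟨ int-telescope (t ^ g) c ⟨
    (t ^ g - 1#) * int (t ^ g) c ≈⟨ *-comm _ _ ⟩
    int (t ^ g) c * (t ^ g - 1#) ∎)
    where
    open QAnalogues R using (int-telescope)
    open SetoidReasoning setoid

-- The d-th factor of a restricted product: 1 where the condition on d fails. The separate f with
-- `h ≈ f` admits an h such as a product with 1, which agrees with its cyclotomic factor only up to
-- equality in the ring.
data Factor {c ℓ : Level} (R : CommutativeRing c ℓ) (t : CommutativeRing.Carrier R) (d : ℕ)
  (h : CommutativeRing.Carrier R) : Set (c ⊔ ℓ) where
  trivial    : let open CommutativeRing R in h ≈ 1# → Factor R t d h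
  cyclotomic : let open CommutativeRing R in ∀ f → h ≈ f → NonZero d → IsPrimitiveRoot (R / f) t d → Factor R t d h

module CoprimeFactors {c ℓ : Level} (R : CommutativeRing c ℓ) where

  open RingNotation R hiding (zero)
  open FiniteProducts R
  open SetoidReasoning setoid

  -- Coprimality as a cancellation property. Over the integers q - 1 and q + 1 satisfy it although
  -- the ideal they generate does not contain 1.
  CoprimeTo : Carrier → Carrier → Set (c ⊔ ℓ)
  CoprimeTo f g = ∀ {b} → f ∣ g * b → f ∣ b

  prod-coprime : ∀ n {f} (g : ℕ → Carrier) → (∀ i → i ℕ.< n → CoprimeTo f (g i)) → CoprimeTo f (prod n g)
  prod-coprime zero    g cop (k , e) = k , trans e (*-identityˡ _)
  prod-coprime (suc n) g cop (k , e) = prod-coprime n (g ∘ suc) (λ i i<n → cop (suc i) (s<s i<n))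
    (cop 0 z<s (k , trans e (*-assoc _ _ _)))

  -- If a = k P with P the product of the later factors, the first factor divides P k and is coprime
  -- to P, hence divides k.
  prod-∣ : ∀ n (f : ℕ → Carrier) {a} → (∀ i → i ℕ.< n → f i ∣ a) →
    (∀ i j → i ℕ.< n → j ℕ.< n → i ≢ j → CoprimeTo (f i) (f j)) → prod n f ∣ a
  prod-∣ zero    f {a} f∣a cop = a , *-identityʳ a
  prod-∣ (suc n) f {a} f∣a cop
    with prod-∣ n (f ∘ suc) {a} (λ i i<n → f∣a (suc i) (s<s i<n))
      (λ i j i<n j<n i≢j → cop (suc i) (suc j) (s<s i<n) (s<s j<n) (i≢j ∘ ℕ.suc-injective))
  ... | k , kP≈a with prod-coprime n (f ∘ suc) (λ j j<n → cop 0 (suc j) z<s (s<s j<n) λ ())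
        (let (l , e) = f∣a 0 z<s in l , trans e (trans (sym kP≈a) (*-comm k _)))
  ... | l , lf≈k = l , trans (sym (*-assoc _ _ _)) (trans (*-congʳ lf≈k) kP≈a)

  factor-coprime : ∀ {t d e f g} → Factor R t d f → Factor R t e g → d ≢ e → CoprimeTo f g
  factor-coprime (trivial f≈1) g-factor d≢e {b} f∣gb = b , trans (*-congˡ f≈1) (*-identityʳ b)
  factor-coprime (cyclotomic f′ f≈f′ _ _) (trivial g≈1) d≢e {b} (k , e) =
    k , trans e (trans (*-congʳ g≈1) (*-identityˡ b))
  factor-coprime {t} {d} {e} {g = g} (cyclotomic f′ f≈f′ d≢0 f-root) (cyclotomic g′ g≈g′ e≢0 g-root) d≢e {b} (k , eq)
    with coprime {R = R} {t} {f′} {g′} {d} {e} {{d≢0}} {{e≢0}} f-root g-root d≢e {b}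
           (k , trans (*-congˡ (sym f≈f′)) (trans eq (*-congʳ g≈g′)))
  ... | l , lf′≈b = l , trans (*-congˡ f≈f′) lf′≈b

  prod-factors-∣ : ∀ n {t} (f : ℕ → Carrier) {a} → (∀ i → i ℕ.< n → Factor R t i (f i)) →
    (∀ i → i ℕ.< n → f i ∣ a) → prod n f ∣ a
  prod-factors-∣ n f factors f∣a = prod-∣ n f f∣a
    λ i j i<n j<n i≢j → factor-coprime (factors i i<n) (factors j j<n) i≢j

  factor-∣-prod : ∀ n (f : ℕ → Carrier) i → i ℕ.< n → f i ∣ prod n f
  factor-∣-prod (suc n) f zero    i<n       = prod n (f ∘ suc) , *-comm _ _
  factor-∣-prod (suc n) f (suc i) (s<s i<n) with factor-∣-prod n (f ∘ suc) i i<n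
  ... | k , e = f 0 * k , trans (*-assoc _ _ _) (*-congˡ e)

  when-factor : ∀ {p} {P : Set p} (P? : Dec P) {t d a} → (P → Factor R t d a) → Factor R t d (a when P?)
  when-factor (yes p) factor = factor p
  when-factor (no _)  factor = trivial refl

  when-∣ : ∀ {p} {P : Set p} (P? : Dec P) {a b} → (P → a ∣ b) → (a when P?) ∣ b
  when-∣ (yes p)     a∣b = a∣b p
  when-∣ (no _)  {b = b} a∣b = b , *-identityʳ b

-- q-Lucas and reflection at a primitive d-th root of unity

module RootOfUnity {c ℓ : Level} (R : CommutativeRing c ℓ) (q : CommutativeRing.Carrier R) (d-1 : ℕ)
  (1<d : 1 ℕ.< suc d-1) (prim : IsPrimitiveRoot R q (suc d-1)) where

  open RingNotation R hiding (zero)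
  open QAnalogues R
  open RingProperties ring using (x[y-z]≈xy-xz; -1*x≈-x; x∙y⁻¹≈ε⇒x≈y; -0#≈0#; +-inverseʳ-unique)
  open NatSolver commutativeSemiring using (solve; _:=_; _:+_; _:*_; con)
  open SetoidReasoning setoid

  d : ℕ
  d = suc d-1

  open IsPrimitiveRoot prim using () renaming (power to q^d≈1; geometric to geometric≈0)

  int-d≈0 : int q d ≈ 0#
  int-d≈0 = trans (int-cong (sym (*-identityʳ q)) d) (geometric≈0 d 1 1<d (≡.sym (ℕ.*-identityʳ d)))

  d∤ : ∀ j → suc j ℕ.< d → ¬ (d ℕ.∣ suc j)
  d∤ j j<d d∣j = ℕ.<⇒≱ j<d (ℕ.∣⇒≤ d∣j)

  int-regular : ∀ j → suc j ℕ.< d → ∀ b → int q (suc j) * b ≈ 0# → b ≈ 0#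
  int-regular j j<d b e = PrimitiveRoot.regular prim (d∤ j j<d) (int-fixed q (suc j) e)

  int-cancel : ∀ j → suc j ℕ.< d → ∀ {a b} → int q (suc j) * a ≈ int q (suc j) * b → a ≈ b
  int-cancel j j<d {a} {b} e = x∙y⁻¹≈ε⇒x≈y a b (int-regular j j<d (a - b)
    (trans (x[y-z]≈xy-xz _ a b) (trans (+-congʳ e) (-‿inverseʳ _))))

  -- The inverse of q^n is q^((d-1)n), because q^d = 1.
  q^-cancel : ∀ n {a b} → q ^ n * a ≈ q ^ n * b → a ≈ b
  q^-cancel n {a} {b} e = begin
    a                                  ≈⟨ unit a ⟨
    q ^ (d-1 ℕ.* n) * (q ^ n * a)      ≈⟨ *-congˡ e ⟩
    q ^ (d-1 ℕ.* n) * (q ^ n * b)      ≈⟨ unit b ⟩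
    b                                  ∎
    where
    unit : ∀ a → q ^ (d-1 ℕ.* n) * (q ^ n * a) ≈ a
    unit a = begin
      q ^ (d-1 ℕ.* n) * (q ^ n * a)    ≈⟨ solve 3 (λ x y a → x :* (y :* a) := y :* x :* a) refl _ _ a ⟩
      q ^ n * q ^ (d-1 ℕ.* n) * a      ≈⟨ *-congʳ (^-homo-* q n (d-1 ℕ.* n)) ⟨
      q ^ (d ℕ.* n) * a                ≈⟨ *-congʳ (^≈1 d q^d≈1 n) ⟩
      1# * a                           ≈⟨ *-identityˡ a ⟩
      a                                ∎

  -- By absorption [k+1] times this binomial has the factor [d] = 0, and [k+1] is regular for k + 1
  -- < d.
  gauss-d≈0 : ∀ k → suc k ℕ.< d → gauss q d (suc k) ≈ 0#
  gauss-d≈0 k k<d = int-regular k k<d _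
    (trans (gauss-absorb-suc q d-1 k) (trans (*-congʳ int-d≈0) (zeroˡ _)))

  gauss-shift-< : ∀ n k → k ℕ.< d → gauss q (n ℕ.+ d) k ≈ gauss q n k
  gauss-shift-< n       zero    k<d = refl
  gauss-shift-< zero    (suc k) k<d = gauss-d≈0 k k<d
  gauss-shift-< (suc n) (suc k) k<d =
    +-cong (gauss-shift-< n k (ℕ.<-trans (ℕ.n<1+n k) k<d)) (*-congˡ (gauss-shift-< n (suc k) k<d))

  q^-shift : ∀ k → q ^ (k ℕ.+ d) ≈ q ^ k
  q^-shift k = trans (^-homo-* q k d) (trans (*-congˡ q^d≈1) (*-identityʳ _))

  -- One step of q-Lucas, the analogue of (1 + y)^(n+d) = (1 + y)^n (1 + y^d) modulo a prime d.
  -- Pascal's rule propagates it because its weights q^k have period d in k.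
  gauss-shift-≥ : ∀ n k → gauss q (n ℕ.+ d) (k ℕ.+ d) ≈ gauss q n (k ℕ.+ d) + gauss q n k
  gauss-shift-≥ zero    zero    = trans (gauss-diagonal q d) (sym (+-identityˡ 1#))
  gauss-shift-≥ zero    (suc k) = trans (gauss-> q (ℕ.m<n+m d z<s)) (sym (+-identityˡ 0#))
  gauss-shift-≥ (suc n) zero    = begin
    gauss q (n ℕ.+ d) d-1 + q ^ d * gauss q (n ℕ.+ d) d
      -- Only here does the lower index drop below d, to d - 1, so the other shift lemma takes over.
      ≈⟨ +-cong (gauss-shift-< n d-1 (ℕ.n<1+n d-1)) (*-cong q^d≈1 (gauss-shift-≥ n zero)) ⟩
    gauss q n d-1 + 1# * (gauss q n d + 1#)
      ≈⟨ solve 2 (λ a b → a :+ con 1 :* (b :+ con 1) := a :+ con 1 :* b :+ con 1) refl _ _ ⟩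
    gauss q n d-1 + 1# * gauss q n d + 1#
      ≈⟨ +-congʳ (+-congˡ (*-congʳ q^d≈1)) ⟨
    gauss q n d-1 + q ^ d * gauss q n d + 1# ∎
  gauss-shift-≥ (suc n) (suc k) = begin
    gauss q (n ℕ.+ d) (k ℕ.+ d) + E * gauss q (n ℕ.+ d) (suc k ℕ.+ d)
      ≈⟨ +-cong (gauss-shift-≥ n k) (*-congˡ (gauss-shift-≥ n (suc k))) ⟩
    (a + b) + E * (a′ + b′)
      ≈⟨ solve 5 (λ a b a′ b′ E → (a :+ b) :+ E :* (a′ :+ b′) := a :+ E :* a′ :+ (b :+ E :* b′))
           refl a b a′ b′ E ⟩
    a + E * a′ + (b + E * b′)
      ≈⟨ +-congˡ (+-congˡ (*-congʳ (q^-shift (suc k)))) ⟩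
    a + E * a′ + (b + q ^ suc k * b′) ∎
    where
    E  = q ^ suc (k ℕ.+ d)
    a  = gauss q n (k ℕ.+ d)
    b  = gauss q n k
    a′ = gauss q n (suc k ℕ.+ d)
    b′ = gauss q n (suc k)

  -- blk s t = s d + t, by the recursion that matches the shift lemmas above.
  blk : ℕ → ℕ → ℕ
  blk zero    t = t
  blk (suc s) t = blk s t ℕ.+ d

  blk-suc : ∀ s t → blk s (suc t) ≡ suc (blk s t)
  blk-suc zero    t = ≡.refl
  blk-suc (suc s) t = ≡.cong (ℕ._+ d) (blk-suc s t)

  blk≡ : ∀ s t → blk s t ≡ t ℕ.+ s ℕ.* d
  blk≡ zero    t = ≡.sym (ℕ.+-identityʳ t)
  blk≡ (suc s) t = ≡.trans (≡.cong (ℕ._+ d) (blk≡ s t))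
    (≡.trans (ℕ.+-assoc t (s ℕ.* d) d) (≡.cong (t ℕ.+_) (ℕ.+-comm (s ℕ.* d) d)))

  blk-+ : ∀ s u t v → blk s t ℕ.+ blk u v ≡ blk (s ℕ.+ u) (t ℕ.+ v)
  blk-+ s u t v = ≡.trans (≡.cong₂ ℕ._+_ (blk≡ s t) (blk≡ u v)) (≡.trans
    (NS.solve 5 (λ s u t v d → (t NS.:+ s NS.:* d) NS.:+ (v NS.:+ u NS.:* d) NS.:= (t NS.:+ v) NS.:+ (s NS.:+ u) NS.:* d) ≡.refl s u t v d)
    (≡.sym (blk≡ (s ℕ.+ u) (t ℕ.+ v))))
    where module NS = +-*-Solver

  blk-carry : ∀ s r → blk s (r ℕ.+ d) ≡ blk (suc s) r
  blk-carry zero    r = ≡.refl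
  blk-carry (suc s) r = ≡.cong (ℕ._+ d) (blk-carry s r)

  data Blocks : ℕ → Set where
    blocks : ∀ u v → v ℕ.< d → Blocks (blk u v)

  toBlocks : ∀ i → Blocks i
  toBlocks i = ≡.subst Blocks (≡.trans (blk≡ (i ℕ./ d) (i ℕ.% d)) (≡.sym (ℕ.m≡m%n+[m/n]*n i d)))
    (blocks (i ℕ./ d) (i ℕ.% d) (ℕ.m%n<n i d))

  q^-blk : ∀ s t → q ^ blk s t ≈ q ^ t
  q^-blk zero    t = refl
  q^-blk (suc s) t = trans (q^-shift (blk s t)) (q^-blk s t)

  binom : ℕ → ℕ → Carrier
  binom _       zero    = 1#
  binom zero    (suc u) = 0#
  binom (suc s) (suc u) = binom s (suc u) + binom s u

  lucas : ∀ s u {t v} → t ℕ.< d → v ℕ.< d → gauss q (blk s t) (blk u v) ≈ binom s u * gauss q t v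
  lucas zero    zero    t<d v<d = sym (*-identityˡ _)
  lucas zero    (suc u) t<d v<d = trans (gauss-> q (ℕ.<-≤-trans t<d (ℕ.m≤n+m d (blk u _)))) (sym (zeroˡ _))
  lucas (suc s) zero    t<d v<d = trans (gauss-shift-< (blk s _) _ v<d) (lucas s zero t<d v<d)
  lucas (suc s) (suc u) t<d v<d = trans (gauss-shift-≥ (blk s _) (blk u _))
    (trans (+-cong (lucas s (suc u) t<d v<d) (lucas s u t<d v<d)) (sym (distribʳ _ _ _)))

  lucas≈0 : ∀ s u {t v} → t ℕ.< v → v ℕ.< d → gauss q (blk s t) (blk u v) ≈ 0#
  lucas≈0 s u t<v v<d = trans (lucas s u (ℕ.<-trans t<v v<d) v<d) (trans (*-congˡ (gauss-> q t<v)) (zeroʳ _))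

  -- With k = sd + t + 1 the index k - 1 stays in the block of k. The sum k + j is put in block s +
  -- u with remainder t + v + 2, which may still exceed d.
  narayana-blk : ∀ s u t v → narayana q (blk s (suc t)) (blk u v) ≡
    gauss q (blk s t) (blk u v) * gauss q (blk (s ℕ.+ u) (suc t ℕ.+ suc v)) (blk u (suc v))
    - gauss q (blk s (suc t)) (blk u (suc v)) * gauss q (blk (s ℕ.+ u) (suc t ℕ.+ suc v)) (blk u v)
  narayana-blk s u t v
    rewrite ≡.sym (blk-+ s u (suc t) (suc v)) | blk-suc s t | blk-suc u v = ≡.refl

  private
    0-0 : ∀ {a b} → a ≈ 0# → b ≈ 0# → a - b ≈ 0#
    0-0 a≈0 b≈0 = trans (+-cong a≈0 (trans (-‿cong b≈0) -0#≈0#)) (+-identityˡ 0#)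

    0ˡ : ∀ {a b} → a ≈ 0# → a * b ≈ 0#
    0ˡ a≈0 = trans (*-congʳ a≈0) (zeroˡ _)

    0ʳ : ∀ {a b} → b ≈ 0# → a * b ≈ 0#
    0ʳ b≈0 = trans (*-congˡ b≈0) (zeroʳ _)

  -- The bound excludes a carry in k + j, so q-Lucas splits the same two ordinary binomials off both
  -- products.
  narayana-lucas : ∀ s u t v → suc t ℕ.+ suc v ℕ.< d →
    narayana q (blk s (suc t)) (blk u v) ≈ binom s u * binom (s ℕ.+ u) u * narayana q (suc t) v
  narayana-lucas s u t v t+v<d = begin
    narayana q (blk s (suc t)) (blk u v)
      ≡⟨ narayana-blk s u t v ⟩
    gauss q (blk s t) (blk u v) * gauss q (blk (s ℕ.+ u) (suc t ℕ.+ suc v)) (blk u (suc v))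
    - gauss q (blk s (suc t)) (blk u (suc v)) * gauss q (blk (s ℕ.+ u) (suc t ℕ.+ suc v)) (blk u v)
      ≈⟨ +-cong (*-cong (lucas s u t<d v<d) (lucas (s ℕ.+ u) u t+v<d 1+v<d))
           (-‿cong (*-cong (lucas s u 1+t<d 1+v<d) (lucas (s ℕ.+ u) u t+v<d v<d))) ⟩
    (B * g₁) * (B′ * g₂) - (B * g₃) * (B′ * g₄)
      ≈⟨ +-cong (regroup B B′ g₁ g₂) (-‿cong (regroup B B′ g₃ g₄)) ⟩
    B * B′ * (g₁ * g₂) - B * B′ * (g₃ * g₄)
      ≈⟨ x[y-z]≈xy-xz (B * B′) (g₁ * g₂) (g₃ * g₄) ⟨
    B * B′ * (g₁ * g₂ - g₃ * g₄) ∎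
    where
    1+t<d : suc t ℕ.< d
    1+t<d = ℕ.≤-<-trans (ℕ.m≤m+n (suc t) (suc v)) t+v<d
    1+v<d : suc v ℕ.< d
    1+v<d = ℕ.≤-<-trans (ℕ.m≤n+m (suc v) (suc t)) t+v<d
    t<d : t ℕ.< d
    t<d = ℕ.<-trans (ℕ.n<1+n t) 1+t<d
    v<d : v ℕ.< d
    v<d = ℕ.<-trans (ℕ.n<1+n v) 1+v<d
    B = binom s u
    B′ = binom (s ℕ.+ u) u
    g₁ = gauss q t v
    g₂ = gauss q (suc t ℕ.+ suc v) (suc v)
    g₃ = gauss q (suc t) (suc v)
    g₄ = gauss q (suc t ℕ.+ suc v) v
    regroup : ∀ a b x y → (a * x) * (b * y) ≈ a * b * (x * y)
    regroup = solve 4 (λ a b x y → (a :* x) :* (b :* y) := a :* b :* (x :* y)) refl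

  -- After the carry, k + j has remainder r = t + v + 2 - d < v, so [k+j,j-1] and [k+j,j] vanish by
  -- q-Lucas. The exception is v + 1 = d, where j has remainder 0; then [k-1,j-1] vanishes instead,
  -- as t < v.
  narayana-carry : ∀ s u t v → suc (suc t) ℕ.< d → v ℕ.< d → d ℕ.≤ suc t ℕ.+ suc v →
    narayana q (blk s (suc t)) (blk u v) ≈ 0#
  narayana-carry s u t v 2+t<d v<d d≤t+v with ℕ.m≤n⇒∃[o]m+o≡n d≤t+v
  ... | r , d+r≡t+v = trans (reflexive (narayana-blk s u t v))
    (0-0 first (0ʳ (trans (reflexive (≡.cong (λ n → gauss q n (blk u v)) carry)) (lucas≈0 (suc (s ℕ.+ u)) u r<v v<d))))
    where
    carry : blk (s ℕ.+ u) (suc t ℕ.+ suc v) ≡ blk (suc (s ℕ.+ u)) r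
    carry = ≡.trans (≡.cong (blk (s ℕ.+ u)) (≡.trans (≡.sym d+r≡t+v) (ℕ.+-comm d r)))
                    (blk-carry (s ℕ.+ u) r)
    r<v : r ℕ.< v
    r<v = ℕ.+-cancelˡ-< d r v (≡.subst₂ ℕ._<_ (≡.trans (≡.sym (ℕ.+-suc (suc t) v)) (≡.sym d+r≡t+v)) ≡.refl
            (ℕ.+-monoˡ-< v 2+t<d))
    first : gauss q (blk s t) (blk u v) * gauss q (blk (s ℕ.+ u) (suc t ℕ.+ suc v)) (blk u (suc v)) ≈ 0#
    first with suc v ℕ.<? d
    ... | yes 1+v<d = 0ʳ (trans (reflexive (≡.cong (λ n → gauss q n (blk u (suc v))) carry))
                        (lucas≈0 (suc (s ℕ.+ u)) u (ℕ.m<n⇒m<1+n r<v) 1+v<d))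
    ... | no 1+v≮d = 0ˡ (lucas≈0 s u (ℕ.<-trans (ℕ.n<1+n t) (ℕ.s<s⁻¹ (ℕ.<-≤-trans 2+t<d (ℕ.≮⇒≥ 1+v≮d)))) v<d)

  -- Both [k-1,j-1] and [k,j] have an upper remainder below the lower one. If v + 1 = d, the second
  -- comparison breaks down, but then k + j carries.
  narayana-< : ∀ s u t v → suc (suc t) ℕ.< d → v ℕ.< d → t ℕ.< v →
    narayana q (blk s (suc t)) (blk u v) ≈ 0#
  narayana-< s u t v 2+t<d v<d t<v with suc v ℕ.<? d
  ... | yes 1+v<d = trans (reflexive (narayana-blk s u t v))
    (0-0 (0ˡ (lucas≈0 s u t<v v<d)) (0ˡ (lucas≈0 s u (s<s t<v) 1+v<d)))
  ... | no 1+v≮d = narayana-carry s u t v 2+t<d v<d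
    (ℕ.≤-trans (ℕ.≮⇒≥ 1+v≮d) (ℕ.m≤n+m (suc v) (suc t)))

  -- Equals P k + k (k+1) / 2, the sum of P + i over 1 ≤ i ≤ k, in the form in which the induction
  -- below accumulates it.
  reflection-exponent : ℕ → ℕ → ℕ
  reflection-exponent P zero    = 0
  reflection-exponent P (suc k) = reflection-exponent P k ℕ.+ (P ℕ.+ suc k)

  reflection-exponent-+ : ∀ a P k → reflection-exponent (a ℕ.+ P) k ≡ a ℕ.* k ℕ.+ reflection-exponent P k
  reflection-exponent-+ a P zero    = ≡.sym (≡.trans (ℕ.+-identityʳ _) (ℕ.*-zeroʳ a))
  reflection-exponent-+ a P (suc k) = ≡.trans
    (≡.cong (ℕ._+ (a ℕ.+ P ℕ.+ suc k)) (reflection-exponent-+ a P k))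
    (NS.solve 4 (λ a P k e → a NS.:* k NS.:+ e NS.:+ (a NS.:+ P NS.:+ (NS.con 1 NS.:+ k)) NS.:=
       a NS.:* (NS.con 1 NS.:+ k) NS.:+ (e NS.:+ (P NS.:+ (NS.con 1 NS.:+ k))))
       ≡.refl a P k (reflection-exponent P k))
    where module NS = +-*-Solver

  q^*int-complement : ∀ a b → a ℕ.+ b ≡ d → q ^ a * int q b ≈ - int q a
  q^*int-complement a b a+b≡d = +-inverseʳ-unique (int q a) (q ^ a * int q b)
    (trans (sym (int-+ q a b)) (trans (reflexive (≡.cong (int q) a+b≡d)) int-d≈0))

  -- As M ≡ -1 - P modulo d, this is the rule for a negative upper index, [-1-P,k] = (-1)^k
  -- q^(-Pk-k(k+1)/2) [P+k,k]. Each step uses q^(P+k+1) [M-k] = -[P+k+1], since the two indices add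
  -- up to d.
  gauss-reflection : ∀ P M k → suc (P ℕ.+ M) ≡ d → k ℕ.≤ M →
    q ^ reflection-exponent P k * gauss q M k ≈ (- 1#) ^ k * gauss q (P ℕ.+ k) k
  gauss-reflection P M zero    eq k≤M = refl
  gauss-reflection P M (suc k) eq k<M = int-cancel k 1+k<d (begin
    I * (q ^ (e ℕ.+ (P ℕ.+ suc k)) * gauss q M (suc k))
      ≈⟨ *-congˡ (*-congʳ (^-homo-* q e (P ℕ.+ suc k))) ⟩
    I * (E * F * gauss q M (suc k))
      ≈⟨ solve 4 (λ I E F g → I :* (E :* F :* g) := E :* (F :* (I :* g))) refl I E F _ ⟩
    E * (F * (I * gauss q M (suc k)))
      ≈⟨ *-congˡ (*-congˡ (gauss-absorb q M k)) ⟩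
    E * (F * (int q (M ℕ.∸ k) * g))
      ≈⟨ *-congˡ (*-assoc F _ g) ⟨
    E * (F * int q (M ℕ.∸ k) * g)
      ≈⟨ *-congˡ (*-congʳ (q^*int-complement (P ℕ.+ suc k) (M ℕ.∸ k) complement)) ⟩
    E * (- J * g)
      ≈⟨ *-congˡ (*-congʳ (-1*x≈-x J)) ⟨
    E * (- 1# * J * g)
      ≈⟨ solve 4 (λ E m J g → E :* (m :* J :* g) := m :* J :* (E :* g)) refl E (- 1#) J g ⟩
    - 1# * J * (E * g)
      ≈⟨ *-congˡ (gauss-reflection P M k eq (ℕ.<⇒≤ k<M)) ⟩
    - 1# * J * (S * h)
      ≈⟨ solve 4 (λ m J S h → m :* J :* (S :* h) := m :* S :* (J :* h)) refl (- 1#) J S h ⟩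
    - 1# * S * (J * h)
      ≡⟨ ≡.cong (λ n → - 1# * S * (int q n * h)) (ℕ.+-suc P k) ⟩
    - 1# * S * (int q (suc (P ℕ.+ k)) * h)
      ≈⟨ *-congˡ (gauss-absorb-suc q (P ℕ.+ k) k) ⟨
    - 1# * S * (I * gauss q (suc (P ℕ.+ k)) (suc k))
      ≈⟨ solve 3 (λ S I g → S :* (I :* g) := I :* (S :* g)) refl (- 1# * S) I _ ⟩
    I * (- 1# * S * gauss q (suc (P ℕ.+ k)) (suc k))
      ≡⟨ ≡.cong (λ n → I * (- 1# * S * gauss q n (suc k))) (ℕ.+-suc P k) ⟨
    I * (- 1# * S * gauss q (P ℕ.+ suc k) (suc k)) ∎)
    where
    e = reflection-exponent P k
    E = q ^ e
    F = q ^ (P ℕ.+ suc k)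
    S = (- 1#) ^ k
    I = int q (suc k)
    J = int q (P ℕ.+ suc k)
    g = gauss q M k
    h = gauss q (P ℕ.+ k) k
    1+k<d : suc k ℕ.< d
    1+k<d = ≡.subst (suc k ℕ.<_) eq (s≤s (ℕ.≤-trans k<M (ℕ.m≤n+m M P)))
    complement : P ℕ.+ suc k ℕ.+ (M ℕ.∸ k) ≡ d
    complement = ≡.trans (≡.cong (ℕ._+ (M ℕ.∸ k)) (ℕ.+-suc P k)) (≡.trans (≡.cong suc
      (≡.trans (ℕ.+-assoc P k _) (≡.cong (P ℕ.+_) (ℕ.m+[n∸m]≡n (ℕ.<⇒≤ k<M))))) eq)

  Complementary : ℕ → ℕ → Set
  Complementary t t′ = suc (t ℕ.+ t′) ≡ d

  complementary-sym : ∀ t t′ → Complementary t t′ → Complementary t′ t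
  complementary-sym t t′ eq = ≡.trans (≡.cong suc (ℕ.+-comm t′ t)) eq

  complementary-≤ : ∀ t t′ v → Complementary t t′ → t ℕ.+ v ℕ.< d → v ℕ.≤ t′
  complementary-≤ t t′ v eq t+v<d =
    ℕ.+-cancelˡ-≤ t v t′ (ℕ.s≤s⁻¹ (≡.subst (t ℕ.+ v ℕ.<_) (≡.sym eq) t+v<d))

  -- Multiplication by [v+1] turns each side into a product g h with g(t) = [t,v] and h(t) =
  -- [t+v+2,v]. Reflection replaces g at one index by h at the complementary one, up to a power of q
  -- and (-1)^v, so both sides become (-1)^v h(t) h(t′).
  narayana-reflection-base : ∀ {t t′} v → Complementary (suc t) (suc t′) →
    suc t ℕ.+ suc v ℕ.< d → suc t′ ℕ.+ suc v ℕ.< d →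
    q ^ (suc t ℕ.* suc v) * narayana q (suc t′) v ≈ q ^ (suc t′ ℕ.* suc v) * narayana q (suc t) v
  narayana-reflection-base {t} {t′} v eq t+v<d t′+v<d = int-cancel v 1+v<d (begin
    I * (X * narayana q (suc t′) v)
      ≈⟨ expand t t′ ⟩
    q ^ suc t′ * q ^ suc t * (q ^ (suc t ℕ.* v) * (g t′ * h t′))
      ≈⟨ *-cong (*-comm _ _) (q^-cancel e₁ core) ⟩
    q ^ suc t * q ^ suc t′ * (q ^ (suc t′ ℕ.* v) * (g t * h t))
      ≈⟨ expand t′ t ⟨
    I * (X′ * narayana q (suc t) v) ∎)
    where
    I = int q (suc v)
    X = q ^ (suc t ℕ.* suc v)
    X′ = q ^ (suc t′ ℕ.* suc v)
    g h : ℕ → Carrier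
    g t = gauss q t v
    h t = gauss q (suc t ℕ.+ suc v) v
    e₁ = reflection-exponent 1 v

    1+v<d : suc v ℕ.< d
    1+v<d = ℕ.≤-<-trans (ℕ.m≤n+m (suc v) (suc t)) t+v<d

    expand : ∀ a b → I * (q ^ (suc a ℕ.* suc v) * narayana q (suc b) v) ≈
      q ^ suc b * q ^ suc a * (q ^ (suc a ℕ.* v) * (g b * h b))
    expand a b = begin
      I * (q ^ (suc a ℕ.* suc v) * narayana q (suc b) v)
        ≈⟨ *-congˡ (*-congʳ (trans (^-congʳ q (ℕ.*-suc (suc a) v)) (^-homo-* q (suc a) (suc a ℕ.* v)))) ⟩
      I * (q ^ suc a * q ^ (suc a ℕ.* v) * narayana q (suc b) v)
        ≈⟨ solve 4 (λ I A V N → I :* (A :* V :* N) := A :* V :* (I :* N)) refl I (q ^ suc a) _ _ ⟩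
      q ^ suc a * q ^ (suc a ℕ.* v) * (I * narayana q (suc b) v)
        ≈⟨ *-congˡ (int-*-narayana q b v) ⟩
      q ^ suc a * q ^ (suc a ℕ.* v) * (q ^ suc b * (g b * h b))
        ≈⟨ solve 4 (λ A V B N → A :* V :* (B :* N) := B :* A :* (V :* N)) refl (q ^ suc a) _ (q ^ suc b) _ ⟩
      q ^ suc b * q ^ suc a * (q ^ (suc a ℕ.* v) * (g b * h b)) ∎

    reflect : ∀ a b → Complementary (suc a) (suc b) → suc a ℕ.+ suc v ℕ.< d →
      q ^ (suc a ℕ.* v) * q ^ e₁ * g b ≈ (- 1#) ^ v * h a
    reflect a b eq a+v<d = begin
      q ^ (suc a ℕ.* v) * q ^ e₁ * g b
        ≈⟨ *-congʳ (^-homo-* q (suc a ℕ.* v) e₁) ⟨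
      q ^ (suc a ℕ.* v ℕ.+ e₁) * g b
        -- Taking P = suc a + 1 makes P + v the upper index of h a. The part `suc a` of P accounts
        -- for the power q^(suc a * v), and what remains, e₁, does not depend on a, so it cancels in
        -- `core`.
        ≡⟨ ≡.cong (λ n → q ^ n * g b) (reflection-exponent-+ (suc a) 1 v) ⟨
      q ^ reflection-exponent (suc a ℕ.+ 1) v * g b
        ≈⟨ gauss-reflection (suc a ℕ.+ 1) b v
             (≡.trans (≡.cong suc (ℕ.+-assoc (suc a) 1 b)) eq) (ℕ.s≤s⁻¹ (complementary-≤ (suc a) (suc b) (suc v) eq a+v<d)) ⟩
      (- 1#) ^ v * gauss q (suc a ℕ.+ 1 ℕ.+ v) v
        ≡⟨ ≡.cong (λ n → (- 1#) ^ v * gauss q n v) (ℕ.+-assoc (suc a) 1 v) ⟩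
      (- 1#) ^ v * h a ∎

    core : q ^ e₁ * (q ^ (suc t ℕ.* v) * (g t′ * h t′)) ≈ q ^ e₁ * (q ^ (suc t′ ℕ.* v) * (g t * h t))
    core = begin
      q ^ e₁ * (q ^ (suc t ℕ.* v) * (g t′ * h t′))
        ≈⟨ solve 4 (λ E T g h → E :* (T :* (g :* h)) := T :* E :* g :* h) refl _ _ (g t′) (h t′) ⟩
      q ^ (suc t ℕ.* v) * q ^ e₁ * g t′ * h t′
        ≈⟨ *-congʳ (reflect t t′ eq t+v<d) ⟩
      (- 1#) ^ v * h t * h t′
        ≈⟨ solve 3 (λ s h h′ → s :* h :* h′ := s :* h′ :* h) refl _ (h t) (h t′) ⟩
      (- 1#) ^ v * h t′ * h t
        ≈⟨ *-congʳ (reflect t′ t (complementary-sym (suc t) (suc t′) eq) t′+v<d) ⟨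
      q ^ (suc t′ ℕ.* v) * q ^ e₁ * g t * h t
        ≈⟨ solve 4 (λ E T g h → E :* (T :* (g :* h)) := T :* E :* g :* h) refl _ _ (g t) (h t) ⟨
      q ^ e₁ * (q ^ (suc t′ ℕ.* v) * (g t * h t)) ∎

  q^-blk-* : ∀ s t u v → q ^ (blk s t ℕ.* blk u v) ≈ q ^ (t ℕ.* v)
  q^-blk-* s t u v = begin
    q ^ (blk s t ℕ.* blk u v)    ≈⟨ ^-assocʳ q (blk s t) (blk u v) ⟨
    (q ^ blk s t) ^ blk u v      ≈⟨ ^-congˡ (blk u v) (q^-blk s t) ⟩
    (q ^ t) ^ blk u v            ≈⟨ ^-assocʳ q t (blk u v) ⟩
    q ^ (t ℕ.* blk u v)          ≡⟨ ≡.cong (q ^_) (ℕ.*-comm t (blk u v)) ⟩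
    q ^ (blk u v ℕ.* t)          ≈⟨ ^-assocʳ q (blk u v) t ⟨
    (q ^ blk u v) ^ t            ≈⟨ ^-congˡ t (q^-blk u v) ⟩
    (q ^ v) ^ t                  ≈⟨ ^-assocʳ q v t ⟩
    q ^ (v ℕ.* t)                ≡⟨ ≡.cong (q ^_) (ℕ.*-comm v t) ⟩
    q ^ (t ℕ.* v)                ∎

  2+<d : ∀ t t′ → Complementary (suc t) (suc t′) → suc (suc t′) ℕ.< d
  2+<d t t′ eq = ≡.subst (suc (suc t′) ℕ.<_) eq (s≤s (s≤s (ℕ.m≤n+m (suc t′) t)))

  <-complement : ∀ t t′ v → Complementary (suc t) (suc t′) → ¬ (suc t ℕ.+ suc v ℕ.< d) → t′ ℕ.< v
  <-complement t t′ v eq t+v≮d = ℕ.s<s⁻¹ (ℕ.+-cancelˡ-< (suc t) (suc t′) (suc v)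
    (≡.subst (ℕ._≤ suc t ℕ.+ suc v) (≡.sym eq) (ℕ.≮⇒≥ t+v≮d)))

  -- By complementarity t + v + 2 ≥ d is the same as t′ < v. So whenever one side has a carry both
  -- sides vanish, one by `narayana-carry` and the other by `narayana-<`; without carries q-Lucas
  -- reduces to remainders with a common factor.
  narayana-reflection : ∀ s {t t′} i → Complementary (suc t) (suc t′) →
    q ^ (blk s (suc t) ℕ.* suc i) * narayana q (blk s (suc t′)) i ≈
    q ^ (blk s (suc t′) ℕ.* suc i) * narayana q (blk s (suc t)) i
  narayana-reflection s {t} {t′} i eq with toBlocks i
  ... | blocks u v v<d with suc t ℕ.+ suc v ℕ.<? d | suc t′ ℕ.+ suc v ℕ.<? d
  ... | no t+v≮d | _ = trans
    (0ʳ (narayana-< s u t′ v (2+<d t t′ eq) v<d (<-complement t t′ v eq t+v≮d)))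
    (sym (0ʳ (narayana-carry s u t v (2+<d t′ t (complementary-sym (suc t) (suc t′) eq)) v<d (ℕ.≮⇒≥ t+v≮d))))
  ... | yes _ | no t′+v≮d = trans
    (0ʳ (narayana-carry s u t′ v (2+<d t t′ eq) v<d (ℕ.≮⇒≥ t′+v≮d)))
    (sym (0ʳ (narayana-< s u t v (2+<d t′ t eq′) v<d (<-complement t′ t v eq′ t′+v≮d))))
    where
    eq′ : Complementary (suc t′) (suc t)
    eq′ = complementary-sym (suc t) (suc t′) eq
  ... | yes t+v<d | yes t′+v<d = begin
    q ^ (blk s (suc t) ℕ.* suc (blk u v)) * narayana q (blk s (suc t′)) (blk u v)
      ≈⟨ *-cong (q^-blk-suc t) (narayana-lucas s u t′ v t′+v<d) ⟩
    q ^ (suc t ℕ.* suc v) * (B * narayana q (suc t′) v)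
      ≈⟨ solve 3 (λ q B N → q :* (B :* N) := B :* (q :* N)) refl _ B _ ⟩
    B * (q ^ (suc t ℕ.* suc v) * narayana q (suc t′) v)
      ≈⟨ *-congˡ (narayana-reflection-base v eq t+v<d t′+v<d) ⟩
    B * (q ^ (suc t′ ℕ.* suc v) * narayana q (suc t) v)
      ≈⟨ solve 3 (λ q B N → q :* (B :* N) := B :* (q :* N)) refl _ B _ ⟨
    q ^ (suc t′ ℕ.* suc v) * (B * narayana q (suc t) v)
      ≈⟨ *-cong (q^-blk-suc t′) (narayana-lucas s u t v t+v<d) ⟨
    q ^ (blk s (suc t′) ℕ.* suc (blk u v)) * narayana q (blk s (suc t)) (blk u v) ∎
    where
    B = binom s u * binom (s ℕ.+ u) u
    q^-blk-suc : ∀ t → q ^ (blk s (suc t) ℕ.* suc (blk u v)) ≈ q ^ (suc t ℕ.* suc v)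
    q^-blk-suc t = trans (^-congʳ q (≡.cong (blk s (suc t) ℕ.*_) (≡.sym (blk-suc u v)))) (q^-blk-* s (suc t) u (suc v))

-- Finite sums: reversal, antisymmetry, blocks

module FiniteSums {c ℓ : Level} (R : CommutativeRing c ℓ) where

  open RingNotation R hiding (zero)
  open RingProperties ring using (-0#≈0#; -‿+-comm)
  open SetoidReasoning setoid

  sum< : ℕ → (ℕ → Carrier) → Carrier
  sum< n f = ∑[ i < n ] f (toℕ i)

  sum<-cong : ∀ n {f g : ℕ → Carrier} → (∀ i → i ℕ.< n → f i ≈ g i) → sum< n f ≈ sum< n g
  sum<-cong zero    e = refl
  sum<-cong (suc n) e = +-cong (e 0 z<s) (sum<-cong n (λ i i<n → e (suc i) (s<s i<n)))

  sum<-≈0 : ∀ n {f} → (∀ i → i ℕ.< n → f i ≈ 0#) → sum< n f ≈ 0#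
  sum<-≈0 zero    e = refl
  sum<-≈0 (suc n) e = trans (+-cong (e 0 z<s) (sum<-≈0 n (λ i i<n → e (suc i) (s<s i<n)))) (+-identityˡ 0#)

  sum<-+ : ∀ m n f → sum< (m ℕ.+ n) f ≈ sum< m f + sum< n (λ i → f (m ℕ.+ i))
  sum<-+ zero    n f = sym (+-identityˡ _)
  sum<-+ (suc m) n f = trans (+-congˡ (sum<-+ m n (f ∘ suc))) (sym (+-assoc _ _ _))

  sum<-extend : ∀ m n f → (∀ i → m ℕ.≤ i → f i ≈ 0#) → sum< (m ℕ.+ n) f ≈ sum< m f
  sum<-extend m n f e = trans (sum<-+ m n f)
    (trans (+-congˡ (sum<-≈0 n (λ i _ → e (m ℕ.+ i) (ℕ.m≤m+n m i)))) (+-identityʳ _))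

  sum<-neg : ∀ n f → sum< n (λ i → - f i) ≈ - sum< n f
  sum<-neg zero    f = sym -0#≈0#
  sum<-neg (suc n) f = trans (+-congˡ (sum<-neg n (f ∘ suc))) (-‿+-comm _ _)

  sum<-suc : ∀ n f → sum< (suc n) f ≈ sum< n f + f n
  sum<-suc zero    f = +-comm (f 0) 0#
  sum<-suc (suc n) f = trans (+-congˡ (sum<-suc n (f ∘ suc))) (sym (+-assoc _ _ _))

  sum<-reverse : ∀ n f → sum< n f ≈ sum< n (λ i → f (n ℕ.∸ suc i))
  sum<-reverse zero    f = refl
  sum<-reverse (suc n) f = trans (sum<-suc n f) (trans (+-comm _ _) (+-congˡ (sum<-reverse n f)))

  -- The doubled sum is needed: a middle index paired with itself only satisfies f i = - f i.
  sum<-antisymmetric : ∀ n f → (∀ i j → suc (i ℕ.+ j) ≡ n → f j ≈ - f i) → sum< n f + sum< n f ≈ 0#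
  sum<-antisymmetric n f anti = begin
    sum< n f + sum< n f      ≈⟨ +-congˡ (trans (sum<-reverse n f) (sum<-cong n reflected)) ⟩
    sum< n f + sum< n (λ i → - f i)  ≈⟨ +-congˡ (sum<-neg n f) ⟩
    sum< n f - sum< n f      ≈⟨ -‿inverseʳ _ ⟩
    0#                       ∎
    where
    reflected : ∀ i → i ℕ.< n → f (n ℕ.∸ suc i) ≈ - f i
    reflected i i<n = anti i (n ℕ.∸ suc i) (ℕ.m+[n∸m]≡n i<n)

  sum<-blocks : ∀ N d f → (∀ s → s ℕ.< N → sum< d (λ t → f (t ℕ.+ s ℕ.* d)) ≈ 0#) → sum< (N ℕ.* d) f ≈ 0#
  sum<-blocks zero    d f e = refl
  sum<-blocks (suc N) d f e = trans (sum<-+ d (N ℕ.* d) f) (trans (+-cong first rest) (+-identityˡ 0#))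
    where
    first : sum< d f ≈ 0#
    first = trans (sum<-cong d (λ t _ → reflexive (≡.cong f (≡.sym (ℕ.+-identityʳ t))))) (e 0 z<s)
    rest : sum< (N ℕ.* d) (λ i → f (d ℕ.+ i)) ≈ 0#
    rest = sum<-blocks N d (λ i → f (d ℕ.+ i)) λ s s<N → trans
      (sum<-cong d (λ t _ → reflexive (≡.cong f (shift s t)))) (e (suc s) (s<s s<N))
      where
      shift : ∀ s t → d ℕ.+ (t ℕ.+ s ℕ.* d) ≡ t ℕ.+ (d ℕ.+ s ℕ.* d)
      shift s t = NS.solve 3 (λ d t e → d NS.:+ (t NS.:+ e) NS.:= t NS.:+ (d NS.:+ e)) ≡.refl d t (s ℕ.* d)
        where module NS = +-*-Solver

-- Vanishing of the sum at a primitive root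

module AlternatingSum {c ℓ : Level} (K : CommutativeRing c ℓ) (q x : CommutativeRing.Carrier K) where

  open RingNotation K hiding (zero)
  open Exp commutativeSemiring using (^-distrib-*)
  open QAnalogues K
  open FiniteSums K
  open RingProperties ring using (-1*x≈-x; -0#≈0#; +-inverseˡ-unique; +-cancelʳ; -‿involutive)
  open NatSolver commutativeSemiring using (solve; _:=_; _:+_; _:*_; con)
  open SetoidReasoning setoid
  private module NS = +-*-Solver

  Q : Carrier
  Q = q ^ 2

  -- unit k i stands for Q ^ (α (C(i+2,2) - (k+1) i)), whose exponent may be negative.
  module Vanishing (d-1 : ℕ) (1<d : 1 ℕ.< suc d-1) (prim : IsPrimitiveRoot K Q (suc d-1))
    (-q^d≈-1 : (- q) ^ suc d-1 ≈ - 1#) (α m r : ℕ) .{{_ : NonZero α}} .{{_ : NonZero r}}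
    (unit : ℕ → ℕ → Carrier) (scale : ℕ → Carrier)
    (unit-* : ∀ k i → unit k i * Q ^ (α ℕ.* (suc k ℕ.* i)) ≈ scale i) where

    open RootOfUnity K Q d-1 1<d prim
    open PrimitiveRoot prim using (regular)

    -- q^n q^n is the power Q^n, which can be cancelled.
    q^-regular : ∀ n {a b} → q ^ n * a ≈ q ^ n * b → a ≈ b
    q^-regular n {a} {b} e = q^-cancel n (trans (double a) (trans (*-congˡ e) (sym (double b))))
      where
      double : ∀ a → Q ^ n * a ≈ q ^ n * (q ^ n * a)
      double a = begin
        (q * (q * 1#)) ^ n * a     ≈⟨ *-congʳ (^-congˡ n (*-congˡ (*-identityʳ q))) ⟩
        (q * q) ^ n * a            ≈⟨ *-congʳ (^-distrib-* q q n) ⟩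
        q ^ n * q ^ n * a          ≈⟨ *-assoc _ _ a ⟩
        q ^ n * (q ^ n * a)        ∎

    Q^≈ : ∀ n → Q ^ n ≈ q ^ (2 ℕ.* n)
    Q^≈ = ^-assocʳ q 2

    int-multiple : ∀ n → int Q (n ℕ.* d) ≈ 0#
    int-multiple zero    = refl
    int-multiple (suc n) = trans (int-+ Q d (n ℕ.* d))
      (trans (+-cong int-d≈0 (trans (*-congˡ (int-multiple n)) (zeroʳ _))) (+-identityˡ 0#))

    int-shift : ∀ a n → int Q (a ℕ.+ n ℕ.* d) ≈ int Q a
    int-shift a n = trans (int-+ Q a (n ℕ.* d))
      (trans (+-congˡ (trans (*-congˡ (int-multiple n)) (zeroʳ _))) (+-identityʳ _))

    w-coefficient : ℕ → ℕ → Carrier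
    w-coefficient k i = unit k i * narayana Q k i ^ α * x ^ i

    W : ℕ → Carrier
    W k = sum< k (w-coefficient k)

    -- The first index is a successor because of the truncated `k ∸ 1`: `narayana` at k = 0, i = 0
    -- is 1, not 0. Positivity of α passes the vanishing on to the power.
    w-coefficient-≥ : ∀ k i → suc k ℕ.≤ i → w-coefficient (suc k) i ≈ 0#
    w-coefficient-≥ k i k<i = trans (*-congʳ (trans (*-congˡ (trans (^-congˡ α N≈0) (0^n α))) (zeroʳ _))) (zeroˡ _)
      where
      N≈0 : narayana Q (suc k) i ≈ 0#
      N≈0 = trans (+-cong (trans (*-congʳ (gauss-> Q k<i)) (zeroˡ _))
        (-‿cong (trans (*-congʳ (gauss-> Q (s<s k<i))) (zeroˡ _)))) (-‿inverseʳ 0#)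

    -- Multiplying by both Q^(e k) and Q^(e k′) clears the negative exponents in `unit`. Then
    -- α(k+1)i + αk = αi + αk(i+1) collects the powers of Q into an α-th power of the reflected
    -- product.
    w-coefficient-reflection : ∀ k k′ i →
      Q ^ (k ℕ.* suc i) * narayana Q k′ i ≈ Q ^ (k′ ℕ.* suc i) * narayana Q k i →
      w-coefficient k′ i * Q ^ (α ℕ.* k) ≈ w-coefficient k i * Q ^ (α ℕ.* k′)
    w-coefficient-reflection k k′ i eq = q^-cancel (e k) (q^-cancel (e k′) (begin
      Q ^ e k′ * (Q ^ e k * (unit k′ i * N k′ ^ α * x ^ i * Q ^ (α ℕ.* k)))
        ≈⟨ solve 6 (λ P′ P U N X A → P′ :* (P :* (U :* N :* X :* A)) := U :* P′ :* X :* (P :* A :* N))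
             refl (Q ^ e k′) (Q ^ e k) (unit k′ i) (N k′ ^ α) (x ^ i) _ ⟩
      unit k′ i * Q ^ e k′ * x ^ i * (Q ^ e k * Q ^ (α ℕ.* k) * N k′ ^ α)
        ≈⟨ *-cong (*-congʳ (unit-* k′ i)) (half k k′) ⟩
      scale i * x ^ i * (Q ^ (α ℕ.* i) * (Q ^ (k ℕ.* suc i) * N k′) ^ α)
        ≈⟨ *-congˡ (*-congˡ (^-congˡ α eq)) ⟩
      scale i * x ^ i * (Q ^ (α ℕ.* i) * (Q ^ (k′ ℕ.* suc i) * N k) ^ α)
        ≈⟨ *-cong (*-congʳ (unit-* k i)) (half k′ k) ⟨
      unit k i * Q ^ e k * x ^ i * (Q ^ e k′ * Q ^ (α ℕ.* k′) * N k ^ α)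
        ≈⟨ solve 6 (λ P′ P U N X A → P′ :* (P :* (U :* N :* X :* A)) := U :* P :* X :* (P′ :* A :* N))
             refl (Q ^ e k′) (Q ^ e k) (unit k i) (N k ^ α) (x ^ i) _ ⟨
      Q ^ e k′ * (Q ^ e k * (unit k i * N k ^ α * x ^ i * Q ^ (α ℕ.* k′))) ∎))
      where
      e : ℕ → ℕ
      e k = α ℕ.* (suc k ℕ.* i)
      N : ℕ → Carrier
      N k = narayana Q k i
      half : ∀ k k′ → Q ^ e k * Q ^ (α ℕ.* k) * N k′ ^ α ≈ Q ^ (α ℕ.* i) * (Q ^ (k ℕ.* suc i) * N k′) ^ α
      half k k′ = begin
        Q ^ e k * Q ^ (α ℕ.* k) * N k′ ^ α
          ≈⟨ *-congʳ (^-homo-* Q (e k) (α ℕ.* k)) ⟨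
        Q ^ (e k ℕ.+ α ℕ.* k) * N k′ ^ α
          ≡⟨ ≡.cong (λ n → Q ^ n * N k′ ^ α) (NS.solve 3 (λ α k i →
               α NS.:* ((NS.con 1 NS.:+ k) NS.:* i) NS.:+ α NS.:* k NS.:=
               α NS.:* i NS.:+ k NS.:* (NS.con 1 NS.:+ i) NS.:* α) ≡.refl α k i) ⟩
        Q ^ (α ℕ.* i ℕ.+ k ℕ.* suc i ℕ.* α) * N k′ ^ α
          ≈⟨ *-congʳ (^-homo-* Q (α ℕ.* i) (k ℕ.* suc i ℕ.* α)) ⟩
        Q ^ (α ℕ.* i) * Q ^ (k ℕ.* suc i ℕ.* α) * N k′ ^ α
          ≈⟨ *-congʳ (*-congˡ (^-assocʳ Q (k ℕ.* suc i) α)) ⟨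
        Q ^ (α ℕ.* i) * (Q ^ (k ℕ.* suc i)) ^ α * N k′ ^ α
          ≈⟨ *-assoc _ _ _ ⟩
        Q ^ (α ℕ.* i) * ((Q ^ (k ℕ.* suc i)) ^ α * N k′ ^ α)
          ≈⟨ *-congˡ (^-distrib-* _ _ α) ⟨
        Q ^ (α ℕ.* i) * (Q ^ (k ℕ.* suc i) * N k′) ^ α ∎

    Reflected : ℕ → ℕ → Set ℓ
    Reflected k k′ = ∀ i → Q ^ (k ℕ.* suc i) * narayana Q k′ i ≈ Q ^ (k′ ℕ.* suc i) * narayana Q k i

    W-extend : ∀ k n → .{{NonZero k}} → sum< (k ℕ.+ n) (w-coefficient k) ≈ W k
    W-extend (suc k) n = sum<-extend (suc k) n _ (w-coefficient-≥ k)

    -- The sums W k and W k′ have different lengths; zero terms extend both to length k + k′, where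
    -- they are compared coefficientwise.
    W-reflection : ∀ k k′ → .{{NonZero k}} → .{{NonZero k′}} → Reflected k k′ →
      W k′ * Q ^ (α ℕ.* k) ≈ W k * Q ^ (α ℕ.* k′)
    W-reflection k k′ eq = begin
      W k′ * Q ^ (α ℕ.* k)
        ≈⟨ *-congʳ (W-extend k′ k) ⟨
      sum< (k′ ℕ.+ k) (w-coefficient k′) * Q ^ (α ℕ.* k)
        ≡⟨ ≡.cong (λ n → sum< n (w-coefficient k′) * Q ^ (α ℕ.* k)) (ℕ.+-comm k′ k) ⟩
      sum< (k ℕ.+ k′) (w-coefficient k′) * Q ^ (α ℕ.* k)
        ≈⟨ *-distribʳ-sum {k ℕ.+ k′} _ (w-coefficient k′ ∘ toℕ) ⟩
      sum< (k ℕ.+ k′) (λ i → w-coefficient k′ i * Q ^ (α ℕ.* k))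
        ≈⟨ sum<-cong (k ℕ.+ k′) (λ i _ → w-coefficient-reflection k k′ i (eq i)) ⟩
      sum< (k ℕ.+ k′) (λ i → w-coefficient k i * Q ^ (α ℕ.* k′))
        ≈⟨ *-distribʳ-sum {k ℕ.+ k′} _ (w-coefficient k ∘ toℕ) ⟨
      sum< (k ℕ.+ k′) (w-coefficient k) * Q ^ (α ℕ.* k′)
        ≈⟨ *-congʳ (W-extend k k′) ⟩
      W k * Q ^ (α ℕ.* k′) ∎
      where
      open SemiringSum semiring using (*-distribʳ-sum)

    sign : ℕ → Carrier
    sign k = (- 1#) ^ k

    -1*-1≈1 : - 1# * - 1# ≈ 1#
    -1*-1≈1 = trans (-1*x≈-x (- 1#)) (-‿involutive 1#)

    sign² : ∀ k → sign k * sign k ≈ 1#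
    sign² k = trans (sym (^-distrib-* (- 1#) (- 1#) k)) (trans (^-congˡ k -1*-1≈1) (1^n k))

    -- (-q)^(k+k′+1) is an odd power of (-q)^d = -1, hence -1. Removing the sign (-1)^(k+k′+1)
    -- leaves (-1)^(k+k′).
    q^-reflected : ∀ k k′ c → suc (k ℕ.+ k′) ≡ d ℕ.* (1 ℕ.+ 2 ℕ.* c) → q ^ suc (k ℕ.+ k′) ≈ sign k * sign k′
    q^-reflected k k′ c eq = begin
      E                                    ≈⟨ *-identityˡ E ⟨
      1# * E                               ≈⟨ *-congʳ (trans (*-cong (sign² k) (sign² k′)) (*-identityˡ 1#)) ⟨
      s * s * (s′ * s′) * E                ≈⟨ *-identityˡ _ ⟨
      1# * (s * s * (s′ * s′) * E)         ≈⟨ *-congʳ -1*-1≈1 ⟨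
      - 1# * - 1# * (s * s * (s′ * s′) * E)
        ≈⟨ solve 4 (λ m s s′ E → m :* m :* (s :* s :* (s′ :* s′) :* E) := m :* (s :* s′) :* (m :* (s :* s′) :* E))
             refl (- 1#) s s′ E ⟩
      - 1# * (s * s′) * (- 1# * (s * s′) * E)
        ≈⟨ *-congˡ (*-congʳ (*-congˡ (^-homo-* (- 1#) k k′))) ⟨
      - 1# * (s * s′) * (sign (suc (k ℕ.+ k′)) * E)
        ≈⟨ *-congˡ (^-distrib-* (- 1#) q (suc (k ℕ.+ k′))) ⟨
      - 1# * (s * s′) * (- 1# * q) ^ suc (k ℕ.+ k′)
        ≈⟨ *-congˡ (trans (^-congˡ (suc (k ℕ.+ k′)) (-1*x≈-x q)) odd-power) ⟩
      - 1# * (s * s′) * - 1#               ≈⟨ solve 2 (λ m s → m :* s :* m := m :* m :* s) refl (- 1#) (s * s′) ⟩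
      - 1# * - 1# * (s * s′)               ≈⟨ *-congʳ -1*-1≈1 ⟩
      1# * (s * s′)                        ≈⟨ *-identityˡ _ ⟩
      s * s′                               ∎
      where
      E = q ^ suc (k ℕ.+ k′)
      s = sign k
      s′ = sign k′
      odd-power : (- q) ^ suc (k ℕ.+ k′) ≈ - 1#
      odd-power = begin
        (- q) ^ suc (k ℕ.+ k′)                ≡⟨ ≡.cong ((- q) ^_) eq ⟩
        (- q) ^ (d ℕ.* (1 ℕ.+ 2 ℕ.* c))       ≈⟨ ^-assocʳ (- q) d (1 ℕ.+ 2 ℕ.* c) ⟨
        ((- q) ^ d) ^ (1 ℕ.+ 2 ℕ.* c)         ≈⟨ ^-congˡ (1 ℕ.+ 2 ℕ.* c) -q^d≈-1 ⟩
        - 1# * (- 1#) ^ (2 ℕ.* c)             ≈⟨ *-congˡ (^≈1 2 (trans (*-congˡ (*-identityʳ _)) -1*-1≈1) c) ⟩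
        - 1# * 1#                             ≈⟨ *-identityʳ _ ⟩
        - 1#                                  ∎

    -- X := (-1)^k′ [2k′+1] q^k + (-1)^k [2k+1] q^k′ is fixed under multiplication by q, hence zero.
    odd-int-reflection : ∀ k k′ → q ^ suc (k ℕ.+ k′) ≈ sign k * sign k′ →
      sign k′ * int q (2 ℕ.* k′ ℕ.+ 1) * q ^ k ≈ - (sign k * int q (2 ℕ.* k ℕ.+ 1) * q ^ k′)
    odd-int-reflection k k′ qK = +-inverseˡ-unique _ _ (regular (d∤ 0 1<d) Q-fixed)
      where
      s = sign k
      s′ = sign k′
      I = int q (2 ℕ.* k ℕ.+ 1)
      I′ = int q (2 ℕ.* k′ ℕ.+ 1)
      X = s′ * I′ * q ^ k + s * I * q ^ k′
      C = s′ * q ^ k + s * q ^ k′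

      exchange : ∀ k k′ → q ^ suc (k ℕ.+ k′) ≈ sign k * sign k′ →
        sign k′ * q ^ (2 ℕ.* k′ ℕ.+ 1) * q ^ k ≈ sign k * q ^ k′
      exchange k k′ qK = begin
        sign k′ * q ^ (2 ℕ.* k′ ℕ.+ 1) * q ^ k
          ≈⟨ trans (*-assoc _ _ _) (*-congˡ (sym (^-homo-* q (2 ℕ.* k′ ℕ.+ 1) k))) ⟩
        sign k′ * q ^ (2 ℕ.* k′ ℕ.+ 1 ℕ.+ k)
          ≡⟨ ≡.cong (λ n → sign k′ * q ^ n) (NS.solve 2 (λ k k′ → NS.con 2 NS.:* k′ NS.:+ NS.con 1 NS.:+ k NS.:=
               k′ NS.:+ (NS.con 1 NS.:+ (k NS.:+ k′))) ≡.refl k k′) ⟩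
        sign k′ * q ^ (k′ ℕ.+ suc (k ℕ.+ k′))
          ≈⟨ *-congˡ (trans (^-homo-* q k′ (suc (k ℕ.+ k′))) (*-congˡ qK)) ⟩
        sign k′ * (q ^ k′ * (sign k * sign k′))
          ≈⟨ solve 3 (λ s s′ q → s′ :* (q :* (s :* s′)) := s′ :* s′ :* (s :* q)) refl (sign k) (sign k′) (q ^ k′) ⟩
        sign k′ * sign k′ * (sign k * q ^ k′)
          ≈⟨ trans (*-congʳ (sign² k′)) (*-identityˡ _) ⟩
        sign k * q ^ k′ ∎

      q-fixed : q * X ≈ X
      -- Adding C completes q [N] to 1 + q [N] = [N] + q^N in both terms of X; `exchange` shows that
      -- the extra powers q^N sum to C again, with its two terms interchanged.
      q-fixed = +-cancelʳ C (q * X) X (begin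
        q * X + C
          ≈⟨ solve 7 (λ q s s′ I I′ a a′ → q :* (s′ :* I′ :* a :+ s :* I :* a′) :+ (s′ :* a :+ s :* a′) :=
               s′ :* (con 1 :+ q :* I′) :* a :+ s :* (con 1 :+ q :* I) :* a′) refl q s s′ I I′ (q ^ k) (q ^ k′) ⟩
        s′ * (1# + q * I′) * q ^ k + s * (1# + q * I) * q ^ k′
          ≈⟨ +-cong (*-congʳ (*-congˡ (int-suc q (2 ℕ.* k′ ℕ.+ 1)))) (*-congʳ (*-congˡ (int-suc q (2 ℕ.* k ℕ.+ 1)))) ⟨
        s′ * (I′ + e′) * q ^ k + s * (I + e) * q ^ k′
          ≈⟨ solve 8 (λ s s′ I I′ e e′ a a′ → s′ :* (I′ :+ e′) :* a :+ s :* (I :+ e) :* a′ :=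
               (s′ :* I′ :* a :+ s :* I :* a′) :+ (s :* e :* a′ :+ s′ :* e′ :* a)) refl s s′ I I′ e e′ (q ^ k) (q ^ k′) ⟩
        X + (s * e * q ^ k′ + s′ * e′ * q ^ k)
          ≈⟨ +-congˡ (+-cong (exchange k′ k (trans (reflexive (≡.cong (λ n → q ^ suc n) (ℕ.+-comm k′ k)))
               (trans qK (*-comm s s′)))) (exchange k k′ qK)) ⟩
        X + C ∎)
        where
        e = q ^ (2 ℕ.* k ℕ.+ 1)
        e′ = q ^ (2 ℕ.* k′ ℕ.+ 1)

      Q-fixed : Q ^ 1 * X ≈ X
      Q-fixed = trans (*-congʳ (*-identityʳ Q)) (^-fixed q-fixed 2)

    exponent : ℕ
    exponent = 2 ℕ.* α ℕ.* m ℕ.+ 1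

    gather : ∀ p k → q ^ (p ℕ.* exponent) * q ^ k * Q ^ (α ℕ.* k ℕ.* m) ≈ q ^ ((p ℕ.+ k) ℕ.* exponent)
    gather p k = begin
      q ^ (p ℕ.* exponent) * q ^ k * Q ^ (α ℕ.* k ℕ.* m)
        ≈⟨ *-cong (sym (^-homo-* q (p ℕ.* exponent) k)) (Q^≈ (α ℕ.* k ℕ.* m)) ⟩
      q ^ (p ℕ.* exponent ℕ.+ k) * q ^ (2 ℕ.* (α ℕ.* k ℕ.* m))
        ≈⟨ ^-homo-* q (p ℕ.* exponent ℕ.+ k) (2 ℕ.* (α ℕ.* k ℕ.* m)) ⟨
      q ^ (p ℕ.* exponent ℕ.+ k ℕ.+ 2 ℕ.* (α ℕ.* k ℕ.* m))
        ≡⟨ ≡.cong (q ^_) (NS.solve 4 (λ p k α m → let e = NS.con 2 NS.:* α NS.:* m NS.:+ NS.con 1 in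
             p NS.:* e NS.:+ k NS.:+ NS.con 2 NS.:* (α NS.:* k NS.:* m) NS.:= (p NS.:+ k) NS.:* e) ≡.refl p k α m) ⟩
      q ^ ((p ℕ.+ k) ℕ.* exponent) ∎

    W^m-reflection : ∀ k k′ → W k′ * Q ^ (α ℕ.* k) ≈ W k * Q ^ (α ℕ.* k′) →
      Q ^ (α ℕ.* k ℕ.* m) * W k′ ^ m ≈ Q ^ (α ℕ.* k′ ℕ.* m) * W k ^ m
    W^m-reflection k k′ eq = begin
      Q ^ (α ℕ.* k ℕ.* m) * W k′ ^ m      ≈⟨ *-congʳ (^-assocʳ Q (α ℕ.* k) m) ⟨
      (Q ^ (α ℕ.* k)) ^ m * W k′ ^ m      ≈⟨ *-comm _ _ ⟩
      W k′ ^ m * (Q ^ (α ℕ.* k)) ^ m      ≈⟨ ^-distrib-* _ _ m ⟨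
      (W k′ * Q ^ (α ℕ.* k)) ^ m          ≈⟨ ^-congˡ m eq ⟩
      (W k * Q ^ (α ℕ.* k′)) ^ m          ≈⟨ ^-distrib-* _ _ m ⟩
      W k ^ m * (Q ^ (α ℕ.* k′)) ^ m      ≈⟨ *-comm _ _ ⟩
      (Q ^ (α ℕ.* k′)) ^ m * W k ^ m      ≈⟨ *-congʳ (^-assocʳ Q (α ℕ.* k′) m) ⟩
      Q ^ (α ℕ.* k′ ℕ.* m) * W k ^ m      ∎

    -- The cancelled powers Q^(αkm), q^k and q^k′ are those the reflections of W^m and of the odd
    -- q-integers consume and produce. What is left over agrees by `gather`, because p + k = p′ +
    -- k′; in the application both are n - 1.
    core-reflection : ∀ p p′ k k′ → p ℕ.+ k ≡ p′ ℕ.+ k′ → q ^ suc (k ℕ.+ k′) ≈ sign k * sign k′ →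
      W k′ * Q ^ (α ℕ.* k) ≈ W k * Q ^ (α ℕ.* k′) →
      sign k′ * int q (2 ℕ.* k′ ℕ.+ 1) * q ^ (p′ ℕ.* exponent) * W k′ ^ m ≈
      - 1# * (sign k * int q (2 ℕ.* k ℕ.+ 1) * q ^ (p ℕ.* exponent) * W k ^ m)
    core-reflection p p′ k k′ p+k≡ qK eq = q^-cancel (α ℕ.* k ℕ.* m) (q^-regular k (q^-regular k′ (begin
      b′ * (b * (A * (s′ * y′ * w′)))
        ≈⟨ solve 6 (λ b′ b A s′ y′ w′ → b′ :* (b :* (A :* (s′ :* y′ :* w′))) := s′ :* b :* (y′ :* b′) :* (A :* w′))
             refl b′ b A s′ y′ w′ ⟩
      s′ * b * (y′ * b′) * (A * w′)
        ≈⟨ *-cong (*-congʳ (trans (odd-int-reflection k k′ qK) (sym (-1*x≈-x _)))) (W^m-reflection k k′ eq) ⟩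
      - 1# * (s * b′) * (y′ * b′) * (A′ * w)
        ≈⟨ solve 6 (λ M S y′ b′ A′ w → M :* S :* (y′ :* b′) :* (A′ :* w) := M :* S :* (y′ :* b′ :* A′) :* w)
             refl (- 1#) (s * b′) y′ b′ A′ w ⟩
      - 1# * (s * b′) * (y′ * b′ * A′) * w
        ≈⟨ *-congʳ (*-congˡ (trans (gather p′ k′) (trans (^-congʳ q (≡.cong (ℕ._* exponent) (≡.sym p+k≡))) (sym (gather p k))))) ⟩
      - 1# * (s * b′) * (y * b * A) * w
        ≈⟨ solve 7 (λ M s b′ b y A w → M :* (s :* b′) :* (y :* b :* A) :* w := b′ :* (b :* (A :* (M :* (s :* y :* w)))))
             refl (- 1#) s b′ b y A w ⟩
      b′ * (b * (A * (- 1# * (s * y * w)))) ∎)))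
      where
      s = sign k * int q (2 ℕ.* k ℕ.+ 1)
      s′ = sign k′ * int q (2 ℕ.* k′ ℕ.+ 1)
      b = q ^ k
      b′ = q ^ k′
      y = q ^ (p ℕ.* exponent)
      y′ = q ^ (p′ ℕ.* exponent)
      A = Q ^ (α ℕ.* k ℕ.* m)
      A′ = Q ^ (α ℕ.* k′ ℕ.* m)
      w = W k ^ m
      w′ = W k′ ^ m

    term : ℕ → ℕ → Carrier
    term n k = (- 1#) ^ k * int Q (k ℕ.* (k ℕ.+ 1)) ^ r * int q (2 ℕ.* k ℕ.+ 1)
             * q ^ ((n ℕ.∸ 1 ℕ.∸ k) ℕ.* (2 ℕ.* α ℕ.* m ℕ.+ 1)) * W k ^ m

    term≈0 : ∀ n k c → k ℕ.* (k ℕ.+ 1) ≡ c ℕ.* d → term n k ≈ 0#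
    term≈0 n k c eq = trans (*-congʳ (trans (*-congʳ (trans (*-congʳ (trans (*-congˡ int^r≈0) (zeroʳ _)))
      (zeroˡ _))) (zeroˡ _))) (zeroˡ _)
      where
      int^r≈0 : int Q (k ℕ.* (k ℕ.+ 1)) ^ r ≈ 0#
      int^r≈0 = trans (^-congˡ r (trans (reflexive (≡.cong (int Q) eq)) (int-multiple c))) (0^n r)

    -- k′(k′+1) - k(k+1) = (k′-k)(k+k′+1) is a multiple of d. To stay within natural numbers,
    -- k(k+k′+1) and k′(k+k′+1) are added to the two sides.
    int-k[k+1]-reflection : ∀ k k′ c → suc (k ℕ.+ k′) ≡ d ℕ.* c → int Q (k′ ℕ.* (k′ ℕ.+ 1)) ≈ int Q (k ℕ.* (k ℕ.+ 1))
    int-k[k+1]-reflection k k′ c eq = begin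
      int Q (k′ ℕ.* (k′ ℕ.+ 1))                          ≈⟨ int-shift (k′ ℕ.* (k′ ℕ.+ 1)) (k ℕ.* c) ⟨
      int Q (k′ ℕ.* (k′ ℕ.+ 1) ℕ.+ k ℕ.* c ℕ.* d)        ≡⟨ ≡.cong (int Q) exchanged ⟩
      int Q (k ℕ.* (k ℕ.+ 1) ℕ.+ k′ ℕ.* c ℕ.* d)         ≈⟨ int-shift (k ℕ.* (k ℕ.+ 1)) (k′ ℕ.* c) ⟩
      int Q (k ℕ.* (k ℕ.+ 1))                            ∎
      where
      multiple : ∀ k₀ → k₀ ℕ.* c ℕ.* d ≡ k₀ ℕ.* suc (k ℕ.+ k′)
      multiple k₀ = ≡.trans (ℕ.*-assoc k₀ c d) (≡.cong (k₀ ℕ.*_) (≡.trans (ℕ.*-comm c d) (≡.sym eq)))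
      exchanged : k′ ℕ.* (k′ ℕ.+ 1) ℕ.+ k ℕ.* c ℕ.* d ≡ k ℕ.* (k ℕ.+ 1) ℕ.+ k′ ℕ.* c ℕ.* d
      exchanged rewrite multiple k | multiple k′ = NS.solve 2 (λ k k′ →
        k′ NS.:* (k′ NS.:+ NS.con 1) NS.:+ k NS.:* (NS.con 1 NS.:+ (k NS.:+ k′)) NS.:=
        k NS.:* (k NS.:+ NS.con 1) NS.:+ k′ NS.:* (NS.con 1 NS.:+ (k NS.:+ k′))) ≡.refl k k′

    term-reflection : ∀ n k k′ c → .{{NonZero k}} → .{{NonZero k′}} → k ℕ.< n → k′ ℕ.< n →
      suc (k ℕ.+ k′) ≡ d ℕ.* (1 ℕ.+ 2 ℕ.* c) → Reflected k k′ → term n k′ ≈ - term n k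
    term-reflection n k k′ c k<n k′<n eq refl-k = begin
      sign k′ * J′ * I′ * y′ * w′
        ≈⟨ solve 5 (λ s J I y w → s :* J :* I :* y :* w := J :* (s :* I :* y :* w)) refl (sign k′) J′ I′ y′ w′ ⟩
      J′ * (sign k′ * I′ * y′ * w′)
        ≈⟨ *-cong (^-congˡ r (int-k[k+1]-reflection k k′ (1 ℕ.+ 2 ℕ.* c) eq))
             (core-reflection (n ℕ.∸ 1 ℕ.∸ k) (n ℕ.∸ 1 ℕ.∸ k′) k k′
               (≡.trans (ℕ.m∸n+n≡m (ℕ.<⇒≤pred k<n)) (≡.sym (ℕ.m∸n+n≡m (ℕ.<⇒≤pred k′<n))))
               (q^-reflected k k′ c eq) (W-reflection k k′ refl-k)) ⟩
      J * (- 1# * (sign k * I * y * w))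
        ≈⟨ solve 6 (λ M s J I y w → J :* (M :* (s :* I :* y :* w)) := M :* (s :* J :* I :* y :* w))
             refl (- 1#) (sign k) J I y w ⟩
      - 1# * (sign k * J * I * y * w)
        ≈⟨ -1*x≈-x _ ⟩
      - (sign k * J * I * y * w) ∎
      where
      J = int Q (k ℕ.* (k ℕ.+ 1)) ^ r
      J′ = int Q (k′ ℕ.* (k′ ℕ.+ 1)) ^ r
      I = int q (2 ℕ.* k ℕ.+ 1)
      I′ = int q (2 ℕ.* k′ ℕ.+ 1)
      y = q ^ ((n ℕ.∸ 1 ℕ.∸ k) ℕ.* exponent)
      y′ = q ^ ((n ℕ.∸ 1 ℕ.∸ k′) ℕ.* exponent)
      w = W k ^ m
      w′ = W k′ ^ m

    -- Reflection inside a single block makes k + k′ + 1 an odd multiple of d, as the sign in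
    -- `q^-reflected` demands.
    blk-complementary : ∀ s t t′ → Complementary t t′ → suc (blk s t ℕ.+ blk s t′) ≡ d ℕ.* (1 ℕ.+ 2 ℕ.* s)
    blk-complementary s t t′ eq = ≡.trans (≡.cong₂ (λ k k′ → suc (k ℕ.+ k′)) (blk≡ s t) (blk≡ s t′))
      (≡.trans (NS.solve 4 (λ t t′ s d → NS.con 1 NS.:+ (t NS.:+ s NS.:* d NS.:+ (t′ NS.:+ s NS.:* d)) NS.:=
          (NS.con 1 NS.:+ (t NS.:+ t′)) NS.:+ d NS.:* (NS.con 2 NS.:* s)) ≡.refl t t′ s d)
      (≡.trans (≡.cong (ℕ._+ d ℕ.* (2 ℕ.* s)) eq) (≡.sym (ℕ.*-suc d (2 ℕ.* s)))))

    blk-<  : ∀ {N s t} → s ℕ.< N → t ℕ.< d → blk s t ℕ.< N ℕ.* d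
    blk-< {N} {s} {t} s<N t<d = ≡.subst (ℕ._< N ℕ.* d) (≡.sym (blk≡ s t))
      (ℕ.<-≤-trans (ℕ.+-monoˡ-< (s ℕ.* d) t<d) (ℕ.*-monoˡ-≤ d s<N))

    term-first : ∀ n s → term n (blk s 0) ≈ 0#
    term-first n s = term≈0 n (blk s 0) (s ℕ.* (blk s 0 ℕ.+ 1))
      (≡.trans (≡.cong (ℕ._* (blk s 0 ℕ.+ 1)) (blk≡ s 0))
        (NS.solve 3 (λ s d k → s NS.:* d NS.:* k NS.:= s NS.:* k NS.:* d) ≡.refl s d (blk s 0 ℕ.+ 1)))

    term-last : ∀ n s t → suc t ≡ d → term n (blk s t) ≈ 0#
    term-last n s t eq = term≈0 n (blk s t) (blk s t ℕ.* suc s)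
      (≡.trans (≡.cong (blk s t ℕ.*_) end) (≡.sym (ℕ.*-assoc (blk s t) (suc s) d)))
      where
      end : blk s t ℕ.+ 1 ≡ suc s ℕ.* d
      end = ≡.trans (ℕ.+-comm (blk s t) 1) (≡.trans (≡.cong suc (blk≡ s t)) (≡.cong (ℕ._+ s ℕ.* d) eq))

    term-antisymmetric : ∀ N s t t′ → s ℕ.< N → Complementary t t′ →
      term (N ℕ.* d) (blk s t′) ≈ - term (N ℕ.* d) (blk s t)
    term-antisymmetric N s zero t′ s<N eq = trans (term-last (N ℕ.* d) s t′ eq)
      (sym (trans (-‿cong (term-first (N ℕ.* d) s)) -0#≈0#))
    term-antisymmetric N s (suc t) zero s<N eq = trans (term-first (N ℕ.* d) s)
      (sym (trans (-‿cong (term-last (N ℕ.* d) s (suc t) (≡.trans (≡.cong suc (≡.sym (ℕ.+-identityʳ (suc t)))) eq))) -0#≈0#))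
    term-antisymmetric N s (suc t) (suc t′) s<N eq =
      term-reflection (N ℕ.* d) (blk s (suc t)) (blk s (suc t′)) s {{nonZero t}} {{nonZero t′}}
        (blk-< s<N (ℕ.<-trans (ℕ.n<1+n _) (2+<d t′ t (complementary-sym (suc t) (suc t′) eq))))
        (blk-< s<N (ℕ.<-trans (ℕ.n<1+n _) (2+<d t t′ eq)))
        (blk-complementary s (suc t) (suc t′) eq)
        (λ i → narayana-reflection s {t} {t′} i eq)
      where
      nonZero : ∀ t → NonZero (blk s (suc t))
      nonZero t = ≡.subst NonZero (≡.sym (blk-suc s t)) _

    sum-term≈0 : ∀ N → sum< (N ℕ.* d) (term (N ℕ.* d)) ≈ 0#
    -- The argument 1 of `torsion-free` cancels the integer suc 1 = 2.
    sum-term≈0 N = sum<-blocks N d (term (N ℕ.* d)) λ s s<N → IsPrimitiveRoot.torsion-free prim 1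
      (trans (+-congˡ (+-identityʳ _)) (sum<-antisymmetric d (λ t → term (N ℕ.* d) (t ℕ.+ s ℕ.* d)) λ t t′ eq →
        ≡.subst₂ (λ k k′ → term (N ℕ.* d) k′ ≈ - term (N ℕ.* d) k) (blk≡ s t) (blk≡ s t′)
          (term-antisymmetric N s t t′ s<N eq)))

-- Integer polynomials with constant coefficient ±1

module IntegerPolynomials where

  open Polynomial ℤ.+-*-commutativeRing

  -- Degree data independent of the list, whose length can exceed the degree because of trailing
  -- zeros. Here a may be zero; the constructor `degree` excludes that.
  record Top (p : Poly) (m : ℕ) (a : ℤ) : Set where
    constructor top
    field
      leading : coeff p m ≡ a
      above   : ∀ i → m ℕ.< i → coeff p i ≡ + 0

  private
    coeff-·≡0 : ∀ a r i → coeff r i ≡ + 0 → coeff (a · r) i ≡ + 0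
    coeff-·≡0 a r i e = ≡.trans (coeff-· a r i) (≡.trans (≡.cong (a ℤ.*_) e) (ℤ.*-zeroʳ a))

    coeff-+≡ : ∀ p r i {a} → coeff p i ≡ + 0 → coeff r i ≡ a → coeff (p + r) i ≡ a
    coeff-+≡ p r i e f = ≡.trans (coeff-+ p r i) (≡.trans (≡.cong₂ ℤ._+_ e f) (ℤ.+-identityˡ _))

  top-* : ∀ p r {m l a b} → Top p m a → Top r l b → Top (p * r) (m ℕ.+ l) (a ℤ.* b)
  top-* [] r {b = b} (top ≡.refl _) _ = top ≡.refl (λ i _ → ≡.refl)
  top-* (a₀ ∷ p) r {zero} {l} {a} {b} (top ≡.refl above) (top r≡b r-above) = top
    (≡.trans (constant l) (≡.cong (a₀ ℤ.*_) r≡b))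
    (λ i l<i → ≡.trans (constant i) (≡.trans (≡.cong (a₀ ℤ.*_) (r-above i l<i)) (ℤ.*-zeroʳ a₀)))
    where
    p≋[] : p ≋ []
    p≋[] = mk≋ λ i → above (suc i) z<s
    constant : ∀ i → coeff ((a₀ ∷ p) * r) i ≡ a₀ ℤ.* coeff r i
    constant i = ≡.trans (≋-trans (+-cong (≋-refl {a₀ · r}) (≋-trans (∷-cong ≡.refl (*-cong p≋[] (≋-refl {r}))) (0∷[]≋[] ≡.refl)))
      (+-identityʳ (a₀ · r)) .at i) (coeff-· a₀ r i)
  top-* (a₀ ∷ p) r {suc m} {l} (top p≡a above) (top r≡b r-above) with top-* p r {m} {l}
    (top p≡a (λ i m<i → above (suc i) (s<s m<i))) (top r≡b r-above)
  ... | top pr≡ pr-above = top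
    (coeff-+≡ (a₀ · r) (+ 0 ∷ p * r) (suc (m ℕ.+ l)) (coeff-·≡0 a₀ r _ (r-above _ (s<s (ℕ.m≤n+m l m)))) pr≡)
    λ where (suc i) (s<s m+l<i) → coeff-+≡ (a₀ · r) (+ 0 ∷ p * r) (suc i)
              (coeff-·≡0 a₀ r (suc i) (r-above (suc i) (ℕ.≤-trans (s≤s (ℕ.m≤n+m l m)) (ℕ.m<n⇒m<1+n m+l<i))))
              (pr-above i m+l<i)

  data Degree (p : Poly) : Set where
    null   : p ≋ [] → Degree p
    degree : ∀ m {a} → a ≢ + 0 → Top p m a → Degree p

  toDegree : ∀ p → Degree p
  toDegree [] = null ≋-refl
  toDegree (a ∷ p) with toDegree p
  ... | degree m b≢0 (top p≡b above) = degree (suc m) b≢0 (top p≡b λ where (suc i) (s<s m<i) → above i m<i)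
  ... | null p≋[] with a ℤ.≟ + 0
  ...   | yes a≡0 = null (∷-tail a≡0 p≋[])
  ...   | no a≢0  = degree 0 a≢0 (top ≡.refl λ where (suc i) _ → p≋[] .at i)

  coeff-≥ : ∀ p i → length p ℕ.≤ i → coeff p i ≡ + 0
  coeff-≥ []      i       p≤i       = ≡.refl
  coeff-≥ (a ∷ p) (suc i) (s≤s p≤i) = coeff-≥ p i p≤i

  take-≋ : ∀ n p → (∀ i → n ℕ.≤ i → coeff p i ≡ + 0) → take n p ≋ p
  take-≋ zero    p       e = mk≋ λ i → ≡.sym (e i z≤n)
  take-≋ (suc n) []      e = ≋-refl
  take-≋ (suc n) (a ∷ p) e = ∷-cong ≡.refl (take-≋ n p λ i n≤i → e (suc i) (s≤s n≤i))

  length-take-≤ : ∀ n (p : Poly) → length (take n p) ℕ.≤ n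
  length-take-≤ zero    p       = z≤n
  length-take-≤ (suc n) []      = z≤n
  length-take-≤ (suc n) (a ∷ p) = s≤s (length-take-≤ n p)

  UnitConstant : Poly → Set
  UnitConstant p = coeff p 0 ℤ.* coeff p 0 ≡ + 1

  unitConstant-resp : ∀ {p r} → p ≋ r → UnitConstant p → UnitConstant r
  unitConstant-resp e u = ≡.trans (≡.cong₂ ℤ._*_ (≡.sym (e .at 0)) (≡.sym (e .at 0))) u

  private
    square-* : ∀ a b → (a ℤ.* b) ℤ.* (a ℤ.* b) ≡ (a ℤ.* a) ℤ.* (b ℤ.* b)
    square-* = NS.solve 2 (λ a b → (a NS.:* b) NS.:* (a NS.:* b) NS.:= (a NS.:* a) NS.:* (b NS.:* b)) ≡.refl
      where module NS = NatSolver ℤ.+-*-commutativeSemiring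

  unitConstant-* : ∀ p r → UnitConstant p → UnitConstant r → UnitConstant (p * r)
  unitConstant-* p r u v = ≡.trans (≡.cong₂ ℤ._*_ (coeff-*-0 p r) (coeff-*-0 p r))
    (≡.trans (square-* (coeff p 0) (coeff r 0)) (≡.cong₂ ℤ._*_ u v))

  unitConstant-factor : ∀ p r → UnitConstant r → UnitConstant (p * r) → UnitConstant p
  unitConstant-factor p r v w = ≡.trans (≡.sym (ℤ.*-identityʳ _)) (≡.trans (≡.cong (coeff p 0 ℤ.* coeff p 0 ℤ.*_) (≡.sym v))
    (≡.trans (≡.sym (square-* (coeff p 0) (coeff r 0))) (≡.trans
      (≡.sym (≡.cong₂ ℤ._*_ (coeff-*-0 p r) (coeff-*-0 p r))) w)))

  private
    unit-cancel : ∀ a b → b ℤ.* b ≡ + 1 → a ℤ.* b ℤ.* b ≡ a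
    unit-cancel a b u = ≡.trans (ℤ.*-assoc a b b) (≡.trans (≡.cong (a ℤ.*_) u) (ℤ.*-identityʳ a))

  -- Unlike in ÷-exact, c may have trailing zeros, which are cut off at its degree.
  ÷-exact′ : ∀ a b c → UnitConstant b → c * b ≋ a → a ÷ b ≋ c
  ÷-exact′ a b c u e with toDegree c
  ... | null c≋[] = ≋-trans
    (÷-exact ℤ.+-*-commutativeRing a b [] u z≤n (≋-trans (*-cong (≋-sym c≋[]) (≋-refl {b})) e)) (≋-sym c≋[])
  ... | degree m c≢0 c-top with toDegree b
  ...   | null b≋[] = contradiction (≡.trans (≡.sym u) (≡.cong₂ ℤ._*_ (b≋[] .at 0) (b≋[] .at 0))) λ ()
  ...   | degree l b≢0 b-top = ≋-trans
    (÷-exact ℤ.+-*-commutativeRing a b c′ u c′≤a (≋-trans (*-cong c′≋c (≋-refl {b})) e)) c′≋c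
    where
    c′ = take (suc m) c
    c′≋c : c′ ≋ c
    c′≋c = take-≋ (suc m) c (Top.above c-top)
    m+l<a : m ℕ.+ l ℕ.< length a
    -- The coefficient of a at m + l is the product of two nonzero leading coefficients, so the list
    -- a must reach beyond that index.
    m+l<a = ℕ.≰⇒> λ a≤m+l → ab≢0 (≡.trans (≡.sym (Top.leading (top-* c b c-top b-top)))
      (≡.trans (e .at (m ℕ.+ l)) (coeff-≥ a (m ℕ.+ l) a≤m+l)))
      where
      ab≢0 : _ ≢ + 0
      ab≢0 ab≡0 with ℤ.i*j≡0⇒i≡0∨j≡0 _ ab≡0
      ... | inj₁ a≡0 = c≢0 a≡0
      ... | inj₂ b≡0 = b≢0 b≡0
    c′≤a : length c′ ℕ.≤ length a
    c′≤a = ℕ.≤-trans (length-take-≤ (suc m) c) (ℕ.≤-trans (s≤s (ℕ.m≤m+n m l)) m+l<a)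

  -- Because the constant coefficient of b is ±1, that of p must vanish; one power of the variable
  -- is then split off and the argument repeats.
  unitConstant-regular : ∀ p b → UnitConstant b → p * b ≋ [] → p ≋ []
  unitConstant-regular []      b u e = ≋-refl
  unitConstant-regular (a ∷ p) b u e = ∷-tail a≡0 (unitConstant-regular p b u (tail-cong shifted))
    where
    a≡0 : a ≡ + 0
    a≡0 = ≡.trans (≡.sym (unit-cancel a (coeff b 0) u))
      (≡.cong (ℤ._* coeff b 0) (≡.trans (≡.sym (coeff-*-0 (a ∷ p) b)) (e .at 0)))
    shifted : + 0 ∷ p * b ≋ []
    shifted = ≋-trans (≋-sym (+-cong (·-zero b a≡0) (≋-refl {+ 0 ∷ p * b}))) e

  module Q = RingNotation ℤ[q]-ring
  open Mult Q.semiring using (_×_)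

  coeff-× : ∀ n p i → coeff (n × p) i ≡ + n ℤ.* coeff p i
  coeff-× zero    p i = ≡.sym (ℤ.*-zeroˡ (coeff p i))
  coeff-× (suc n) p i = ≡.trans (coeff-+ p (n × p) i) (≡.trans (≡.cong (λ a → coeff p i ℤ.+ a) (coeff-× n p i))
    (≡.sym (ℤ.suc-* (+ n) (coeff p i))))

  ×-torsion-free : ∀ n p → suc n × p ≋ [] → p ≋ []
  ×-torsion-free n p e = mk≋ λ i → ℤ.*-cancelˡ-≡ (+ suc n) _ _
    (≡.trans (≡.sym (coeff-× (suc n) p i)) (≡.trans (e .at i) (≡.sym (ℤ.*-zeroʳ (+ suc n)))))

  private
    open RingProperties ℤ.+-*-ring using (x[y-z]≈xy-xz; +-cancelˡ)

    coeff-tail : ∀ p i → coeff (tail p) i ≡ coeff p (suc i)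
    coeff-tail []      i = ≡.refl
    coeff-tail (a ∷ p) i = ≡.refl

    coeff-remainder : ∀ a k b i → coeff (tail (a + - (k · b))) i ≡ coeff a (suc i) ℤ.- k ℤ.* coeff b (suc i)
    coeff-remainder a k b i = ≡.trans (coeff-tail (a + - (k · b)) i) (≡.trans (coeff-+ a (- (k · b)) (suc i))
      (≡.cong (λ x → coeff a (suc i) ℤ.+ x) (≡.trans (coeff-neg (k · b) (suc i)) (≡.cong ℤ.-_ (coeff-· k b (suc i))))))

    coeff-∷-* : ∀ a p b i → coeff ((a ∷ p) * b) (suc i) ≡ a ℤ.* coeff b (suc i) ℤ.+ coeff (p * b) i
    coeff-∷-* a p b i = ≡.trans (coeff-+ (a · b) (+ 0 ∷ p * b) (suc i))
      (≡.cong (ℤ._+ coeff (p * b) i) (coeff-· a b (suc i)))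

    x+[z-x]≡z : ∀ x z → x ℤ.+ (z ℤ.- x) ≡ z
    x+[z-x]≡z x z = ≡.trans (≡.cong (λ y → x ℤ.+ y) (ℤ.+-comm z (ℤ.- x))) (≡.trans (≡.sym (ℤ.+-assoc x (ℤ.- x) z))
      (≡.trans (≡.cong (ℤ._+ z) (ℤ.+-inverseʳ x)) (ℤ.+-identityˡ z)))

    y≡z-x : ∀ x y z → x ℤ.+ y ≡ z → y ≡ z ℤ.- x
    y≡z-x x y z e = +-cancelˡ x y (z ℤ.- x) (≡.trans e (≡.sym (x+[z-x]≡z x z)))

  -- The quotient is read off from the constant coefficient upwards: its constant coefficient is
  -- coeff a 0 * coeff b 0.
  unitConstant-torsion-free : ∀ n b → UnitConstant b → ∀ c a → c * b ≋ suc n × a → b Q.∣ a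
  unitConstant-torsion-free n b u [] a e = [] , ≋-sym (×-torsion-free n a (≋-sym e))
  unitConstant-torsion-free n b u (c₀ ∷ c) a e with unitConstant-torsion-free n b u c r (mk≋ λ i →
    ≡.trans (cb≡ i) (≡.trans (remainder i) (≡.sym (≡.trans (coeff-× (suc n) r i) (≡.cong (N ℤ.*_) (coeff-remainder a k b i))))))
    where
    N = + suc n
    k = coeff a 0 ℤ.* coeff b 0
    r = tail (a + - (k · b))
    c₀≡Nk : c₀ ≡ N ℤ.* k
    c₀≡Nk = ≡.trans (≡.sym (unit-cancel c₀ (coeff b 0) u)) (≡.trans (≡.cong (ℤ._* coeff b 0)
      (≡.trans (≡.sym (coeff-*-0 (c₀ ∷ c) b)) (≡.trans (e .at 0) (coeff-× (suc n) a 0)))) (ℤ.*-assoc N (coeff a 0) (coeff b 0)))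
    cb≡ : ∀ i → coeff (c * b) i ≡ N ℤ.* coeff a (suc i) ℤ.- c₀ ℤ.* coeff b (suc i)
    cb≡ i = y≡z-x _ _ _ (≡.trans (≡.sym (coeff-∷-* c₀ c b i)) (≡.trans (e .at (suc i)) (coeff-× (suc n) a (suc i))))
    remainder : ∀ i → N ℤ.* coeff a (suc i) ℤ.- c₀ ℤ.* coeff b (suc i) ≡ N ℤ.* (coeff a (suc i) ℤ.- k ℤ.* coeff b (suc i))
    remainder i = ≡.trans (≡.cong (λ x → N ℤ.* coeff a (suc i) ℤ.- x)
      (≡.trans (≡.cong (ℤ._* coeff b (suc i)) c₀≡Nk) (ℤ.*-assoc N k (coeff b (suc i)))))
      (≡.sym (x[y-z]≈xy-xz N (coeff a (suc i)) (k ℤ.* coeff b (suc i))))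
  ... | l , lb≋r = (k ∷ l) , mk≋ λ where
        zero → ≡.trans (coeff-*-0 (k ∷ l) b) (unit-cancel (coeff a 0) (coeff b 0) u)
        (suc i) → ≡.trans (coeff-∷-* k l b i) (≡.trans
          (≡.cong (λ x → k ℤ.* coeff b (suc i) ℤ.+ x) (≡.trans (lb≋r .at i) (coeff-remainder a k b i)))
          (x+[z-x]≡z (k ℤ.* coeff b (suc i)) (coeff a (suc i))))
    where
    k = coeff a 0 ℤ.* coeff b 0

  open FiniteProducts ℤ[q]-ring using (prod)

  unitConstant-prod : ∀ n f → (∀ i → i ℕ.< n → UnitConstant (f i)) → UnitConstant (prod n f)
  unitConstant-prod zero    f u = ≡.refl
  unitConstant-prod (suc n) f u = unitConstant-* (f 0) (prod n (f ∘ suc)) (u 0 z<s)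
    (unitConstant-prod n (f ∘ suc) (λ i i<n → u (suc i) (s<s i<n)))

-- Cyclotomic polynomials from their recursion

module CyclotomicPolynomials where

  open RingNotation ℤ[q]-ring hiding (zero)
  open FiniteProducts ℤ[q]-ring
  open QAnalogues ℤ[q]-ring
  open CoprimeFactors ℤ[q]-ring
  open IntegerPolynomials using (UnitConstant; unitConstant-resp; unitConstant-factor; unitConstant-prod;
    unitConstant-regular; unitConstant-torsion-free; ÷-exact′)
  open Polynomial ℤ.+-*-commutativeRing using (coeff-+; X-*; at; _÷_)
  open RingProperties ring using (x∙y⁻¹≈ε⇒x≈y; [y-z]x≈yx-zx)
  open SetoidReasoning setoid

  unitConstant-q^-1 : ∀ d → .{{NonZero d}} → UnitConstant (q ^ d - 1#)
  unitConstant-q^-1 (suc d) = ≡.cong (λ a → a ℤ.* a) (≡.trans (coeff-+ (q ^ suc d) (- 1#) 0)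
    (≡.cong (ℤ._+ -[1+ 0 ]) (X-* (q ^ d) .at 0)))

  cancel : ∀ {a b p} → UnitConstant p → a * p ≈ b * p → a ≈ b
  cancel {a} {b} {p} u e = x∙y⁻¹≈ε⇒x≈y a b (unitConstant-regular (a - b) p u
    (trans ([y-z]x≈yx-zx p a b) (trans (+-congʳ e) (-‿inverseʳ (b * p)))))

  -- Φ is abstract here because its well-founded recursion must not be unfolded.
  module Recursive (Φ : ℕ → ℤ[q])
    (Φ-unfold : ∀ d → Φ d ≡ (q ^ d - 1#) ÷ (∏[ e < d ] (Φ (toℕ e) when (toℕ e ∣? d)))) where

    Φ-at : ℕ → ℕ → ℤ[q]
    Φ-at n e = Φ e when (e ∣? n)

    divisor : ℕ → ℤ[q]
    divisor d = prod d (Φ-at d)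

    -- The three facts need a joint recursion: exactness of the division for d uses that the earlier
    -- Φ_e are pairwise coprime, which comes from `root` for them, and `root` for d comes from
    -- `product` and `unit`.
    record IsCyclotomic (d : ℕ) : Set where
      field
        unit    : UnitConstant (Φ d)
        product : Φ d * divisor d ≈ q ^ d - 1#
        root    : IsPrimitiveRoot (ℤ[q]-ring / Φ d) q d
    open IsCyclotomic

    CyclotomicBelow : ℕ → Set
    CyclotomicBelow d = ∀ e → e ℕ.< d → NonZero e → IsCyclotomic e

    ∣-nonZero : ∀ {e n} → .{{NonZero n}} → e ℕ.∣ n → NonZero e
    ∣-nonZero {zero}  {n} 0∣n = contradiction (ℕ.0∣⇒≡0 0∣n) (ℕ.≢-nonZero⁻¹ n)
    ∣-nonZero {suc e}     _   = _

    Φ-at-factor : ∀ n e → .{{NonZero n}} → (NonZero e → IsCyclotomic e) → Factor ℤ[q]-ring q e (Φ-at n e)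
    Φ-at-factor n e isCyclotomic = when-factor (e ∣? n) {q} {e} {Φ e} λ e∣n →
      cyclotomic (Φ e) refl (∣-nonZero e∣n) (root (isCyclotomic (∣-nonZero e∣n)))

    unitConstant-when : ∀ {P : Set} (P? : Dec P) {a} → (P → UnitConstant a) → UnitConstant (a when P?)
    unitConstant-when (yes p) u = u p
    unitConstant-when (no _)  u = ≡.refl

    divisor-∣ : ∀ d → .{{NonZero d}} → CyclotomicBelow d → divisor d ∣ q ^ d - 1#
    divisor-∣ d below = prod-factors-∣ d {q} (Φ-at d)
      (λ e e<d → Φ-at-factor d e (below e e<d))
      (λ e e<d → when-∣ (e ∣? d) {Φ e} {q ^ d - 1#} λ e∣d →
        ModuloFactor.root-∣ ℤ[q]-ring q (Φ e) (root (below e e<d (∣-nonZero e∣d))) e∣d)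

    Φ-∣-divisor : ∀ d e → e ℕ.< d → e ℕ.∣ d → Φ e ∣ divisor d
    Φ-∣-divisor d e e<d e∣d = let (k , eq) = factor-∣-prod d (Φ-at d) e e<d in
      k , trans (*-congˡ {k} (sym (when-yes {a = Φ e} (e ∣? d) e∣d))) eq

    prod-Φ-at : ∀ g → IsCyclotomic g → prod (suc g) (Φ-at g) ≈ q ^ g - 1#
    prod-Φ-at g cyc-g = begin
      prod (suc g) (Φ-at g)     ≈⟨ prod-suc g (Φ-at g) ⟩
      divisor g * Φ-at g g      ≈⟨ *-congˡ {divisor g} (when-yes {a = Φ g} (g ∣? g) ℕ.∣-refl) ⟩
      divisor g * Φ g           ≈⟨ *-comm (divisor g) (Φ g) ⟩
      Φ g * divisor g           ≈⟨ product cyc-g ⟩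
      q ^ g - 1#                ∎

    -- q^g - 1 is the product of Φ_e over e dividing g. These are pairwise coprime, and each occurs
    -- among the factors of `divisor d`, since e divides d and e ≤ g < d.
    q^g-1-∣-divisor : ∀ d g → .{{NonZero d}} → .{{NonZero g}} → CyclotomicBelow d → g ℕ.∣ d → g ℕ.< d →
      IsCyclotomic g → q ^ g - 1# ∣ divisor d
    q^g-1-∣-divisor d g below g∣d g<d cyc-g = k , trans (*-congˡ {k} (sym (prod-Φ-at g cyc-g))) eq
      where
      e<d : ∀ e → e ℕ.< suc g → e ℕ.< d
      e<d e e≤g = ℕ.≤-<-trans (ℕ.s≤s⁻¹ e≤g) g<d
      whole-∣ : prod (suc g) (Φ-at g) ∣ divisor d
      whole-∣ = prod-factors-∣ (suc g) {q} (Φ-at g)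
        (λ e e≤g → Φ-at-factor g e (below e (e<d e e≤g)))
        (λ e e≤g → when-∣ (e ∣? g) {Φ e} {divisor d} λ e∣g → Φ-∣-divisor d e (e<d e e≤g) (ℕ.∣-trans e∣g g∣d))
      open Algebra.Definitions.RawMagma._∣ʳ_ whole-∣ using () renaming (quotient to k; equality to eq)

    module _ (d : ℕ) .{{d≢0 : NonZero d}} (below : CyclotomicBelow d) where

      unit-divisor : UnitConstant (divisor d)
      unit-divisor = unitConstant-prod d (Φ-at d) λ e e<d →
        unitConstant-when (e ∣? d) {Φ e} λ e∣d → unit (below e e<d (∣-nonZero e∣d))

      Φ*divisor : Φ d * divisor d ≈ q ^ d - 1#
      Φ*divisor = let (c , eq) = divisor-∣ d below in
        trans (*-congʳ {divisor d} {Φ d} {c} (trans (reflexive (Φ-unfold d))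
          (÷-exact′ (q ^ d - 1#) (divisor d) c unit-divisor eq))) eq

      unit-Φ : UnitConstant (Φ d)
      unit-Φ = unitConstant-factor (Φ d) (divisor d) unit-divisor
        (unitConstant-resp {q ^ d - 1#} {Φ d * divisor d} (sym Φ*divisor) (unitConstant-q^-1 d))

      Φ-geometric : ∀ c g → 1 ℕ.< c → d ≡ c ℕ.* g → Φ d ∣ int (q ^ g) c
      Φ-geometric c g 1<c d≡cg = ModuloFactor.geometric-∣ ℤ[q]-ring q (Φ d) {d} {c} {g} {divisor d} Φ*divisor d≡cg
        (q^g-1-∣-divisor d g {{d≢0}} {{g≢0}} below g∣d g<d (below g g<d g≢0))
        (λ {a} {b} → cancel {a} {b} {q ^ g - 1#} (unitConstant-q^-1 g {{g≢0}}))
        where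
        g∣d : g ℕ.∣ d
        g∣d = ℕ.divides c d≡cg
        g≢0 : NonZero g
        g≢0 = ∣-nonZero g∣d
        g<d : g ℕ.< d
        g<d = ≡.subst (g ℕ.<_) (≡.trans (ℕ.*-comm g c) (≡.sym d≡cg)) (ℕ.m<m*n g c {{g≢0}} 1<c)

      Φ-torsion-free : Quotient.TorsionFree ℤ[q]-ring (Φ d)
      Φ-torsion-free n {b} (k , e) = unitConstant-torsion-free n (Φ d) unit-Φ k b e

      isCyclotomic-step : IsCyclotomic d
      isCyclotomic-step = record
        { unit    = unit-Φ
        ; product = Φ*divisor
        ; root    = ModuloFactor.toPrimitiveRoot ℤ[q]-ring q (Φ d) d
            (divisor d , trans (*-comm (divisor d) (Φ d)) Φ*divisor) Φ-geometric Φ-torsion-free }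

    isCyclotomic : ∀ d → NonZero d → IsCyclotomic d
    isCyclotomic = <-rec (λ d → NonZero d → IsCyclotomic d) λ d IH d≢0 → isCyclotomic-step d {{d≢0}} (λ e e<d e≢0 → IH e<d e≢0)

-- Transport of primitive roots, parity, and torsion in extensions

-- `power` and `geometric` are equations and survive any ring homomorphism. Torsion-freeness is not
-- inherited by the target, so it is supplied for `h f`.
root-transport : ∀ {a ℓ₁ b ℓ₂} (R : CommutativeRing a ℓ₁) (S : CommutativeRing b ℓ₂)
  (let module R = CommutativeRing R; module S = CommutativeRing S) (h : R.Carrier → S.Carrier) →
  IsRingHomomorphism R.rawRing S.rawRing h → ∀ {f t t′ d} → h t S.≈ t′ → Quotient.TorsionFree S (h f) →
  IsPrimitiveRoot (R / f) t d → IsPrimitiveRoot (S / h f) t′ d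
root-transport R S h h-hom {f} {t} {t′} {d} ht≈t′ tf prim = record
  { power        = S/.trans (S/.sym (H.^-homo ht≈/t′ d)) (S/.trans (h-cong/ prim.power) (QS.≈⇒≈/ 1#-homo))
  ; geometric    = λ c g 1<c d≡cg → S/.trans (S/.sym (H.int-homo (H.^-homo ht≈/t′ g) c))
                     (S/.trans (h-cong/ (prim.geometric c g 1<c d≡cg)) (QS.≈⇒≈/ 0#-homo))
  ; torsion-free = ModuloFactor.torsion-free/ S t′ (h f) tf }
  where
  module S = CommutativeRing S
  module S/ = CommutativeRing (S / h f)
  module QR = Quotient R f
  module QS = Quotient S (h f)
  module prim = IsPrimitiveRoot prim
  open IsRingHomomorphism h-hom renaming (⟦⟧-cong to h-cong)
  h-cong/ : ∀ {x y} → x QR.≈/ y → h x QS.≈/ h y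
  h-cong/ (QR.mk≈/ k e) = QS.mk≈/ (h k) (S.trans (h-cong e) (S.trans (+-homo _ _) (S.+-congˡ (*-homo k f))))
  module H = RingMorphism (R / f) (S / h f) h (ringHomomorphism (R / f) (S / h f) h h-cong/
    (λ x y → QS.≈⇒≈/ (+-homo x y)) (λ x y → QS.≈⇒≈/ (*-homo x y)) (QS.≈⇒≈/ 1#-homo))
  ht≈/t′ : h t QS.≈/ t′
  ht≈/t′ = QS.≈⇒≈/ ht≈t′

module Parity {c ℓ : Level} (K : CommutativeRing c ℓ) where

  open RingNotation K hiding (zero)
  open Exp commutativeSemiring using (^-distrib-*)
  open QAnalogues K
  open RingProperties ring using (-1*x≈-x; -‿involutive; +-cancelʳ; +-inverseʳ-unique)
  open SetoidReasoning setoid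

  -- Put v = t^(2g). From v^c = 1 the sum `int v c` is fixed by v, so `regular` makes it zero unless
  -- d = c g divides 2g. That would force c = 2 and d even.
  square-root : ∀ {t d} → .{{NonZero d}} → ¬ (2 ℕ.∣ d) → IsPrimitiveRoot K t d → IsPrimitiveRoot K (t ^ 2) d
  square-root {t} {d} 2∤d prim = record
    { power        = t²^d≈1
    ; geometric    = geometric′
    ; torsion-free = torsion-free }
    where
    open IsPrimitiveRoot prim
    open PrimitiveRoot prim using (regular)

    t²^d≈1 : (t ^ 2) ^ d ≈ 1#
    t²^d≈1 = trans (^-assocʳ t 2 d) (trans (^-congʳ t (ℕ.*-comm 2 d)) (^≈1 d power 2))

    geometric′ : ∀ c g → 1 ℕ.< c → d ≡ c ℕ.* g → int ((t ^ 2) ^ g) c ≈ 0#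
    geometric′ c g 1<c d≡cg = regular {j = 2 ℕ.* g} d∤2g (trans (*-congʳ (sym (^-assocʳ t 2 g))) fixed)
      where
      v = (t ^ 2) ^ g
      instance
        g≢0 : NonZero g
        g≢0 = ℕ.m*n≢0⇒n≢0 c {{≡.subst NonZero d≡cg (ℕ.≢-nonZero (ℕ.≢-nonZero⁻¹ d))}}
      v^c≈1 : v ^ c ≈ 1#
      v^c≈1 = trans (^-assocʳ (t ^ 2) g c) (trans (^-congʳ (t ^ 2) (≡.trans (ℕ.*-comm g c) (≡.sym d≡cg))) t²^d≈1)
      fixed : v * int v c ≈ int v c
      fixed = +-cancelʳ 1# _ _ (trans (+-comm _ 1#) (trans (sym (int-suc v c)) (+-congˡ v^c≈1)))
      d∤2g : ¬ (d ℕ.∣ 2 ℕ.* g)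
      d∤2g d∣2g = 2∤d (ℕ.divides g (≡.trans d≡cg (≡.trans (ℕ.*-comm c g) (≡.cong (g ℕ.*_) c≡2))))
        where
        c∣2 : c ℕ.∣ 2
        c∣2 = ℕ.*-cancelʳ-∣ g (≡.subst (ℕ._∣ 2 ℕ.* g) d≡cg d∣2g)
        c≡2 : c ≡ 2
        c≡2 = ℕ.≤-antisym (ℕ.∣⇒≤ c∣2) 1<c

  -1^2 : (- 1#) ^ 2 ≈ 1#
  -1^2 = trans (*-congˡ (*-identityʳ _)) (trans (-1*x≈-x (- 1#)) (-‿involutive 1#))

  neg-^ : ∀ t n → (- t) ^ n ≈ (- 1#) ^ n * t ^ n
  neg-^ t n = trans (^-congˡ n (sym (-1*x≈-x t))) (^-distrib-* (- 1#) t n)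

  odd-root-neg : ∀ {t d} → ¬ (2 ℕ.∣ d) → IsPrimitiveRoot K t d → (- t) ^ d ≈ - 1#
  odd-root-neg {t} {d} 2∤d prim = trans (neg-^ t d) (trans (*-cong (odd d 2∤d) (IsPrimitiveRoot.power prim)) (*-identityʳ _))
    where
    odd : ∀ n → ¬ (2 ℕ.∣ n) → (- 1#) ^ n ≈ - 1#
    odd zero          2∤n = contradiction (2 ℕ.∣0) 2∤n
    odd (suc zero)    2∤n = *-identityʳ _
    odd (suc (suc n)) 2∤n = trans
      (trans (sym (*-assoc _ _ _)) (trans (*-congʳ (trans (*-congˡ (sym (*-identityʳ _))) -1^2)) (*-identityˡ _)))
      (odd n λ 2∣n → 2∤n (ℕ.∣m∣n⇒∣m+n ℕ.∣-refl 2∣n))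

  -- For d = 2g the geometric condition with two summands reads 1 + (t²)^g = 0, that is t^d = -1,
  -- and (-1)^d = 1.
  even-root-neg : ∀ {t d} → 2 ℕ.∣ d → IsPrimitiveRoot K (t ^ 2) d → (- t) ^ d ≈ - 1#
  even-root-neg {t} {d} 2∣d@(ℕ.divides g d≡g2) prim = begin
    (- t) ^ d                ≈⟨ neg-^ t d ⟩
    (- 1#) ^ d * t ^ d       ≈⟨ *-congʳ (trans (^-congʳ (- 1#) d≡2g) (^≈1 2 -1^2 g)) ⟩
    1# * t ^ d               ≈⟨ *-identityˡ _ ⟩
    t ^ d                    ≈⟨ +-inverseʳ-unique 1# (t ^ d) 1+t^d≈0 ⟩
    - 1#                     ∎
    where
    open IsPrimitiveRoot prim
    d≡2g : d ≡ 2 ℕ.* g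
    d≡2g = ≡.trans d≡g2 (ℕ.*-comm g 2)
    1+t^d≈0 : 1# + t ^ d ≈ 0#
    1+t^d≈0 = begin
      1# + t ^ d                          ≈⟨ +-congˡ (trans (^-congʳ t d≡2g) (sym (^-assocʳ t 2 g))) ⟩
      1# + (t ^ 2) ^ g                    ≈⟨ +-congˡ (trans (*-congˡ (int-1 _)) (*-identityʳ _)) ⟨
      1# + (t ^ 2) ^ g * int ((t ^ 2) ^ g) 1  ≈⟨ geometric 2 g (s<s z<s) d≡2g ⟩
      0#                                  ∎

module PolynomialTorsion {c ℓ : Level} (R : CommutativeRing c ℓ) where

  open Polynomial R
  private
    module R = RingNotation R
    module RM = Mult R.semiring
    module P = RingNotation commutativeRing
    module PM = Mult P.semiring

  C-hom : IsRingHomomorphism R.rawRing P.rawRing C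
  C-hom = ringHomomorphism R commutativeRing C (λ e → ∷-cong e ≋-refl) (λ _ _ → ≋-refl)
    (λ a b → ∷-cong (R.sym (R.+-identityʳ _)) ≋-refl) ≋-refl

  coeff-× : ∀ n p i → coeff (n PM.× p) i R.≈ n RM.× coeff p i
  coeff-× zero    p i = R.refl
  coeff-× (suc n) p i = R.trans (coeff-+ p (n PM.× p) i) (R.+-congˡ (coeff-× n p i))

  coeffs-∣ : ∀ f p → (∀ i → f R.∣ coeff p i) → C f P.∣ p
  coeffs-∣ f []      f∣ = [] , ≋-refl
  coeffs-∣ f (a ∷ p) f∣ = let (k , kf≈a) = f∣ 0 ; (ks , e) = coeffs-∣ f p (λ i → f∣ (suc i)) in
    (k ∷ ks) , ∷-cong (R.trans (R.+-identityʳ _) kf≈a) e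

  -- Multiplication by a constant polynomial acts on each coefficient, so the property is inherited
  -- coefficientwise.
  C-torsion-free : ∀ {f} → Quotient.TorsionFree R f → Quotient.TorsionFree commutativeRing (C f)
  C-torsion-free {f} tf n {p} (c , e) = coeffs-∣ f p λ i → tf n (coeff c i , R.trans (R.*-comm _ f)
    (R.trans (R.sym (R.trans (P.trans (*-comm c (C f)) (C-* f c) .at i) (coeff-· f c i)))
      (R.trans (e .at i) (coeff-× (suc n) p i))))

module LocalisationTorsion {c ℓ : Level} (R : CommutativeRing c ℓ) (t : CommutativeRing.Carrier R)
  (t-cancel : ∀ {a b} → CommutativeRing._≈_ R (CommutativeRing._*_ R t a) (CommutativeRing._*_ R t b)
                      → CommutativeRing._≈_ R a b) where

  open Localisation R t t-cancel
  private
    module R = RingNotation R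
    module RM = Mult R.semiring
    module L = RingNotation commutativeRing
    module LM = Mult L.semiring
    open NatSolver R.commutativeSemiring using (solve; _:=_; _:+_; _:*_; con)

  fromBase-hom : IsRingHomomorphism R.rawRing L.rawRing fromBase
  fromBase-hom = ringHomomorphism R commutativeRing fromBase
    (λ e → mk≃ (R.*-congˡ e))
    (λ x y → mk≃ (R.*-congˡ (solve 2 (λ x y → x :+ y := con 1 :* x :+ con 1 :* y) R.refl x y)))
    (λ x y → ≃-refl) ≃-refl

  module FromBase = RingMorphism R commutativeRing fromBase fromBase-hom

  -- Iterated addition of fractions also multiplies their denominators, so the two sides are
  -- different representatives. Multiplication by the integer n, a fraction with denominator 1,
  -- connects them.
  ×-num : ∀ n b m → n LM.× (b /t^ m) ≃ (n RM.× b) /t^ m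
  ×-num n b m = begin
    n LM.× (b /t^ m)                        ≈⟨ LM.×-congʳ n (L.*-identityˡ (b /t^ m)) ⟨
    n LM.× (1# * (b /t^ m))                 ≈⟨ LM.×-assoc-* n 1# (b /t^ m) ⟨
    (n LM.× 1#) * (b /t^ m)                 ≈⟨ L.*-congʳ (FromBase.×-homo n R.1#) ⟨
    fromBase (n RM.× R.1#) * (b /t^ m)      ≈⟨ mk≃ (R.*-congˡ (R.trans (RM.×-assoc-* n R.1# b) (RM.×-congʳ n (R.*-identityˡ b)))) ⟩
    (n RM.× b) /t^ m                        ∎
    where open SetoidReasoning L.setoid

  -- Clearing denominators shows that f divides an integer multiple of t^k′ b in R; the integer is
  -- cancelled there, and dividing by t^(k′+m) returns to b / t^m.
  fromBase-torsion-free : ∀ {f} → Quotient.TorsionFree R f → Quotient.TorsionFree commutativeRing (fromBase f)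
  fromBase-torsion-free {f} tf n {b /t^ m} ((c /t^ k) , e) =
    (l /t^ (k′ ℕ.+ m)) , mk≃ (begin
      t R.^ m R.* (l R.* f)                       ≈⟨ R.*-congˡ lf≈ ⟩
      t R.^ m R.* (t R.^ k′ R.* b)                ≈⟨ solve 3 (λ x y b → x :* (y :* b) := y :* x :* b) R.refl _ _ b ⟩
      t R.^ k′ R.* t R.^ m R.* b                  ≈⟨ R.*-congʳ (R.^-homo-* t k′ m) ⟨
      t R.^ (k′ ℕ.+ m) R.* b                      ≡⟨ ≡.cong (λ n → t R.^ n R.* b) (ℕ.+-identityʳ (k′ ℕ.+ m)) ⟨
      t R.^ (k′ ℕ.+ m ℕ.+ 0) R.* b                ∎)
    where
    open SetoidReasoning R.setoid
    -- Denominator exponents add under multiplication, and `fromBase f` contributes the 0.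
    k′ = k ℕ.+ 0
    cf≃ : (c R.* f) /t^ k′ ≃ (suc n RM.× b) /t^ m
    cf≃ = ≃-trans e (×-num (suc n) b m)
    divisible : f R.∣ (suc n RM.× (t R.^ k′ R.* b))
    divisible = t R.^ m R.* c , (begin
      t R.^ m R.* c R.* f                         ≈⟨ R.*-assoc _ c f ⟩
      t R.^ m R.* (c R.* f)                       ≈⟨ cf≃ .cross ⟩
      t R.^ k′ R.* (suc n RM.× b)                 ≈⟨ RM.×-comm-* (suc n) (t R.^ k′) b ⟩
      suc n RM.× (t R.^ k′ R.* b)                 ∎)
    open Algebra.Definitions.RawMagma._∣ʳ_ (tf n divisible) using () renaming (quotient to l; equality to lf≈)

-- From vanishing modulo each factor to divisibility by the product

module SumDivisibility {c ℓ : Level} (R : CommutativeRing c ℓ) (q x : CommutativeRing.Carrier R) where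

  open RingNotation R hiding (zero)
  open QAnalogues R
  open FiniteSums R using (sum<)
  open FiniteProducts R
  open CoprimeFactors R
  open Divisibility semiring using (∣-respˡ-≈)
  open Σ using (_×_)

  module Summands (α m r : ℕ) .{{_ : NonZero α}} .{{_ : NonZero r}} (unit : ℕ → ℕ → Carrier) (scale : ℕ → Carrier)
    (unit-* : ∀ k i → unit k i * (q ^ 2) ^ (α ℕ.* (suc k ℕ.* i)) ≈ scale i) where

    W : ℕ → Carrier
    W k = sum< k (λ i → unit k i * narayana (q ^ 2) k i ^ α * x ^ i)

    term : ℕ → ℕ → Carrier
    term n k = (- 1#) ^ k * int (q ^ 2) (k ℕ.* (k ℕ.+ 1)) ^ r * int q (2 ℕ.* k ℕ.+ 1)
             * q ^ ((n ℕ.∸ 1 ℕ.∸ k) ℕ.* (2 ℕ.* α ℕ.* m ℕ.+ 1)) * W k ^ m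

    -- Powers, q-integers and sums of R and of `R / f` belong to different ring structures and are
    -- matched by `Projection`. The sum in `R / f` vanishes because n = N d consists of whole
    -- blocks.
    root-∣-sum : ∀ {f d n} → 1 ℕ.< d → d ℕ.∣ n → IsPrimitiveRoot (R / f) (q ^ 2) d →
      (let module K = RingNotation (R / f) in (- q) K.^ d K.≈ - 1#) → f ∣ sum< n (term n)
    root-∣-sum {f} {d@(suc d-1)} {n} 1<d (ℕ.divides N ≡.refl) prim -q^d≈-1 =
      ≈/0⇒∣ (K.trans (Projection.sum-homo n {term n ∘ toℕ} {S.term n ∘ toℕ} (λ i → term≈ (toℕ i))) (S.sum-term≈0 N))
      where
      open Quotient R f
      module K = RingNotation (R / f)
      module KQ = QAnalogues (R / f)
      module S = AlternatingSum.Vanishing (R / f) q x d-1 1<d prim -q^d≈-1 α m r unit scale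
        (λ k i → K.trans (K.*-congˡ (K.sym (Projection.^-homo K.refl (α ℕ.* (suc k ℕ.* i))))) (≈⇒≈/ (unit-* k i)))
      W≈ : ∀ k → W k K.≈ S.W k
      W≈ k = Projection.sum-homo k (λ i → K.*-cong (K.*-congˡ (Projection.^-homo (Projection.narayana-homo K.refl k (toℕ i)) α))
        (Projection.^-homo K.refl (toℕ i)))
      term≈ : ∀ k → term n k K.≈ S.term n k
      term≈ k = K.*-cong (K.*-cong (K.*-cong (K.*-cong (Projection.^-homo K.refl k)
        (Projection.^-homo (Projection.int-homo K.refl (k ℕ.* (k ℕ.+ 1))) r))
        (Projection.int-homo K.refl (2 ℕ.* k ℕ.+ 1)))
        (Projection.^-homo K.refl ((n ℕ.∸ 1 ℕ.∸ k) ℕ.* (2 ℕ.* α ℕ.* m ℕ.+ 1))))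
        (Projection.^-homo (W≈ k) m)

    module _ (A B : ℕ → Carrier)
      (A-root : ∀ d → NonZero d → IsPrimitiveRoot (R / A d) q d)
      (B-root : ∀ d → NonZero d → IsPrimitiveRoot (R / B d) (q ^ 2) d)
      (n : ℕ) where

      private
        S : Carrier
        S = sum< n (term n)

        1<d⇒nonZero : ∀ {d} → 1 ℕ.< d → NonZero d
        1<d⇒nonZero (s≤s _) = _

        -- At each d at most one of the two restricted factors differs from 1, so the two products
        -- merge into one family indexed by d. For odd d the root q is exchanged for q², which gives
        -- odd and even factors the same root and makes `coprime` applicable across parities.
        factor : ∀ d (odd? : Dec (d ℕ.∣ n × 1 ℕ.< d × ¬ (2 ℕ.∣ d))) (even? : Dec (d ℕ.∣ n × 1 ℕ.< d × 2 ℕ.∣ d)) →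
          Factor R (q ^ 2) d ((A d when odd?) * (B d when even?)) × ((A d when odd?) * (B d when even?)) ∣ S
        factor d (yes (_ , _ , 2∤d)) (yes (_ , _ , 2∣d)) = contradiction 2∣d 2∤d
        factor d (yes (d∣n , 1<d , 2∤d)) (no _) =
          cyclotomic (A d) (*-identityʳ (A d)) d≢0 square , ∣-respˡ-≈ (sym (*-identityʳ (A d)))
            (root-∣-sum 1<d d∣n square (odd-root-neg 2∤d (A-root d d≢0)))
          where
          open Parity (R / A d)
          d≢0 : NonZero d
          d≢0 = 1<d⇒nonZero 1<d
          square : IsPrimitiveRoot (R / A d) (q ^ 2) d
          square = square-root {{d≢0}} 2∤d (A-root d d≢0)
        factor d (no _) (yes (d∣n , 1<d , 2∣d)) =
          cyclotomic (B d) (*-identityˡ (B d)) d≢0 (B-root d d≢0) , ∣-respˡ-≈ (sym (*-identityˡ (B d)))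
            (root-∣-sum 1<d d∣n (B-root d d≢0) (Parity.even-root-neg (R / B d) 2∣d (B-root d d≢0)))
          where
          d≢0 : NonZero d
          d≢0 = 1<d⇒nonZero 1<d
        factor d (no _) (no _) = trivial (*-identityˡ 1#) , S , trans (*-congˡ (*-identityˡ 1#)) (*-identityʳ S)

        odd? : ∀ d → Dec (d ℕ.∣ n × 1 ℕ.< d × ¬ (2 ℕ.∣ d))
        odd? d = d ∣? n ×-dec 1 <? d ×-dec ¬? (2 ∣? d)
        even? : ∀ d → Dec (d ℕ.∣ n × 1 ℕ.< d × 2 ℕ.∣ d)
        even? d = d ∣? n ×-dec 1 <? d ×-dec 2 ∣? d

      cyclotomic-product-∣-sum :
        prod (suc n) (λ d → A d when (d ∣? n ×-dec 1 <? d ×-dec ¬? (2 ∣? d)))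
        * prod (suc n) (λ d → B d when (d ∣? n ×-dec 1 <? d ×-dec 2 ∣? d)) ∣ sum< n (term n)
      cyclotomic-product-∣-sum = ∣-respˡ-≈
        (Product.∑-distrib-+ {suc n} (λ d → A (toℕ d) when odd? (toℕ d)) (λ d → B (toℕ d) when even? (toℕ d)))
        (prod-factors-∣ (suc n) (λ d → (A d when odd? d) * (B d when even? d))
          (λ d _ → proj₁ (factor d (odd? d) (even? d))) (λ d _ → proj₂ (factor d (odd? d) (even? d))))

-- The substitution of q² for q

module LocalisationMap {c ℓ : Level} (R : CommutativeRing c ℓ) (t : CommutativeRing.Carrier R)
  (t-cancel : ∀ {a b} → CommutativeRing._≈_ R (CommutativeRing._*_ R t a) (CommutativeRing._*_ R t b)
                      → CommutativeRing._≈_ R a b) where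

  open Localisation R t t-cancel
  private
    module R = RingNotation R
    open SetoidReasoning R.setoid

    same-den : ∀ {a b m n} → m ≡ n → a R.≈ b → a /t^ m ≃ b /t^ n
    same-den ≡.refl a≈b .cross = R.*-congˡ a≈b

  module Square (h : R.Carrier → R.Carrier) (h-hom : IsRingHomomorphism R.rawRing R.rawRing h)
    (ht≈t² : h t R.≈ t R.^ 2) where

    private
      open IsRingHomomorphism h-hom renaming (⟦⟧-cong to h-cong)
      open RingMorphism R R h h-hom using (^-homo)

      h-power : ∀ n → h (t R.^ n) R.≈ t R.^ (2 ℕ.* n)
      h-power n = R.trans (^-homo ht≈t² n) (R.^-assocʳ t 2 n)

    square-map : Fraction → Fraction
    square-map (a /t^ n) = h a /t^ (2 ℕ.* n)

    square-map-cong : ∀ {x y} → x ≃ y → square-map x ≃ square-map y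
    square-map-cong {a /t^ m} {b /t^ n} (mk≃ e) = mk≃ (begin
      t R.^ (2 ℕ.* n) R.* h a      ≈⟨ R.*-congʳ (h-power n) ⟨
      h (t R.^ n) R.* h a          ≈⟨ *-homo _ _ ⟨
      h (t R.^ n R.* a)            ≈⟨ h-cong e ⟩
      h (t R.^ m R.* b)            ≈⟨ *-homo _ _ ⟩
      h (t R.^ m) R.* h b          ≈⟨ R.*-congʳ (h-power m) ⟩
      t R.^ (2 ℕ.* m) R.* h b      ∎)

    square-map-+ : ∀ x y → square-map (x + y) ≃ square-map x + square-map y
    square-map-+ (a /t^ m) (b /t^ n) = same-den (ℕ.*-distribˡ-+ 2 m n) (begin
      h (t R.^ n R.* a R.+ t R.^ m R.* b)                  ≈⟨ +-homo _ _ ⟩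
      h (t R.^ n R.* a) R.+ h (t R.^ m R.* b)              ≈⟨ R.+-cong (*-homo _ _) (*-homo _ _) ⟩
      h (t R.^ n) R.* h a R.+ h (t R.^ m) R.* h b          ≈⟨ R.+-cong (R.*-congʳ (h-power n)) (R.*-congʳ (h-power m)) ⟩
      t R.^ (2 ℕ.* n) R.* h a R.+ t R.^ (2 ℕ.* m) R.* h b  ∎)

    square-map-* : ∀ x y → square-map (x * y) ≃ square-map x * square-map y
    square-map-* (a /t^ m) (b /t^ n) = same-den (ℕ.*-distribˡ-+ 2 m n) (*-homo a b)

    square-map-hom : IsRingHomomorphism (CommutativeRing.rawRing commutativeRing)
                                        (CommutativeRing.rawRing commutativeRing) square-map
    square-map-hom = ringHomomorphism commutativeRing commutativeRing square-map
      square-map-cong square-map-+ square-map-* (mk≃ (R.*-congˡ 1#-homo))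

module PolynomialMapMorphism {a ℓ₁ b ℓ₂ : Level} (R : CommutativeRing a ℓ₁) (S : CommutativeRing b ℓ₂)
  (f : CommutativeRing.Carrier R → CommutativeRing.Carrier S)
  (f-hom : IsRingHomomorphism (CommutativeRing.rawRing R) (CommutativeRing.rawRing S) f) where

  open PolynomialMap R S f f-hom
  private
    module R = Polynomial R
    module S = CommutativeRing S
    open Polynomial S
    open IsRingHomomorphism f-hom

  map-hom : IsRingHomomorphism (CommutativeRing.rawRing R.commutativeRing) (CommutativeRing.rawRing commutativeRing) map
  map-hom = ringHomomorphism R.commutativeRing commutativeRing map
    (λ {p} {r} e → mk≋ λ i → S.trans (coeff-map p i) (S.trans (⟦⟧-cong (R.at e i)) (S.sym (coeff-map r i))))
    map-+ map-* map-1#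

module Substitution where

  open Polynomial ℤ.+-*-commutativeRing
  open QPolynomials using () renaming (_⟨q²⟩ to sub)
  private module Q = RingNotation ℤ[q]-ring

  sub-cong : ∀ {p r} → p ≋ r → sub p ≋ sub r
  sub-cong {[]}    {[]}    e = ≋-refl
  sub-cong {[]}    {b ∷ r} e = ≋-sym (∷-tail (≡.sym (e .at 0)) (∷-tail ≡.refl (≋-sym (sub-cong {[]} {r} (tail-cong e)))))
  sub-cong {a ∷ p} {[]}    e = ∷-tail (e .at 0) (∷-tail ≡.refl (sub-cong {p} {[]} (tail-cong e)))
  sub-cong {a ∷ p} {b ∷ r} e = ∷-cong (e .at 0) (∷-cong ≡.refl (sub-cong (tail-cong e)))

  sub-+ : ∀ p r → sub (p + r) ≋ sub p + sub r
  sub-+ []      r       = ≋-refl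
  sub-+ (a ∷ p) []      = ≋-refl
  sub-+ (a ∷ p) (b ∷ r) = ∷-cong ≡.refl (∷-cong ≡.refl (sub-+ p r))

  sub-· : ∀ a p → sub (a · p) ≋ a · sub p
  sub-· a []      = ≋-refl
  sub-· a (b ∷ p) = ∷-cong ≡.refl (∷-cong (≡.sym (ℤ.*-zeroʳ a)) (sub-· a p))

  sub-* : ∀ p r → sub (p * r) ≋ sub p * sub r
  sub-* []      r = ≋-refl
  sub-* (a ∷ p) r = ≋-trans (sub-+ (a · r) (+ 0 ∷ p * r)) (+-cong (sub-· a r)
    (∷-cong ≡.refl (≋-trans (∷-cong ≡.refl (sub-* p r)) (≋-sym (0∷-* (sub p) (sub r))))))

  sub-hom : IsRingHomomorphism Q.rawRing Q.rawRing sub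
  sub-hom = ringHomomorphism ℤ[q]-ring ℤ[q]-ring sub sub-cong sub-+ sub-* (∷-cong ≡.refl (0∷[]≋[] ≡.refl))

  sub-q : sub q ≋ q Q.^ 2
  sub-q = mk≋ λ where
    0 → ≡.refl
    1 → ≡.refl
    2 → ≡.refl
    3 → ≡.refl
    (suc (suc (suc (suc i)))) → ≡.refl

-- Brackets and q-binomials as exact quotients

module QBinomials where

  open RingNotation ℤ[q]-ring hiding (zero)
  open FiniteProducts ℤ[q]-ring
  open QAnalogues ℤ[q]-ring
  open QPolynomials using (qbinomial) renaming ([_] to bracket)
  open IntegerPolynomials using (UnitConstant; unitConstant-resp; unitConstant-prod; ÷-exact′)
  open Polynomial ℤ.+-*-commutativeRing using (coeff-+; coeff-*-0)
  open SetoidReasoning setoid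

  bracket≈int : ∀ n → bracket n ≈ int q n
  bracket≈int n = ÷-exact′ (1# - q ^ n) (1# - q) (int q n) ≡.refl (int-telescope′ q n)

  int-unit : ∀ n → UnitConstant (int q (suc n))
  int-unit n = ≡.cong (λ a → a ℤ.* a) (≡.trans (coeff-+ 1# (q * int q n) 0)
    (≡.cong (λ a → + 1 ℤ.+ a) (coeff-*-0 q (int q n))))

  -- The denominator has constant coefficient ±1, so the product formula `gauss-*` identifies the
  -- coefficientwise quotient.
  qbinomial≈gauss : ∀ n k → qbinomial n k ≈ gauss q n k
  qbinomial≈gauss n k = ÷-exact′ (prod k (λ j → bracket (n ℕ.∸ j))) (prod k (λ j → bracket (suc j))) (gauss q n k)
    (unitConstant-prod k (λ j → bracket (suc j)) λ j _ → unitConstant-resp (sym (bracket≈int (suc j))) (int-unit j))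
    (begin
      gauss q n k * prod k (λ j → bracket (suc j))
        ≈⟨ *-congˡ {gauss q n k} (prod-cong k λ j _ → bracket≈int (suc j)) ⟩
      gauss q n k * prod k (λ j → int q (suc j))
        ≈⟨ gauss-* q n k ⟩
      prod k (λ j → int q (n ℕ.∸ j))
        ≈⟨ prod-cong k (λ j _ → bracket≈int (n ℕ.∸ j)) ⟨
      prod k (λ j → bracket (n ℕ.∸ j)) ∎)

-- Specialisation to Laurent polynomials

module Instance where

  open QPolynomials using (qbinomial) renaming (_⟨q²⟩ to sub; [_] to bracket)
  open WPolynomials using (ι; w; _⟨q²⟩ₓ; q^_; const; x)
  open Substitution
  open QBinomials
  open IntegerPolynomials using (UnitConstant; unitConstant-torsion-free)
  open Polynomial ℤ.+-*-commutativeRing using (_÷_)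
  private
    module Q where
      open RingNotation ℤ[q]-ring public
      open QAnalogues ℤ[q]-ring public
    module L = RingNotation ℤ[q,q⁻¹]-ring
  open RingNotation ℤ[q,q⁻¹][x]-ring hiding (zero)
  open QAnalogues ℤ[q,q⁻¹][x]-ring
  open FiniteSums ℤ[q,q⁻¹][x]-ring

  fromBase-hom : IsRingHomomorphism Q.rawRing L.rawRing Laurent.fromBase
  fromBase-hom = LocalisationTorsion.fromBase-hom ℤ[q]-ring q _

  const-hom : IsRingHomomorphism L.rawRing rawRing const
  const-hom = PolynomialTorsion.C-hom ℤ[q,q⁻¹]-ring

  ι-hom : IsRingHomomorphism Q.rawRing rawRing ι
  ι-hom = Composition.isRingHomomorphism trans fromBase-hom const-hom

  laurent-sub : L.Carrier → L.Carrier
  laurent-sub (a Laurent./t^ n) = sub a Laurent./t^ (2 ℕ.* n)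

  laurent-sub-hom : IsRingHomomorphism L.rawRing L.rawRing laurent-sub
  laurent-sub-hom = LocalisationMap.Square.square-map-hom ℤ[q]-ring q _ sub sub-hom sub-q

  ⟨q²⟩ₓ-hom : IsRingHomomorphism rawRing rawRing _⟨q²⟩ₓ
  ⟨q²⟩ₓ-hom = PolynomialMapMorphism.map-hom ℤ[q,q⁻¹]-ring ℤ[q,q⁻¹]-ring laurent-sub laurent-sub-hom

  η : ℤ[q] → Carrier
  η a = ι (sub a)

  η-hom : IsRingHomomorphism Q.rawRing rawRing η
  η-hom = Composition.isRingHomomorphism trans sub-hom ι-hom

  laurent-η : L.Carrier → Carrier
  laurent-η a = const (laurent-sub a)

  laurent-η-hom : IsRingHomomorphism L.rawRing rawRing laurent-η
  laurent-η-hom = Composition.isRingHomomorphism trans laurent-sub-hom const-hom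

  module ιH = RingMorphism ℤ[q]-ring ℤ[q,q⁻¹][x]-ring ι ι-hom
  module ηH = RingMorphism ℤ[q]-ring ℤ[q,q⁻¹][x]-ring η η-hom

  𝐪 : Carrier
  𝐪 = ι q

  η-q : η q ≈ 𝐪 ^ 2
  η-q = trans (IsRingHomomorphism.⟦⟧-cong ι-hom {sub q} {q Q.^ 2} sub-q) (ιH.^-homo {q} {𝐪} refl 2)

  ι-bracket : ∀ n → ι (bracket n) ≈ int 𝐪 n
  ι-bracket n = trans (IsRingHomomorphism.⟦⟧-cong ι-hom {bracket n} {Q.int q n} (bracket≈int n)) (ιH.int-homo {q} {𝐪} refl n)

  η-bracket : ∀ n → η (bracket n) ≈ int (𝐪 ^ 2) n
  η-bracket n = trans (IsRingHomomorphism.⟦⟧-cong η-hom {bracket n} {Q.int q n} (bracket≈int n)) (ηH.int-homo {q} {𝐪 ^ 2} η-q n)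

  -- Integer exponents enter the argument only through this equation, where a compensating power m
  -- makes the total exponent a natural number.
  q^-* : ∀ e m n → e ℤ.+ + m ≡ + n → q^ e L.* Laurent.fromBase (q Q.^ m) L.≈ Laurent.fromBase (q Q.^ n)
  q^-* (+ k)    m n eq = Laurent.mk≃ (Q.*-congˡ {Q.1#} (Q.trans (Q.sym (Q.^-homo-* q k m))
    (Q.reflexive (≡.cong (q Q.^_) (ℤ.+-injective eq)))))
  q^-* -[1+ k ] m n eq = Laurent.mk≃ (begin
    Q.1# Q.* (Q.1# Q.* q Q.^ m)                ≈⟨ Q.*-identityˡ (Q.1# Q.* q Q.^ m) ⟩
    Q.1# Q.* q Q.^ m                           ≈⟨ Q.*-identityˡ (q Q.^ m) ⟩
    q Q.^ m                                    ≡⟨ ≡.cong (q Q.^_) m≡ ⟩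
    q Q.^ (suc k ℕ.+ 0 ℕ.+ n)                  ≈⟨ Q.^-homo-* q (suc k ℕ.+ 0) n ⟩
    q Q.^ (suc k ℕ.+ 0) Q.* q Q.^ n            ∎)
    where
    open SetoidReasoning Q.setoid
    m≡ : m ≡ suc k ℕ.+ 0 ℕ.+ n
    m≡ = ℤ.+-injective (≡.trans (≡.sym (cancelled (+ suc k) (+ m))) (≡.trans (≡.cong (λ e → + suc k ℤ.+ e) eq)
      (≡.cong (λ j → + (j ℕ.+ n)) (≡.sym (ℕ.+-identityʳ (suc k))))))
      where
      cancelled : ∀ a b → a ℤ.+ (ℤ.- a ℤ.+ b) ≡ b
      cancelled a b = ≡.trans (≡.sym (ℤ.+-assoc a (ℤ.- a) b))
        (≡.trans (≡.cong (λ c → c ℤ.+ b) (ℤ.+-inverseʳ a)) (ℤ.+-identityˡ b))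

  exponent : ℕ → ℕ → ℕ → ℤ
  exponent α k i = + α ℤ.* (+ (suc (suc i) ℕ.C 2) ℤ.- + (suc k ℕ.* i))

  -- Restoring the subtracted α(k+1)i leaves α times the binomial (i+2 choose 2), independent of k.
  -- This independence is what allows `scale` to be the same for k and its reflection.
  exponent-+ : ∀ α k i → exponent α k i ℤ.+ + (α ℕ.* (suc k ℕ.* i)) ≡ + (α ℕ.* (suc (suc i) ℕ.C 2))
  exponent-+ α k i = begin
    + α ℤ.* (a ℤ.- b) ℤ.+ + (α ℕ.* (suc k ℕ.* i))  ≡⟨ ≡.cong (λ c → + α ℤ.* (a ℤ.- b) ℤ.+ c) (ℤ.pos-* α (suc k ℕ.* i)) ⟩
    + α ℤ.* (a ℤ.- b) ℤ.+ + α ℤ.* b                ≡⟨ ℤ.*-distribˡ-+ (+ α) (a ℤ.- b) b ⟨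
    + α ℤ.* (a ℤ.- b ℤ.+ b)                        ≡⟨ ≡.cong (+ α ℤ.*_) (ℤ.+-assoc a (ℤ.- b) b) ⟩
    + α ℤ.* (a ℤ.+ (ℤ.- b ℤ.+ b))                  ≡⟨ ≡.cong (λ c → + α ℤ.* (a ℤ.+ c)) (ℤ.+-inverseˡ b) ⟩
    + α ℤ.* (a ℤ.+ + 0)                            ≡⟨ ≡.cong (+ α ℤ.*_) (ℤ.+-identityʳ a) ⟩
    + α ℤ.* a                                      ≡⟨ ℤ.pos-* α (suc (suc i) ℕ.C 2) ⟨
    + (α ℕ.* (suc (suc i) ℕ.C 2))                  ∎
    where
    open SetoidReasoning (≡.setoid ℤ)
    a = + (suc (suc i) ℕ.C 2)
    b = + (suc k ℕ.* i)

  unit : ℕ → ℕ → ℕ → Carrier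
  unit α k i = laurent-η (q^ exponent α k i)

  scale : ℕ → ℕ → Carrier
  scale α i = (𝐪 ^ 2) ^ (α ℕ.* (suc (suc i) ℕ.C 2))

  unit-* : ∀ α k i → unit α k i * (𝐪 ^ 2) ^ (α ℕ.* (suc k ℕ.* i)) ≈ scale α i
  unit-* α k i = begin
    unit α k i * (𝐪 ^ 2) ^ m
      ≈⟨ *-congˡ {unit α k i} (ηH.^-homo {q} {𝐪 ^ 2} η-q m) ⟨
    unit α k i * η (q Q.^ m)
      ≈⟨ IsRingHomomorphism.*-homo laurent-η-hom e (Laurent.fromBase (q Q.^ m)) ⟨
    laurent-η (e L.* Laurent.fromBase (q Q.^ m))
      ≈⟨ IsRingHomomorphism.⟦⟧-cong laurent-η-hom {e L.* Laurent.fromBase (q Q.^ m)} {Laurent.fromBase (q Q.^ n)}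
           (q^-* (exponent α k i) m n (exponent-+ α k i)) ⟩
    η (q Q.^ n)
      ≈⟨ ηH.^-homo {q} {𝐪 ^ 2} η-q n ⟩
    scale α i ∎
    where
    open SetoidReasoning setoid
    m = α ℕ.* (suc k ℕ.* i)
    n = α ℕ.* (suc (suc i) ℕ.C 2)
    e = q^ exponent α k i

  difference : ℕ → ℕ → ℤ[q]
  difference k i = qbinomial (k ℕ.∸ 1) i Q.* qbinomial (k ℕ.+ suc i) (suc i)
             Q.- qbinomial k (suc i) Q.* qbinomial (k ℕ.+ suc i) i

  η-difference : ∀ k i → η (difference k i) ≈ narayana (𝐪 ^ 2) k i
  η-difference k i = trans
    (IsRingHomomorphism.⟦⟧-cong η-hom {difference k i} {Q.narayana q k i}
      (Q.+-cong (Q.*-cong (qbinomial≈gauss (k ℕ.∸ 1) i) (qbinomial≈gauss (k ℕ.+ suc i) (suc i)))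
        (Q.-‿cong (Q.*-cong (qbinomial≈gauss k (suc i)) (qbinomial≈gauss (k ℕ.+ suc i) i)))))
    (ηH.narayana-homo {q} {𝐪 ^ 2} η-q k i)

  w-term : ℕ → ℕ → ℕ → Carrier
  w-term α k i = const (q^ exponent α k i L.* Laurent.fromBase (difference k i Q.^ α)) * x ^ i

  w-term⟨q²⟩ : ∀ α k i → (w-term α k i) ⟨q²⟩ₓ ≈ unit α k i * narayana (𝐪 ^ 2) k i ^ α * x ^ i
  w-term⟨q²⟩ α k i = begin
    (w-term α k i) ⟨q²⟩ₓ
      ≈⟨ S.*-homo (const (e L.* d)) (x ^ i) ⟩
    laurent-η (e L.* d) * (x ^ i) ⟨q²⟩ₓ
      ≈⟨ *-cong (IsRingHomomorphism.*-homo laurent-η-hom e d) (SH.^-homo {x} {x} x-fixed i) ⟩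
    unit α k i * η (difference k i Q.^ α) * x ^ i
      ≈⟨ *-congʳ {x ^ i} (*-congˡ {unit α k i} (ηH.^-homo {difference k i} (η-difference k i) α)) ⟩
    unit α k i * narayana (𝐪 ^ 2) k i ^ α * x ^ i ∎
    where
    open SetoidReasoning setoid
    module S = IsRingHomomorphism ⟨q²⟩ₓ-hom
    module SH = RingMorphism ℤ[q,q⁻¹][x]-ring ℤ[q,q⁻¹][x]-ring _⟨q²⟩ₓ ⟨q²⟩ₓ-hom
    e = q^ exponent α k i
    d = Laurent.fromBase (difference k i Q.^ α)
    x-fixed : x ⟨q²⟩ₓ ≈ x
    x-fixed = PolynomialMap.map-X ℤ[q,q⁻¹]-ring ℤ[q,q⁻¹]-ring laurent-sub laurent-sub-hom

  w⟨q²⟩ : ∀ α k → (w α k) ⟨q²⟩ₓ ≈ sum< k (λ i → unit α k i * narayana (𝐪 ^ 2) k i ^ α * x ^ i)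
  w⟨q²⟩ α k = RingMorphism.sum-homo ℤ[q,q⁻¹][x]-ring ℤ[q,q⁻¹][x]-ring _⟨q²⟩ₓ ⟨q²⟩ₓ-hom k
    {λ i → w-term α k (toℕ i)} (λ i → w-term⟨q²⟩ α k (toℕ i))

  ι-torsion-free : ∀ f → UnitConstant f → Quotient.TorsionFree ℤ[q,q⁻¹][x]-ring (ι f)
  ι-torsion-free f u = PolynomialTorsion.C-torsion-free ℤ[q,q⁻¹]-ring
    (LocalisationTorsion.fromBase-torsion-free ℤ[q]-ring q _ {f}
      (λ n {b} (k , e) → unitConstant-torsion-free n f u k b e))

  sub-unitConstant : ∀ p → UnitConstant p → UnitConstant (sub p)
  sub-unitConstant (a ∷ p) u = u

  module _ (Φ : ℕ → ℤ[q])
    (Φ-unfold : ∀ d → Φ d ≡ (q Q.^ d Q.- Q.1#) ÷ (Q.∏-syntax d (λ e → Φ (toℕ e) Q.when (toℕ e ∣? d))))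
    (α m n r : ℕ) .{{_ : NonZero α}} .{{_ : NonZero r}} where

    open CyclotomicPolynomials.Recursive Φ Φ-unfold using (isCyclotomic; module IsCyclotomic)

    private
      ι-root : ∀ d → NonZero d → IsPrimitiveRoot (ℤ[q,q⁻¹][x]-ring / ι (Φ d)) 𝐪 d
      ι-root d d≢0 = root-transport ℤ[q]-ring ℤ[q,q⁻¹][x]-ring ι ι-hom {Φ d} {q} {𝐪} {d} refl
        (ι-torsion-free (Φ d) (IsCyclotomic.unit (isCyclotomic d d≢0))) (IsCyclotomic.root (isCyclotomic d d≢0))

      η-root : ∀ d → NonZero d → IsPrimitiveRoot (ℤ[q,q⁻¹][x]-ring / η (Φ d)) (𝐪 ^ 2) d
      η-root d d≢0 = root-transport ℤ[q]-ring ℤ[q,q⁻¹][x]-ring η η-hom {Φ d} {q} {𝐪 ^ 2} {d} η-q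
        (ι-torsion-free (sub (Φ d)) (sub-unitConstant (Φ d) (IsCyclotomic.unit (isCyclotomic d d≢0)))) (IsCyclotomic.root (isCyclotomic d d≢0))

      open SumDivisibility.Summands ℤ[q,q⁻¹][x]-ring 𝐪 x α m r (unit α) (scale α) (unit-* α)

      summand : ℕ → Carrier
      summand k = (- 1#) ^ k
        * ι (bracket (k ℕ.* (k ℕ.+ 1)) ⟨q²⟩) ^ r
        * ι (bracket (2 ℕ.* k ℕ.+ 1))
        * ι q ^ ((n ℕ.∸ 1 ℕ.∸ k) ℕ.* (2 ℕ.* α ℕ.* m ℕ.+ 1))
        * ((w α k) ⟨q²⟩ₓ) ^ m
        where open QPolynomials using (_⟨q²⟩)

      summand≈term : ∀ k → term n k ≈ summand k
      summand≈term k = sym (*-cong (*-cong (*-cong (*-congˡ {(- 1#) ^ k}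
        (^-congˡ r (η-bracket (k ℕ.* (k ℕ.+ 1))))) (ι-bracket (2 ℕ.* k ℕ.+ 1))) refl) (^-congˡ m (w⟨q²⟩ α k)))

    cyclotomic-product-∣ :
      (∏[ d ≤ n ] (ι (Φ (toℕ d)) when (toℕ d ∣? n ×-dec 1 <? toℕ d ×-dec ¬? (2 ∣? toℕ d))))
      * (∏[ d ≤ n ] (η (Φ (toℕ d)) when (toℕ d ∣? n ×-dec 1 <? toℕ d ×-dec 2 ∣? toℕ d)))
      ∣ sum< n summand
    cyclotomic-product-∣ = let (k , e) = cyclotomic-product-∣-sum (ι ∘ Φ) (η ∘ Φ) ι-root η-root n in
      k , trans e (sum<-cong n {term n} {summand} (λ i _ → summand≈term i))

open import Defs

theorem2 : (α m n r : ℕ) .{{_ : NonZero α}} .{{_ : NonZero m}} .{{_ : NonZero n}} .{{_ : NonZero r}} →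
  (∏[ d ≤ n ] (ι (Φ (toℕ d))      when (toℕ d ∣? n ×-dec 1 <? toℕ d ×-dec ¬? (2 ∣? toℕ d))))
  * (∏[ d ≤ n ] (ι (Φ (toℕ d) ⟨q²⟩) when (toℕ d ∣? n ×-dec 1 <? toℕ d ×-dec 2 ∣? toℕ d)))
  ∣
  ∑[ k < n ]
    ( (- 1#) ^ toℕ k
    * ι ([ toℕ k ℕ.* (toℕ k ℕ.+ 1) ] ⟨q²⟩) ^ r
    * ι [ 2 ℕ.* toℕ k ℕ.+ 1 ]
    * ι q ^ ((n ℕ.∸ 1 ℕ.∸ toℕ k) ℕ.* (2 ℕ.* α ℕ.* m ℕ.+ 1))
    * (w α (toℕ k) ⟨q²⟩ₓ) ^ m )
theorem2 α m n r = Instance.cyclotomic-product-∣ Φ QPolynomials.Φ-unfold α m n r
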